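{- Let $k\ge 2$ be an integer and, for $j\ge 1$, let $\lambda^{(j)}$ be the largest zero of $G_j(x)$. Then $\bigcup_{j=1}^{\infty}(\lambda^{(j)},\lambda^{(j+1)}]=(0,2\sqrt{k-1})$. Moreover, if an integer $t\ge 4$ and a real number $\theta$ satisfy $\lambda^{(t-3)}<\theta\le\lambda^{(t-2)}$, then $$b(k,\theta)\le M(k,t,c)=2\left(\sum_{i=0}^{t-4}(k-1)^i+\frac{(k-1)^{t-3}}{c}+\frac{(k-1)^{t-2}}{c}\right),$$ where $c=-F_{t-2}(\theta)/G_{t-4}(\theta)$.
   Context: Graphs are finite and simple. $b(k,\theta)$ denotes the maximum order (number of vertices) of a connected bipartite $k$-regular graph $\Gamma$ with $\lambda_2(\Gamma)\le\theta$, where $\lambda_2(\Gamma)$ is the second largest eigenvalue of the adjacency matrix of $\Gamma$ (counted with multiplicity). For the integer $k\ge 2$ define polynomials $F_i(x)$ by $F_0(x)=1$, $F_1(x)=x$, $F_2(x)=x^2-k$, and $F_i(x)=xF_{i-1}(x)-(k-1)F_{i-2}(x)$ for $i\ge 3$; and $G_i(x)=\sum_{j=0}^{\lfloor i/2\rfloor}F_{i-2j}(x)$ for $i\ge 0$. -}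

module Defs where

open import Algebra.Bundles using (CommutativeRing)
open import Data.Bool.Base using (Bool; true; false; T)
open import Data.Fin.Base using (Fin; toℕ)
open import Data.Fin.Subset using (∣_∣)
open import Data.List.Base using (List; _∷_; filter; length)
open import Data.List.Relation.Unary.Linked using (Linked)
open import Data.Nat.Base as ℕ using (ℕ; zero; suc; ⌊_/2⌋; _∸_)
open import Data.Product.Base using (∃; ∃₂; Σ-syntax; _×_; proj₁)
import Data.Vec.Base as Vec
open import Data.Vec.Functional using (Vector)
open import Level using (0ℓ) renaming (suc to lsuc)
open import Relation.Binary.Construct.Closure.ReflexiveTransitive using (Star)
import Relation.Binary.Construct.StrictToNonStrict as StrictToNonStrict
open import Relation.Binary.Core using (Rel)
open import Relation.Binary.PropositionalEquality.Core using (_≡_; _≢_)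
open import Relation.Binary.Structures using (IsStrictTotalOrder)
open import Relation.Nullary.Negation.Core using (¬_)

-- The standard axioms for ℝ, which determine it up to unique isomorphism
-- (of ordered fields, with respect to _≈_).  They are meant to be read
-- together with excluded middle: deciding the order and the existence of
-- arbitrary suprema are classical principles.

record CompleteOrderedField : Set (lsuc 0ℓ) where
  infix 4 _<_
  field
    commutativeRing : CommutativeRing 0ℓ 0ℓ

  open CommutativeRing commutativeRing public

  field
    _<_                : Rel Carrier 0ℓ
    isStrictTotalOrder : IsStrictTotalOrder _≈_ _<_

  open IsStrictTotalOrder isStrictTotalOrder public
    using (compare; _≟_; _<?_)
  open StrictToNonStrict _≈_ _<_ public using (_≤_)

  infix 4 _≥_
  _≥_ : Rel Carrier 0ℓ
  x ≥ y = y ≤ x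

  IsUpperBound : (Carrier → Set) → Carrier → Set
  IsUpperBound P u = ∀ x → P x → x ≤ u

  field
    0<1     : 0# < 1#
    +-monoˡ : ∀ z {x y} → x < y → (x + z) < (y + z)
    *-pos   : ∀ {x y} → 0# < x → 0# < y → 0# < (x * y)
    inverse : ∀ x → x ≉ 0# → Σ[ y ∈ Carrier ] x * y ≈ 1#
    sup     : ∀ (P : Carrier → Set) → ∃ P → ∃ (IsUpperBound P) →
              Σ[ s ∈ Carrier ] IsUpperBound P s × (∀ u → IsUpperBound P u → s ≤ u)

record Graph (n : ℕ) : Set where
  field
    adj       : Fin n → Fin n → Bool
    symmetric : ∀ i j → adj i j ≡ adj j i
    loopless  : ∀ i → ¬ T (adj i i)

  Adjacent : Rel (Fin n) 0ℓ
  Adjacent i j = T (adj i j)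

  degree : Fin n → ℕ
  degree i = ∣ Vec.tabulate (adj i) ∣

  Regular : ℕ → Set
  Regular k = ∀ i → degree i ≡ k

  Connected : Set
  Connected = ∀ i j → Star Adjacent i j

  Bipartite : Set
  Bipartite = Σ[ side ∈ (Fin n → Bool) ] (∀ i j → Adjacent i j → side i ≢ side j)

module Theory (ℝ : CompleteOrderedField) where
  open CompleteOrderedField ℝ
  open import Algebra.Properties.Semiring.Exp semiring using (_^_)
  open import Algebra.Properties.Semiring.Mult semiring using ()
    renaming (_×_ to _·_)
  open import Algebra.Properties.Semiring.Sum semiring
    using (sum-syntax; sum⁺-syntax)

  fromℕ : ℕ → Carrier
  fromℕ n = n · 1#

  _÷_[_] : (x y : Carrier) → y ≉ 0# → Carrier
  x ÷ y [ y≉0 ] = x * proj₁ (inverse y y≉0)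

  IsSqrt : Carrier → Carrier → Set
  IsSqrt s x = 0# ≤ s × s * s ≈ x

  IsLargestZero : (Carrier → Carrier) → Carrier → Set
  IsLargestZero f z = f z ≈ 0# × (∀ y → f y ≈ 0# → y ≤ z)

  Matrix : ℕ → Set
  Matrix n = Fin n → Fin n → Carrier

  -- The zero vector is included.
  InEigenspace : ∀ {n} → Matrix n → Carrier → Vector Carrier n → Set
  InEigenspace {n} A μ v = ∀ i → ∑[ j < n ] (A i j * v j) ≈ μ * v i

  LinearlyIndependent : ∀ {m n} → (Fin m → Vector Carrier n) → Set
  LinearlyIndependent {m} v =
    ∀ (a : Vector Carrier m) →
    (∀ i → ∑[ l < m ] (a l * v l i) ≈ 0#) → ∀ l → a l ≈ 0#

  InSpan : ∀ {m n} → (Fin m → Vector Carrier n) → Vector Carrier n → Set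
  InSpan {m} v w =
    Σ[ a ∈ Vector Carrier m ] (∀ i → w i ≈ ∑[ l < m ] (a l * v l i))

  -- "μ has multiplicity m"; in particular multiplicity 0 says that μ is
  -- not an eigenvalue.
  HasMultiplicity : ∀ {n} → Matrix n → Carrier → ℕ → Set
  HasMultiplicity {n} A μ m =
    Σ[ v ∈ (Fin m → Vector Carrier n) ]
      (∀ l → InEigenspace A μ (v l)) ×
      LinearlyIndependent v ×
      (∀ w → InEigenspace A μ w → InSpan v w)

  count : Carrier → List Carrier → ℕ
  count μ μs = length (filter (μ ≟_) μs)

  -- All eigenvalues in non-increasing order, each repeated according to
  -- its multiplicity.  The length of the list is not prescribed, so
  -- diagonalisability is not presupposed.
  IsEigenvalueList : ∀ {n} → Matrix n → List Carrier → Set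
  IsEigenvalueList A μs =
    Linked _≥_ μs × (∀ μ → HasMultiplicity A μ (count μ μs))

  IsSecondEigenvalue : ∀ {n} → Matrix n → Carrier → Set
  IsSecondEigenvalue A μ₂ = ∃₂ λ μ₁ μs → IsEigenvalueList A (μ₁ ∷ μ₂ ∷ μs)

  indicator : Bool → Carrier
  indicator true  = 1#
  indicator false = 0#

  adjacencyMatrix : ∀ {n} → Graph n → Matrix n
  adjacencyMatrix Γ i j = indicator (Graph.adj Γ i j)

  λ₂[_]≤_ : ∀ {n} → Graph n → Carrier → Set
  λ₂[ Γ ]≤ θ = Σ[ μ ∈ Carrier ] IsSecondEigenvalue (adjacencyMatrix Γ) μ × μ ≤ θ

  Admissible : ℕ → Carrier → ∀ {n} → Graph n → Set
  Admissible k θ Γ =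
    Connected × Bipartite × Regular k × (λ₂[ Γ ]≤ θ)
    where open Graph Γ

  IsMaxOrder : ℕ → Carrier → ℕ → Set
  IsMaxOrder k θ b =
    (Σ[ Γ ∈ Graph b ] Admissible k θ Γ) ×
    (∀ n (Γ : Graph n) → Admissible k θ Γ → n ℕ.≤ b)

  -- F k i and G k i are polynomial functions: only zeros and values matter.

  F : ℕ → ℕ → Carrier → Carrier
  F k 0                   x = 1#
  F k 1                   x = x
  F k 2                   x = x ^ 2 - fromℕ k
  F k (suc (suc (suc i))) x =
    x * F k (suc (suc i)) x - (fromℕ k - 1#) * F k (suc i) x

  G : ℕ → ℕ → Carrier → Carrier
  G k i x = ∑[ j ≤ ⌊ i /2⌋ ] F k (i ∸ 2 ℕ.* toℕ j) x

  -- Meant for t ≥ 4, where ∸ is ordinary subtraction.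
  M : (k t : ℕ) (c : Carrier) → c ≉ 0# → Carrier
  M k t c c≉0 =
    fromℕ 2 * ((∑[ i ≤ t ∸ 4 ] (κ ^ toℕ i))
               + (κ ^ (t ∸ 3)) ÷ c [ c≉0 ]
               + (κ ^ (t ∸ 2)) ÷ c [ c≉0 ])
    where κ = fromℕ k - 1#

{-# OPTIONS --safe #-}
-- Put q = k − 1.  The polynomials G satisfy G (i+2) = x G (i+1) − q G i, and the Christoffel–Darboux
-- formula shows that G (i+1) / G i increases beyond the largest zero of G i; so the largest
-- zeros increase and lie below 2√q, and they exhaust (0, 2√q) because at a fixed x < 2√q the
-- ratios G (i+1) / G i would otherwise decrease by a fixed amount at every step.
--
-- For the bound write e = t − 4, a i = G i (θ), A for the adjacency matrix and γ i = G i (A) δ u for a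
-- vertex u.  The entries of F i (A) count non-backtracking walks, so those of γ i are natural
-- numbers.  For W = Σ q^(e−i) (a i) (γ i), over the i ≤ e of the parity of e, Christoffel–Darboux gives
--   (A² − θ²) W = (a e) γ (e+2) − a (e+2) γ e =: P.
-- Off the eigenvectors of ±k, i.e. 𝟙 and the sign vector of the bipartition, A² ≤ θ²; hence
-- n ⟨W , P⟩ ≤ 2 (k² − θ²) ⟨W , 𝟙⟩² = 2 ⟨P , 𝟙⟩ ⟨W , 𝟙⟩.  As a (e+2) ≤ 0 < a e and W · γ e ≥ W entrywise,
-- also ⟨W , P⟩ ≥ (a e − a (e+2)) ⟨W , 𝟙⟩.  With c = 1 − a (e+2) / a e this is the claim.  The graph
-- K k,k, whose second eigenvalue is 0, shows that the maximum is over a nonempty set.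

module Submission where

open import Algebra.Bundles using (CommutativeRing)
import Algebra.Solver.Ring
open import Algebra.Solver.Ring.AlmostCommutativeRing using
    (fromCommutativeRing; _-Raw-AlmostCommutative⟶_)
open import Axiom.ExcludedMiddle using (ExcludedMiddle)
open import Data.Bool.Base using (Bool; true; false; T; not; _xor_)
open import Data.Bool.Properties using (xor-comm; xor-same)
open import Data.Empty using (⊥; ⊥-elim)
open import Data.Fin.Base using (Fin; zero; suc; toℕ; _↑ˡ_; _↑ʳ_; splitAt; join)
open import Data.Fin.Properties using (splitAt-↑ˡ; splitAt-↑ʳ; join-splitAt)
open import Data.Fin.Subset using (∣_∣)
open import Data.Integer.Base as ℤ using (ℤ; +_; -[1+_])
import Data.Integer.Properties as ℤ
open import Data.List.Base using (List; []; _∷_; length; replicate; _++_; [_])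
import Data.List.Properties as List
open import Data.List.Relation.Unary.All as All using (_∷_)
open import Data.List.Relation.Unary.AllPairs using (_∷_)
open import Data.List.Relation.Unary.Linked as Linked using (Linked; [-]; _∷_)
open import Data.List.Relation.Unary.Linked.Properties using (Linked⇒AllPairs)
open import Data.Maybe.Base using (Maybe; just; nothing)
open import Data.Nat.Base as ℕ using (ℕ; zero; suc; _∸_; ⌊_/2⌋)
import Data.Nat.Properties as ℕ
open import Data.Product.Base using (∃; Σ-syntax; _×_; _,_; proj₁; proj₂)
open import Data.Sum.Base using (_⊎_; inj₁; inj₂; [_,_]′)
open import Data.Unit.Base using (⊤; tt)
import Data.Vec.Base as Vec
open import Data.Vec.Functional using (Vector)
open import Function.Base using (_∘_)
open import Function.Bundles using (_⇔_; mk⇔)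
open import Level using (0ℓ)
open import Relation.Binary.Construct.Closure.ReflexiveTransitive as Closure using (Star; _◅_)
open import Relation.Binary.Bundles using (StrictPartialOrder)
import Relation.Binary.Construct.StrictToNonStrict as StrictToNonStrict
open import Relation.Binary.Definitions using (tri<; tri≈; tri>)
open import Relation.Binary.PropositionalEquality.Core as ≡ using (_≡_)
open import Relation.Binary.Structures using (IsStrictTotalOrder)
open import Relation.Nullary using (¬_; Dec; yes; no; contradiction)
open import Defs


-- The spectral hypothesis is a list of eigenvalues with geometric multiplicities; no
-- diagonalisation comes with it. So the bound `A² ≤ θ²` off `𝟙` and the sign vector `σ` has to be
-- extracted from completeness of the field. The matrix `B = A − η (𝟙 𝟙ᵀ − σ σᵀ)` has `±θ` in place
-- of `±κ`. An eigenvector of `B` above `θ` would be orthogonal to `𝟙` and `σ`, hence a second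
-- independent eigenvector of `A` above `θ`, which the list forbids. As the supremum of the Rayleigh
-- quotient is always an eigenvalue when it exceeds `θ`, this gives `B ≤ θ`. Conjugation by `σ`
-- turns `B` into `−B`, so `−θ ≤ B` as well, and a polynomial identity combines both into `B² ≤ θ²`.
-- Compactness of the sphere is replaced by elimination: a symmetric form is either coercive or
-- nonpositive at some nonzero vector. The factor 2 of `M` reflects the two exceptional
-- eigenvectors: on nonnegative vectors the `σ` component is at most the `𝟙` component. Integrality
-- of walk counts serves only to get `γ e ≥ 1` on the support of `W`.

-- A ring solver with integer coefficients.

module IntegerCoefficientSolver {c ℓ} (R : CommutativeRing c ℓ) where
  open CommutativeRing R
  open import Algebra.Properties.Ring ring
    using (-‿distribˡ-*; -‿distribʳ-*; -0#≈0#; -‿involutive)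
  open import Algebra.Properties.AbelianGroup +-abelianGroup using (⁻¹-∙-comm; xyx⁻¹≈y)
  open import Algebra.Definitions.RawMonoid +-rawMonoid using (_×′_)
  open import Algebra.Properties.Semiring.Mult.TCOptimised semiring
    using (1+×; ×-homo-+; ×1-homo-*)
  open import Relation.Binary.Reasoning.Setoid setoid

  private
    ⟦_⟧ : ℤ → Carrier
    ⟦ + n ⟧      = n ×′ 1#
    ⟦ -[1+ n ] ⟧ = - (suc n ×′ 1#)

    -‿homo : ∀ i → ⟦ ℤ.- i ⟧ ≈ - ⟦ i ⟧
    -‿homo (+ zero)  = sym -0#≈0#
    -‿homo (+ suc n) = refl
    -‿homo -[1+ n ]  = sym (-‿involutive _)

    ⊖-homo : ∀ m n → ⟦ m ℤ.⊖ n ⟧ ≈ m ×′ 1# - n ×′ 1#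
    ⊖-homo zero    zero    = sym (-‿inverseʳ 0#)
    ⊖-homo zero    (suc n) = sym (+-identityˡ _)
    ⊖-homo (suc m) zero    = sym (trans (+-congˡ -0#≈0#) (+-identityʳ _))
    ⊖-homo (suc m) (suc n) rewrite ℤ.[1+m]⊖[1+n]≡m⊖n m n = begin
      ⟦ m ℤ.⊖ n ⟧                                    ≈⟨ ⊖-homo m n ⟩
      a - b                                          ≈⟨ +-congʳ (xyx⁻¹≈y 1# a) ⟨
      1# + a - 1# - b                                ≈⟨ +-assoc _ _ _ ⟩
      1# + a + (- 1# - b)                            ≈⟨ +-congˡ (⁻¹-∙-comm 1# b) ⟩
      1# + a - (1# + b)                              ≈⟨ +-cong (1+× m 1#) (-‿cong (1+× n 1#)) ⟨
      suc m ×′ 1# - suc n ×′ 1#                      ∎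
      where a = m ×′ 1# ; b = n ×′ 1#

    +-homo : ∀ i j → ⟦ i ℤ.+ j ⟧ ≈ ⟦ i ⟧ + ⟦ j ⟧
    +-homo (+ m)    (+ n)    = ×-homo-+ 1# m n
    +-homo (+ m)    -[1+ n ] = ⊖-homo m (suc n)
    +-homo -[1+ m ] (+ n)    = trans (⊖-homo n (suc m)) (+-comm _ _)
    +-homo -[1+ m ] -[1+ n ] = begin
      - (suc (suc (m ℕ.+ n)) ×′ 1#)        ≡⟨ ≡.cong (λ k → - (k ×′ 1#)) (ℕ.+-suc (suc m) n) ⟨
      - ((suc m ℕ.+ suc n) ×′ 1#)          ≈⟨ -‿cong (×-homo-+ 1# (suc m) (suc n)) ⟩
      - (suc m ×′ 1# + suc n ×′ 1#)        ≈⟨ ⁻¹-∙-comm _ _ ⟨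
      - (suc m ×′ 1#) - suc n ×′ 1#        ∎

    +*-homo : ∀ m j → ⟦ + m ℤ.* j ⟧ ≈ m ×′ 1# * ⟦ j ⟧
    +*-homo m (+ n) rewrite ≡.sym (ℤ.pos-* m n) = ×1-homo-* m n
    +*-homo m -[1+ n ] = begin
      ⟦ + m ℤ.* ℤ.- (+ suc n) ⟧       ≡⟨ ≡.cong ⟦_⟧ (ℤ.neg-distribʳ-* (+ m) (+ suc n)) ⟨
      ⟦ ℤ.- (+ m ℤ.* + suc n) ⟧       ≈⟨ -‿homo (+ m ℤ.* + suc n) ⟩
      - ⟦ + m ℤ.* + suc n ⟧           ≈⟨ -‿cong (+*-homo m (+ suc n)) ⟩
      - (m ×′ 1# * suc n ×′ 1#)     ≈⟨ -‿distribʳ-* _ _ ⟩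
      m ×′ 1# * - (suc n ×′ 1#)     ∎

    *-homo : ∀ i j → ⟦ i ℤ.* j ⟧ ≈ ⟦ i ⟧ * ⟦ j ⟧
    *-homo (+ m)    j = +*-homo m j
    *-homo -[1+ m ] j = begin
      ⟦ ℤ.- (+ suc m) ℤ.* j ⟧         ≡⟨ ≡.cong ⟦_⟧ (ℤ.neg-distribˡ-* (+ suc m) j) ⟨
      ⟦ ℤ.- (+ suc m ℤ.* j) ⟧         ≈⟨ -‿homo (+ suc m ℤ.* j) ⟩
      - ⟦ + suc m ℤ.* j ⟧             ≈⟨ -‿cong (+*-homo (suc m) j) ⟩
      - (suc m ×′ 1# * ⟦ j ⟧)       ≈⟨ -‿distribˡ-* _ _ ⟩
      - (suc m ×′ 1#) * ⟦ j ⟧       ∎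

    morphism : ℤ.+-*-rawRing -Raw-AlmostCommutative⟶ fromCommutativeRing R
    morphism = record
      { ⟦_⟧ = ⟦_⟧ ; +-homo = +-homo ; *-homo = *-homo ; -‿homo = -‿homo
      ; 0-homo = refl ; 1-homo = refl }

    -- Coefficients are compared as integers, where equality computes. Distinct integers may still
    -- agree in `R`, hence only a `Maybe`.
    coeff≟ : ∀ i j → Maybe (⟦ i ⟧ ≈ ⟦ j ⟧)
    coeff≟ i j with i ℤ.≟ j
    ... | yes ≡.refl = just refl
    ... | no _       = nothing

  open Algebra.Solver.Ring ℤ.+-*-rawRing (fromCommutativeRing R) morphism coeff≟ public
    using (Polynomial; solve; _:=_; con; _:+_; _:*_; _:-_; :-_)

  :0 :1 :2 : ∀ {n} → Polynomial n
  :0 = con (+ 0)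
  :1 = con (+ 1)
  :2 = con (+ 2)

-- Arithmetic of a complete ordered field.

module Real (ℝ : CompleteOrderedField) where
  open CompleteOrderedField ℝ public hiding (zero)
  open IsStrictTotalOrder isStrictTotalOrder public
    using (isStrictPartialOrder; <-resp-≈; <-respˡ-≈; <-respʳ-≈)
    renaming (trans to <-trans; irrefl to <-irrefl)
  open Theory ℝ public
  open IntegerCoefficientSolver commutativeRing public
  open import Algebra.Properties.Ring ring public using (-0#≈0#)

  strictPartialOrder : StrictPartialOrder 0ℓ 0ℓ 0ℓ
  strictPartialOrder = record { isStrictPartialOrder = isStrictPartialOrder }

  open import Relation.Binary.Reasoning.StrictPartialOrder strictPartialOrder public
  private module NS = StrictToNonStrict _≈_ _<_

  <⇒≤ : ∀ {x y} → x < y → x ≤ y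
  <⇒≤ = inj₁

  ≤-refl : ∀ {x} → x ≤ x
  ≤-refl = inj₂ refl

  ≤-reflexive : ∀ {x y} → x ≈ y → x ≤ y
  ≤-reflexive = inj₂

  ≤-trans : ∀ {x y z} → x ≤ y → y ≤ z → x ≤ z
  ≤-trans = NS.trans isEquivalence <-resp-≈ <-trans

  <-≤-trans : ∀ {x y z} → x < y → y ≤ z → x < z
  <-≤-trans = NS.<-≤-trans <-trans <-respʳ-≈

  ≤-<-trans : ∀ {x y z} → x ≤ y → y < z → x < z
  ≤-<-trans = NS.≤-<-trans sym <-trans <-respˡ-≈

  <⇒≱ : ∀ {x y} → x < y → ¬ (y ≤ x)
  <⇒≱ x<y y≤x = <-irrefl refl (<-≤-trans x<y y≤x)

  <⇒≉ : ∀ {x y} → x < y → y ≉ x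
  <⇒≉ x<y y≈x = <-irrefl (sym y≈x) x<y

  <-≤-connex : ∀ x y → x < y ⊎ y ≤ x
  <-≤-connex x y with compare x y
  ... | tri< x<y _ _ = inj₁ x<y
  ... | tri≈ _ x≈y _ = inj₂ (inj₂ (sym x≈y))
  ... | tri> _ _ y<x = inj₂ (inj₁ y<x)

  ≮⇒≥ : ∀ {x y} → ¬ (x < y) → y ≤ x
  ≮⇒≥ {x} {y} x≮y with <-≤-connex x y
  ... | inj₁ x<y = contradiction x<y x≮y
  ... | inj₂ y≤x = y≤x

  ≤∧≉⇒< : ∀ {x y} → x ≤ y → y ≉ x → x < y
  ≤∧≉⇒< (inj₁ x<y) _   = x<y
  ≤∧≉⇒< (inj₂ x≈y) y≉x = contradiction (sym x≈y) y≉x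

  x-x≈0 : ∀ {x y} → x ≈ y → x - y ≈ 0#
  x-x≈0 {x} {y} x≈y = trans (+-congʳ x≈y) (-‿inverseʳ y)

  x-y≈0⇒x≈y : ∀ {x y} → x - y ≈ 0# → x ≈ y
  x-y≈0⇒x≈y {x} {y} eq = begin-equality
    x             ≈⟨ solve 2 (λ x y → x := (x :- y) :+ y) refl x y ⟩
    (x - y) + y   ≈⟨ +-congʳ eq ⟩
    0# + y        ≈⟨ +-identityˡ y ⟩
    y             ∎

  0<y-x : ∀ {x y} → x < y → 0# < y - x
  0<y-x {x} x<y = <-respˡ-≈ (-‿inverseʳ x) (+-monoˡ (- x) x<y)

  0≤y-x : ∀ {x y} → x ≤ y → 0# ≤ y - x
  0≤y-x (inj₁ x<y) = inj₁ (0<y-x x<y)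
  0≤y-x (inj₂ x≈y) = inj₂ (sym (x-x≈0 (sym x≈y)))

  -- The rules <-by, …, ≈-by₃ deduce a relation from given ones by a linear
  -- combination; the side condition is a ring identity.
  <-by : ∀ {x y p} → 0# < p → y - x ≈ p → x < y
  <-by {x} {y} {p} 0<p eq = begin-strict
    x             ≈⟨ +-identityˡ x ⟨
    0# + x        <⟨ +-monoˡ x 0<p ⟩
    p + x         ≈⟨ +-congʳ eq ⟨
    (y - x) + x   ≈⟨ solve 2 (λ x y → (y :- x) :+ x := y) refl x y ⟩
    y             ∎

  ≤-by : ∀ {x y p} → 0# ≤ p → y - x ≈ p → x ≤ y
  ≤-by (inj₁ 0<p) eq = inj₁ (<-by 0<p eq)
  ≤-by (inj₂ 0≈p) eq = inj₂ (sym (x-y≈0⇒x≈y (trans eq (sym 0≈p))))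

  ≈-by : ∀ {x y e₁ e₂} r → e₁ ≈ e₂ → x - y ≈ r * (e₁ - e₂) → x ≈ y
  ≈-by r e eq = x-y≈0⇒x≈y (trans eq (trans (*-congˡ (x-x≈0 e)) (zeroʳ r)))

  ≈-by₂ : ∀ {x y e₁ e₂ f₁ f₂} r s → e₁ ≈ e₂ → f₁ ≈ f₂ →
          x - y ≈ r * (e₁ - e₂) + s * (f₁ - f₂) → x ≈ y
  ≈-by₂ r s e f eq = x-y≈0⇒x≈y (trans eq (trans
    (+-cong (trans (*-congˡ (x-x≈0 e)) (zeroʳ r)) (trans (*-congˡ (x-x≈0 f)) (zeroʳ s)))
    (+-identityˡ 0#)))

  ≈-by₃ : ∀ {x y e₁ e₂ f₁ f₂ g₁ g₂} r s t → e₁ ≈ e₂ → f₁ ≈ f₂ → g₁ ≈ g₂ →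
          x - y ≈ r * (e₁ - e₂) + s * (f₁ - f₂) + t * (g₁ - g₂) → x ≈ y
  ≈-by₃ r s t e f g eq = x-y≈0⇒x≈y (trans eq (trans
    (+-cong (trans (+-cong (trans (*-congˡ (x-x≈0 e)) (zeroʳ r))
                           (trans (*-congˡ (x-x≈0 f)) (zeroʳ s)))
                   (+-identityˡ 0#))
            (trans (*-congˡ (x-x≈0 g)) (zeroʳ t)))
    (+-identityˡ 0#)))

  +-nonneg : ∀ {x y} → 0# ≤ x → 0# ≤ y → 0# ≤ x + y
  +-nonneg {x} {y} 0≤x 0≤y = ≤-trans 0≤y
    (≤-by 0≤x (solve 2 (λ x y → (x :+ y) :- y := x) refl x y))

  +-pos-nonneg : ∀ {x y} → 0# < x → 0# ≤ y → 0# < x + y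
  +-pos-nonneg {x} {y} 0<x 0≤y = ≤-<-trans 0≤y
    (<-by 0<x (solve 2 (λ x y → (x :+ y) :- y := x) refl x y))

  +-nonneg-pos : ∀ {x y} → 0# ≤ x → 0# < y → 0# < x + y
  +-nonneg-pos {x} {y} 0≤x 0<y = <-respʳ-≈ (+-comm y x) (+-pos-nonneg 0<y 0≤x)

  +-pos : ∀ {x y} → 0# < x → 0# < y → 0# < x + y
  +-pos 0<x 0<y = +-pos-nonneg 0<x (<⇒≤ 0<y)

  *-nonneg : ∀ {x y} → 0# ≤ x → 0# ≤ y → 0# ≤ x * y
  *-nonneg (inj₁ 0<x) (inj₁ 0<y) = inj₁ (*-pos 0<x 0<y)
  *-nonneg {x} {y} (inj₂ 0≈x) _ = inj₂ (sym (trans (*-congʳ (sym 0≈x)) (zeroˡ y)))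
  *-nonneg {x} {y} (inj₁ _) (inj₂ 0≈y) = inj₂ (sym (trans (*-congˡ (sym 0≈y)) (zeroʳ x)))

  neg-pos : ∀ {x} → x < 0# → 0# < - x
  neg-pos {x} x<0 = <-respʳ-≈ (+-identityˡ (- x)) (0<y-x x<0)

  neg-nonneg : ∀ {x} → x ≤ 0# → 0# ≤ - x
  neg-nonneg {x} x≤0 = ≤-trans (0≤y-x x≤0) (≤-reflexive (+-identityˡ (- x)))

  sq-pos : ∀ {x} → x ≉ 0# → 0# < x * x
  sq-pos {x} x≉0 with compare 0# x
  ... | tri< 0<x _ _ = *-pos 0<x 0<x
  ... | tri≈ _ 0≈x _ = contradiction (sym 0≈x) x≉0
  ... | tri> _ _ x<0 = <-respʳ-≈ (solve 1 (λ x → :- x :* :- x := x :* x) refl x)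
                         (*-pos (neg-pos x<0) (neg-pos x<0))

  sq-nonneg : ∀ x → 0# ≤ x * x
  sq-nonneg x with x ≟ 0#
  ... | yes x≈0 = inj₂ (sym (trans (*-congʳ x≈0) (zeroˡ x)))
  ... | no  x≉0 = inj₁ (sq-pos x≉0)

  0≤1 : 0# ≤ 1#
  0≤1 = <⇒≤ 0<1

  -- Spelled `1# + 1#`, not `fromℕ 2`, so that the solver constant `:2` evaluates to it
  -- definitionally.
  2# : Carrier
  2# = 1# + 1#

  fromℕ-nonneg : ∀ n → 0# ≤ fromℕ n
  fromℕ-nonneg zero    = ≤-refl
  fromℕ-nonneg (suc n) = +-nonneg 0≤1 (fromℕ-nonneg n)

  0<2 : 0# < 2#
  0<2 = +-pos 0<1 0<1

  *-cancel-pos : ∀ {x y} → 0# < x → 0# < x * y → 0# < y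
  *-cancel-pos {x} {y} 0<x 0<xy with <-≤-connex 0# y
  ... | inj₁ 0<y = 0<y
  ... | inj₂ y≤0 = contradiction
    (≤-by (*-nonneg (<⇒≤ 0<x) (neg-nonneg y≤0))
          (solve 2 (λ x y → :0 :- x :* y := x :* :- y) refl x y)) (<⇒≱ 0<xy)

  *-cancel-nonneg : ∀ {x y} → 0# < x → 0# ≤ x * y → 0# ≤ y
  *-cancel-nonneg {x} {y} 0<x 0≤xy with <-≤-connex y 0#
  ... | inj₂ 0≤y = 0≤y
  ... | inj₁ y<0 = contradiction 0≤xy
    (<⇒≱ (<-by (*-pos 0<x (neg-pos y<0))
          (solve 2 (λ x y → :0 :- x :* y := x :* :- y) refl x y)))

  *-nonzero : ∀ {x y} → x ≉ 0# → x * y ≈ 0# → y ≈ 0#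
  *-nonzero {x} {y} x≉0 xy≈0 = let (x⁻¹ , xx⁻¹≈1) = inverse x x≉0 in
    ≈-by₂ (- y) x⁻¹ xx⁻¹≈1 xy≈0
      (solve 3 (λ x y i → y :- :0 := :- y :* (x :* i :- :1) :+ i :* (x :* y :- :0))
        refl x y x⁻¹)

  inverse-pos : ∀ {x} → 0# < x → Σ[ y ∈ Carrier ] 0# < y × x * y ≈ 1#
  inverse-pos {x} 0<x = let (y , xy≈1) = inverse x (<⇒≉ 0<x) in
    y , *-cancel-pos 0<x (<-respʳ-≈ (sym xy≈1) 0<1) , xy≈1

  half : ∀ {x} → 0# < x → Σ[ y ∈ Carrier ] 0# < y × y < x
  half {x} 0<x = let (h , 0<h , 2h≈1) = inverse-pos 0<2 in
    x * h , *-pos 0<x 0<h , <-by (*-pos 0<x 0<h) (≈-by (- x) 2h≈1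
      (solve 2 (λ x h → x :- x :* h :- x :* h := :- x :* (:2 :* h :- :1)) refl x h))

  -- If the multiples of `ε` were bounded, their supremum less `ε` would still bound them, since
  -- each multiple is followed by another one.
  archimedean : ∀ {ε} x → 0# < ε → (∀ (P : Set) → Dec P) → Σ[ j ∈ ℕ ] x < fromℕ j * ε
  archimedean {ε} x 0<ε em with em (Σ[ j ∈ ℕ ] x < fromℕ j * ε)
  ... | yes p = p
  ... | no ¬p = contradiction (lub (s - ε) below) (<⇒≱ (<-by 0<ε
         (solve 2 (λ s e → s :- (s :- e) := e) refl s ε)))
    where
    Multiple : Carrier → Set
    Multiple y = Σ[ j ∈ ℕ ] y ≈ fromℕ j * ε
    supremum = sup Multiple (0# , 0 , sym (zeroˡ ε))
      (x , λ { y (j , y≈jε) → ≤-trans (≤-reflexive y≈jε) (≮⇒≥ λ x<jε → ¬p (j , x<jε)) })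
    s = proj₁ supremum
    lub = proj₂ (proj₂ supremum)
    below : IsUpperBound Multiple (s - ε)
    below y (j , y≈jε) = ≤-by
      (0≤y-x (proj₁ (proj₂ supremum) (fromℕ (suc j) * ε) (suc j , refl)))
      (≈-by (- 1#) y≈jε (solve 4 (λ s e y j →
          (s :- e :- y) :- (s :- (:1 :+ j) :* e) := :- :1 :* (y :- j :* e))
        refl s ε y (fromℕ j)))

-- The intermediate value theorem for Lipschitz functions.

module Intermediate (ℝ : CompleteOrderedField) where
  open Real ℝ

  AbsBound : Carrier → Carrier → Set
  AbsBound b a = a ≤ b × - a ≤ b

  bound-nonneg : ∀ {a b} → AbsBound b a → 0# ≤ b
  bound-nonneg {a} {b} (a≤b , -a≤b) = *-cancel-nonneg 0<2
    (≤-by (+-nonneg (0≤y-x a≤b) (0≤y-x -a≤b))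
      (solve 2 (λ a b → :2 :* b :- :0 := (b :- a) :+ (b :- :- a)) refl a b))

  bound-resp : ∀ {a a′ b b′} → a ≈ a′ → b ≈ b′ → AbsBound b a → AbsBound b′ a′
  bound-resp a≈a′ b≈b′ (p , n) =
    ≤-trans (≤-reflexive (sym a≈a′)) (≤-trans p (≤-reflexive b≈b′)) ,
    ≤-trans (≤-reflexive (-‿cong (sym a≈a′))) (≤-trans n (≤-reflexive b≈b′))

  bound-weaken : ∀ {a b b′} → b ≤ b′ → AbsBound b a → AbsBound b′ a
  bound-weaken b≤b′ (p , n) = ≤-trans p b≤b′ , ≤-trans n b≤b′

  bound-+ : ∀ {a b a′ b′} → AbsBound b a → AbsBound b′ a′ → AbsBound (b + b′) (a + a′)
  bound-+ {a} {b} {a′} {b′} (p , n) (p′ , n′) =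
    ≤-by (+-nonneg (0≤y-x p) (0≤y-x p′))
      (solve 4 (λ a b a′ b′ → b :+ b′ :- (a :+ a′) := (b :- a) :+ (b′ :- a′)) refl a b a′ b′) ,
    ≤-by (+-nonneg (0≤y-x n) (0≤y-x n′))
      (solve 4 (λ a b a′ b′ → b :+ b′ :- (:- (a :+ a′)) := (b :- :- a) :+ (b′ :- :- a′)) refl a b a′ b′)

  bound-neg : ∀ {a b} → AbsBound b a → AbsBound b (- a)
  bound-neg {a} (p , n) = n , ≤-trans (≤-reflexive (solve 1 (λ a → :- :- a := a) refl a)) p

  bound-* : ∀ {r R a b} → 0# ≤ r → r ≤ R → AbsBound b a → AbsBound (R * b) (r * a)
  bound-* {r} {R} {a} {b} 0≤r r≤R ab@(p , n) =
    ≤-by (+-nonneg (*-nonneg (0≤y-x r≤R) 0≤b) (*-nonneg 0≤r (0≤y-x p)))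
      (solve 4 (λ r R a b → R :* b :- r :* a := (R :- r) :* b :+ r :* (b :- a)) refl r R a b) ,
    ≤-by (+-nonneg (*-nonneg (0≤y-x r≤R) 0≤b) (*-nonneg 0≤r (0≤y-x n)))
      (solve 4 (λ r R a b → R :* b :- (:- (r :* a)) := (R :- r) :* b :+ r :* (b :- :- a)) refl r R a b)
    where 0≤b = bound-nonneg ab

  -- An explicit substitute for continuity on `[0, B]`. The bound on values is kept next to the one
  -- on slopes because the slope of a product involves the values of its factors.
  record Lipschitz (B : Carrier) (f : Carrier → Carrier) : Set where
    field
      K       : Carrier
      0≤K     : 0# ≤ K
      bounded : ∀ {y} → 0# ≤ y → y ≤ B → AbsBound K (f y)
      slope   : ∀ {x y} → 0# ≤ y → y ≤ x → x ≤ B → AbsBound (K * (x - y)) (f x - f y)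

  private
    -- Climbing from a nonpositive value to `fz` with slope at most `K` takes a distance of at least
    -- `fz / (K + 1)`. The factor `κ` is `1 / (K + 1)` because `K` itself may be zero.
    left-of-positive : ∀ {z fz κ y fy K} → 0# < κ → (K + 1#) * κ ≈ 1# → fy ≤ 0# →
      fz - fy ≤ K * (z - y) → y ≤ z → y ≤ z - fz * κ
    left-of-positive {z} {fz} {κ} {y} {fy} {K} 0<κ [K+1]κ≈1 fy≤0 slope y≤z = ≤-by
      (*-nonneg (<⇒≤ 0<κ) (+-nonneg (+-nonneg (0≤y-x slope) (neg-nonneg fy≤0)) (0≤y-x y≤z)))
      (≈-by (- (z - y)) [K+1]κ≈1
         (solve 6 (λ z fz i y fy K → (z :- fz :* i) :- y :- i :* ((K :* (z :- y) :- (fz :- fy)) :+ :- fy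
             :+ (z :- y))
             := :- (z :- y) :* ((K :+ :1) :* i :- :1))
           refl z fz κ y fy K))

    right-of-negative : ∀ {z fz κ y fy K} → 0# < κ → (K + 1#) * κ ≈ 1# → fz < 0# → 0# ≤ K →
      z ≤ y → y ≤ z - fz * κ → fy - fz ≤ K * (y - z) → fy ≤ 0#
    right-of-negative {z} {fz} {κ} {y} {fy} {K} 0<κ [K+1]κ≈1 fz<0 0≤K z≤y y≤ slope = ≤-by
      (+-nonneg (+-nonneg (0≤y-x slope) (0≤y-x z≤y)) (*-nonneg (+-nonneg 0≤K 0≤1) (0≤y-x y≤)))
      (≈-by fz [K+1]κ≈1
         (solve 6 (λ z fz i y fy K → (:0 :- fy)
               :- ((K :* (y :- z) :- (fy :- fz)) :+ (y :- z) :+ (K :+ :1) :* (z :- fz :* i :- y))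
              := fz :* ((K :+ :1) :* i :- :1))
            refl z fz κ y fy K))

  module _ {B f} (lip : Lipschitz B f) (f-cong : ∀ {x y} → x ≈ y → f x ≈ f y) where
    open Lipschitz lip

    private
      module AtSupremum {a b} (0≤a : 0# ≤ a) (a<b : a < b) (b≤B : b ≤ B)
        (fa<0 : f a < 0#) (0<fb : 0# < f b) {z κ}
        (0<κ : 0# < κ) ([K+1]κ≈1 : (K + 1#) * κ ≈ 1#)
        (upper : IsUpperBound (λ x → a ≤ x × x ≤ b × f x ≤ 0#) z)
        (least : ∀ u → IsUpperBound (λ x → a ≤ x × x ≤ b × f x ≤ 0#) u → z ≤ u) where

        a≤z : a ≤ z
        a≤z = upper a (≤-refl , <⇒≤ a<b , <⇒≤ fa<0)

        z≤b : z ≤ b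
        z≤b = least b (λ x p → proj₁ (proj₂ p))

        0≤z = ≤-trans 0≤a a≤z

        -- Were `f z` positive, `f` would be positive on a whole stretch to the left of `z`, whose
        -- left end would be a smaller upper bound.
        fz≯0 : ¬ (0# < f z)
        fz≯0 0<fz = <⇒≱ (<-by (*-pos 0<fz 0<κ)
            (solve 2 (λ z e → z :- (z :- e) := e) refl z (f z * κ)))
          (least (z - f z * κ) λ { y p@(a≤y , y≤b , fy≤0) → left-of-positive 0<κ [K+1]κ≈1 fy≤0
            (proj₁ (slope (≤-trans 0≤a a≤y) (upper y p) (≤-trans z≤b b≤B))) (upper y p) })

        -- Were `f z` negative, `f` would stay nonpositive up to `z - f z * κ`. Either this point is
        -- a member of the set beyond its supremum, or it lies past `b`, where `f` is positive.
        fz≮0 : ¬ (f z < 0#)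
        fz≮0 fz<0 with <-≤-connex b (z - f z * κ)
        ... | inj₂ y≤b = <⇒≱ z<y (upper _ (≤-trans a≤z (<⇒≤ z<y) , y≤b ,
            right-of-negative 0<κ [K+1]κ≈1 fz<0 0≤K (<⇒≤ z<y) ≤-refl
              (proj₁ (slope 0≤z (<⇒≤ z<y) (≤-trans y≤b b≤B)))))
          where
          z<y : z < z - f z * κ
          z<y = <-by (*-pos (neg-pos fz<0) 0<κ)
            (solve 3 (λ z f i → z :- f :* i :- z := :- f :* i) refl z (f z) κ)
        ... | inj₁ b<y = <⇒≱ 0<fb (right-of-negative 0<κ [K+1]κ≈1 fz<0 0≤K z≤b (<⇒≤ b<y)
                           (proj₁ (slope 0≤z z≤b b≤B)))

        fz≈0 : f z ≈ 0#
        fz≈0 with compare (f z) 0#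
        ... | tri< fz<0 _ _ = contradiction fz<0 fz≮0
        ... | tri≈ _ fz≈0 _ = fz≈0
        ... | tri> _ _ 0<fz = contradiction 0<fz fz≯0

        root : Σ[ z ∈ Carrier ] a < z × z < b × f z ≈ 0#
        root = z , ≤∧≉⇒< a≤z (λ z≈a → <-irrefl (trans (f-cong (sym z≈a)) fz≈0) fa<0) ,
          ≤∧≉⇒< z≤b (λ b≈z → <-irrefl (trans (sym fz≈0) (f-cong (sym b≈z))) 0<fb) , fz≈0

    intermediate-value : ∀ {a b} → 0# ≤ a → a < b → b ≤ B → f a < 0# → 0# < f b →
                         Σ[ z ∈ Carrier ] a < z × z < b × f z ≈ 0#
    intermediate-value {a} {b} 0≤a a<b b≤B fa<0 0<fb =
      let (κ , 0<κ , [K+1]κ≈1) = inverse-pos (+-nonneg-pos 0≤K 0<1)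
          (z , upper , least)  = sup (λ x → a ≤ x × x ≤ b × f x ≤ 0#)
            (a , ≤-refl , <⇒≤ a<b , <⇒≤ fa<0) (b , λ x p → proj₁ (proj₂ p))
      in AtSupremum.root 0≤a a<b b≤B fa<0 0<fb 0<κ [K+1]κ≈1 upper least

-- The polynomials `G` in recurrence form, and their largest zeros.

module Chebyshev (ℝ : CompleteOrderedField) (q : CompleteOrderedField.Carrier ℝ) where
  open Real ℝ
  open Intermediate ℝ

  -- The zeros of g i are 2√q cos(jπ/(i+1)), 1 ≤ j ≤ i.
  g : ℕ → Carrier → Carrier
  g 0             x = 1#
  g 1             x = x
  g (suc (suc i)) x = x * g (suc i) x - q * g i x

  g-cong : ∀ i {x y} → x ≈ y → g i x ≈ g i y
  g-cong 0             x≈y = refl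
  g-cong 1             x≈y = x≈y
  g-cong (suc (suc i)) x≈y =
    +-cong (*-cong x≈y (g-cong (suc i) x≈y)) (-‿cong (*-congˡ (g-cong i x≈y)))

  module _ (0<q : 0# < q) where

    g-lipschitz : ∀ {B} → 0# ≤ B → ∀ i → Lipschitz B (g i)
    g-lipschitz {B} 0≤B 0 = record
      { K = 1# ; 0≤K = 0≤1
      ; bounded = λ _ _ → ≤-refl , ≤-by 0<2′ (solve 0 (:1 :- :- :1 := :1 :+ :1) refl)
      ; slope = λ {x} {y} _ y≤x _ →
          ≤-by (0≤y-x y≤x) (solve 2 (λ x y → :1 :* (x :- y) :- (:1 :- :1) := x :- y) refl x y) ,
          ≤-by (0≤y-x y≤x) (solve 2 (λ x y → :1 :* (x :- y) :- (:- (:1 :- :1)) := x :- y) refl x y)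
      }
      where 0<2′ = <⇒≤ 0<2
    g-lipschitz {B} 0≤B 1 = record
      { K = 1# + B ; 0≤K = +-nonneg 0≤1 0≤B
      ; bounded = λ {y} 0≤y y≤B →
          ≤-by (+-nonneg 0≤1 (0≤y-x y≤B)) (solve 2 (λ B y → :1 :+ B :- y := :1 :+ (B :- y)) refl B y) ,
          ≤-by (+-nonneg 0≤1 (+-nonneg 0≤B 0≤y)) (solve 2 (λ B y → :1 :+ B :- :- y := :1 :+ (B :+ y)) refl
              B y)
      ; slope = λ {x} {y} _ y≤x _ →
          ≤-by (*-nonneg 0≤B (0≤y-x y≤x))
            (solve 3 (λ B x y → (:1 :+ B) :* (x :- y) :- (x :- y) := B :* (x :- y)) refl B x y) ,
          ≤-by (*-nonneg (+-nonneg (<⇒≤ 0<2) 0≤B) (0≤y-x y≤x))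
            (solve 3 (λ B x y → (:1 :+ B) :* (x :- y) :- (:- (x :- y)) := (:2 :+ B) :* (x :- y)) refl B x
                y)
      }
    g-lipschitz {B} 0≤B (suc (suc i)) = record
      -- From `x gx − y gy = x (gx − gy) + (x − y) gy`: the slope uses all three terms, the bound on
      -- values drops the middle one.
      { K = B * L.K + L.K + q * M.K
      ; 0≤K = +-nonneg (+-nonneg (*-nonneg 0≤B L.0≤K) L.0≤K) (*-nonneg (<⇒≤ 0<q) M.0≤K)
      ; bounded = λ {y} 0≤y y≤B → bound-weaken
          (≤-by L.0≤K (solve 3 (λ B l qm → B :* l :+ l :+ qm :- (B :* l :+ qm) := l) refl B L.K
              (q * M.K)))
          (bound-+ (bound-* 0≤y y≤B (L.bounded 0≤y y≤B))
                   (bound-neg (bound-* (<⇒≤ 0<q) ≤-refl (M.bounded 0≤y y≤B))))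
      ; slope = λ {x} {y} 0≤y y≤x x≤B → bound-resp
          (solve 7 (λ x y gx gy hx hy q →
              x :* (gx :- gy) :+ (x :- y) :* gy :+ :- (q :* (hx :- hy))
              := x :* gx :- q :* hx :- (y :* gy :- q :* hy))
            refl x y (g (suc i) x) (g (suc i) y) (g i x) (g i y) q)
          (solve 6 (λ x y B l m q → B :* (l :* (x :- y)) :+ (x :- y) :* l :+ q :* (m :* (x :- y))
              := (B :* l :+ l :+ q :* m) :* (x :- y)) refl x y B L.K M.K q)
          (bound-+ (bound-+ (bound-* (≤-trans 0≤y y≤x) x≤B (L.slope 0≤y y≤x x≤B))
                            (bound-* (0≤y-x y≤x) ≤-refl (L.bounded 0≤y (≤-trans y≤x x≤B))))
                   (bound-neg (bound-* (<⇒≤ 0<q) ≤-refl (M.slope 0≤y y≤x x≤B))))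
      }
      where
      module L = Lipschitz (g-lipschitz 0≤B (suc i))
      module M = Lipschitz (g-lipschitz 0≤B i)

    g-root : ∀ i {a b} → 0# ≤ a → a < b → g i a < 0# → 0# < g i b →
             Σ[ z ∈ Carrier ] a < z × z < b × g i z ≈ 0#
    g-root i {a} {b} 0≤a a<b = intermediate-value
      (g-lipschitz (≤-trans 0≤a (<⇒≤ a<b)) i) (g-cong i) 0≤a a<b ≤-refl

    -- The polynomial `g 2` is `x² − q`, so the square root is one of its zeros; at `1# + q` its
    -- value is `1 + q + q²`.
    sqrt-q : Σ[ s ∈ Carrier ] 0# < s × s * s ≈ q
    sqrt-q = let (s , 0<s , _ , g₂s≈0) = g-root 2 {0#} {1# + q} ≤-refl (+-pos 0<1 0<q)
                    (<-by 0<q (solve 1 (λ q → :0 :- (:0 :* :0 :- q :* :1) := q) refl q))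
                    (<-by (+-pos (+-pos 0<1 0<q) (*-pos 0<q 0<q))
                      (solve 1 (λ q → (:1 :+ q) :* (:1 :+ q) :- q :* :1 :- :0
                          := :1 :+ q :+ q :* q) refl q))
             in s , 0<s , ≈-by 1# g₂s≈0
                  (solve 2 (λ s q → s :* s :- q := :1 :* (s :* s :- q :* :1 :- :0)) refl s q)

    -- All indices are demanded at once because the induction runs over ratios of consecutive `g`,
    -- whose denominators must be positive. For `j ≥ 1` it turns out to be equivalent to
    -- `ρ (j ∸ 1) < x`.
    Positive : ℕ → Carrier → Set
    Positive zero    x = ⊤
    Positive (suc j) x = Positive j x × 0# < g (suc j) x

    positive-last : ∀ j {x} → Positive j x → 0# < g j x
    positive-last zero    _ = 0<1
    positive-last (suc j) p = proj₂ p

    positive-all : ∀ j {x} → Positive j x → ∀ i → i ℕ.≤ j → 0# < g i x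
    positive-all j       p       0       _ = 0<1
    positive-all (suc j) (p , r) (suc i) i≤j with ℕ.m≤n⇒m<n∨m≡n i≤j
    ... | inj₁ (ℕ.s≤s i<j) = positive-all j p (suc i) i<j
    ... | inj₂ ≡.refl      = r

    -- g (1+j) / g j is increasing on the half line where g 0, …, g j are positive, by
    -- the Christoffel–Darboux formula.
    positive-mono : ∀ j {x y} → y < x → Positive j y →
      Positive j x × 0# < g (suc j) x * g j y - g (suc j) y * g j x
    positive-mono zero {x} {y} y<x _ = tt , <-by (0<y-x y<x)
      (solve 2 (λ x y → x :* :1 :- y :* :1 :- :0 := x :- y) refl x y)
    positive-mono (suc j) {x} {y} y<x (p , 0<gy) =
      let (p′ , 0<D) = positive-mono j y<x p
          0<gx = *-cancel-pos (positive-last j p)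
            (<-by (+-pos 0<D (*-pos 0<gy (positive-last j p′)))
              (solve 4 (λ gx hx gy hy → hy :* gx :- :0 := (gx :* hy :- gy :* hx) :+ gy :* hx) refl
                 (g (suc j) x) (g j x) (g (suc j) y) (g j y)))
      in (p′ , 0<gx) , <-by (+-pos (*-pos (0<y-x y<x) (*-pos 0<gx 0<gy)) (*-pos 0<q 0<D))
           (solve 7 (λ x y gx hx gy hy q → (x :* gx :- q :* hx) :* gy :- (y :* gy :- q :* hy) :* gx :- :0
               := (x :- y) :* (gx :* gy) :+ q :* (gx :* hy :- gy :* hx)) refl
              x y (g (suc j) x) (g j x) (g (suc j) y) (g j y) q)

    -- The ratio `g (suc j) / g j` is nonnegative at `y` and strictly increasing, so even a zero at
    -- `y` gives strict positivity to its right.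
    positive-beyond : ∀ j {x y} → y < x → Positive j y → 0# ≤ g (suc j) y → Positive (suc j) x
    positive-beyond j {x} {y} y<x p 0≤gy =
      let (p′ , 0<D) = positive-mono j y<x p
      in p′ , *-cancel-pos (positive-last j p)
            (<-by (+-pos-nonneg 0<D (*-nonneg 0≤gy (<⇒≤ (positive-last j p′))))
              (solve 4 (λ gx hx gy hy → hy :* gx :- :0 := (gx :* hy :- gy :* hx) :+ gy :* hx) refl
                 (g (suc j) x) (g j x) (g (suc j) y) (g j y)))

    module _ {s : Carrier} (0<s : 0# < s) (s²≈q : s * s ≈ q) where

      -- At `2√q` the closed form is `g i = (i + 1) sⁱ`. The ratio bound reproduces itself because
      -- `2 s g′ − s² g − s g′ = s (g′ − s g)`. It makes `2s` a point where every `g i` is positive,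
      -- a right end for locating zeros.
      g[2s]-ratio : ∀ i → 0# < g i (2# * s) × s * g i (2# * s) ≤ g (suc i) (2# * s)
      g[2s]-ratio zero = 0<1 , ≤-by (<⇒≤ 0<s)
        (solve 1 (λ s → :2 :* s :- s :* :1 := s) refl s)
      g[2s]-ratio (suc i) = let (0<g , s*g≤g′) = g[2s]-ratio i in
        <-≤-trans (*-pos 0<s 0<g) s*g≤g′ ,
        ≤-by (*-nonneg (<⇒≤ 0<s) (0≤y-x s*g≤g′))
          (≈-by (g i (2# * s)) s²≈q
            (solve 4 (λ s q g g′ → :2 :* s :* g′ :- q :* g :- s :* g′
                 :- s :* (g′ :- s :* g) := g :* (s :* s :- q)) refl s q (g i (2# * s))
                     (g (suc i) (2# * s))))

      0<2s : 0# < 2# * s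
      0<2s = *-pos 0<2 0<s

      -- Indices are shifted: this concerns `g (suc j)`, as `g 0` has no zero. The field `positive`
      -- certifies maximality: beyond `root` the ratio `g (suc j) / g j` grows from zero.
      record LargestRoot (j : ℕ) : Set where
        field
          root     : Carrier
          0≤root   : 0# ≤ root
          root<2s  : root < 2# * s
          positive : Positive j root
          isRoot   : g (suc j) root ≈ 0#

        -- At a zero of `g (suc j)` the recurrence leaves only `− q g j`.
        g-negative : g (suc (suc j)) root < 0#
        g-negative = <-by (*-pos 0<q (positive-last j positive))
          (≈-by (- root) isRoot (solve 4 (λ x q g h → :0 :- (x :* g :- q :* h) :- q :* h
               := :- x :* (g :- :0)) refl root q (g (suc j) root) (g j root)))

      -- Any zero found between the old root and `2s` will do: beyond the old root all of `g 0`,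
      -- ..., `g (suc j)` are positive, so the next ratio increases there and vanishes at most once.
      nextRoot : ∀ {j} (r : LargestRoot j) →
        (Σ[ z ∈ Carrier ] LargestRoot.root r < z × z < 2# * s × g (suc (suc j)) z ≈ 0#) → LargestRoot
            (suc j)
      nextRoot {j} r (z , r<z , z<2s , gz≈0) = record
        { root = z ; 0≤root = ≤-trans 0≤root (<⇒≤ r<z) ; root<2s = z<2s
        ; positive = positive-beyond j r<z positive (≤-reflexive (sym isRoot))
        ; isRoot = gz≈0 }
        where open LargestRoot r

      abstract
        largestRoot : ∀ j → LargestRoot j
        largestRoot zero    = record
          { root = 0# ; 0≤root = ≤-refl ; root<2s = 0<2s ; positive = tt ; isRoot = refl }
        largestRoot (suc j) = nextRoot r
          (g-root (suc (suc j)) 0≤root root<2s g-negative (proj₁ (g[2s]-ratio (suc (suc j)))))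
          where
          r : LargestRoot j
          r = largestRoot j
          open LargestRoot r

      ρ : ℕ → Carrier
      ρ j = LargestRoot.root (largestRoot j)

      ρ<⇒positive : ∀ j {x} → ρ j < x → Positive (suc j) x
      ρ<⇒positive j r<x = positive-beyond j r<x positive (≤-reflexive (sym isRoot))
        where open LargestRoot (largestRoot j)

      ρ-largest : ∀ j y → g (suc j) y ≈ 0# → y ≤ ρ j
      ρ-largest j y gy≈0 = ≮⇒≥ λ r<y → <⇒≉ (proj₂ (ρ<⇒positive j r<y)) gy≈0

      -- Positivity propagates to the right, so a positive point cannot lie to the left of a zero.
      positive⇒ρ< : ∀ j {x} → Positive (suc j) x → ρ j < x
      positive⇒ρ< j {x} p with <-≤-connex (ρ j) x
      ... | inj₁ r<x = r<x
      ... | inj₂ (inj₁ x<r) = contradiction isRoot (<⇒≉ (proj₂ (proj₁ (positive-mono (suc j) x<r p))))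
        where open LargestRoot (largestRoot j)
      ... | inj₂ (inj₂ x≈r) = contradiction (trans (g-cong (suc j) x≈r) isRoot) (<⇒≉ (proj₂ p))
        where open LargestRoot (largestRoot j)

      ≤ρ⇒nonpositive : ∀ j {x} → Positive j x → x ≤ ρ j → g (suc j) x ≤ 0#
      ≤ρ⇒nonpositive j p x≤r = ≮⇒≥ λ 0<g → <⇒≱ (positive⇒ρ< j (p , 0<g)) x≤r

      bracket : ∀ j {x} → 0# < x → x ≤ ρ j → Σ[ i ∈ ℕ ] ρ i < x × x ≤ ρ (suc i)
      -- As `g 1` is the identity, `isRoot` says that `ρ 0` is zero; here the descent stops.
      bracket zero    0<x x≤r = contradiction
          (≤-trans x≤r (≤-reflexive (LargestRoot.isRoot (largestRoot 0)))) (<⇒≱ 0<x)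
      bracket (suc j) {x} 0<x x≤r =
        [ (λ r<x → j , r<x , x≤r) , bracket j 0<x ]′ (<-≤-connex (ρ j) x)

      module _ (em : ExcludedMiddle 0ℓ) where

        private
          -- A ratio of at most `x − m` is followed by one of at most `x − q / (x − m)`, and this is
          -- at most `x − (ε + m)` as soon as `(ε + m) (x − m) ≤ q`. The latter holds for every
          -- `m ≥ 0` because, with `4 x ε = 4 q − x²`, four times the difference is
          -- `(x − 2 m)² + 4 m ε`.
          decreasing-ratio : ∀ {x ε} → 0# < ε → 2# * 2# * x * ε ≈ 2# * 2# * q - x * x →
            (∀ i → 0# < g i x) → ∀ i → g (suc i) x ≤ (x - fromℕ i * ε) * g i x
          decreasing-ratio {x} {ε} _ _ _ zero =
            ≤-reflexive (solve 2 (λ x e → x := (x :- :0 :* e) :* :1) refl x ε)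
          decreasing-ratio {x} {ε} 0<ε 4xε≈ g-pos (suc i) = ≤-trans
            (step (fromℕ i * ε) (*-nonneg (fromℕ-nonneg i) (<⇒≤ 0<ε)) (g-pos i) (decreasing-ratio 0<ε 4xε≈
                g-pos i))
            (≤-reflexive (*-congʳ (+-congˡ (-‿cong
              (solve 2 (λ e n → e :+ n :* e := (:1 :+ n) :* e) refl ε (fromℕ i))))))
            where
            q-bound : ∀ m → 0# ≤ m → 0# ≤ q - (ε + m) * (x - m)
            q-bound m 0≤m = *-cancel-nonneg (*-pos 0<2 0<2) (≤-by
                   (+-nonneg (sq-nonneg (x - 2# * m)) (*-nonneg (<⇒≤ (*-pos 0<2 0<2))
                       (*-nonneg 0≤m (<⇒≤ 0<ε))))
                   (≈-by (- 1#) 4xε≈ (solve 4 (λ x q e m → let t = :2 in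
                      t :* t :* (q :- (e :+ m) :* (x :- m)) :- :0
                      :- ((x :- t :* m) :* (x :- t :* m) :+ t :* t :* (m :* e))
                      := :- :1 :* (t :* t :* x :* e :- (t :* t :* q :- x :* x))) refl x q ε m)))
            step : ∀ m {γ γ′} → 0# ≤ m → 0# < γ → γ′ ≤ (x - m) * γ →
                   x * γ′ - q * γ ≤ (x - (ε + m)) * γ′
            step m {γ} {γ′} 0≤m 0<γ γ′≤ = ≤-by
              (+-nonneg (*-nonneg (+-nonneg (<⇒≤ 0<ε) 0≤m) (0≤y-x γ′≤))
                  (*-nonneg (<⇒≤ 0<γ) (q-bound m 0≤m)))
              (solve 6 (λ x q e m g g′ →
                 (x :- (e :+ m)) :* g′ :- (x :* g′ :- q :* g)
                 := (e :+ m) :* ((x :- m) :* g :- g′) :+ g :* (q :- (e :+ m) :* (x :- m)))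
               refl x q ε m γ γ′)

          eventually-negative : ∀ {x m γ γ′} → x < m → 0# < γ → γ′ ≤ (x - m) * γ → ¬ (0# ≤ γ′)
          eventually-negative {x} {m} {γ} {γ′} x<m 0<γ γ′≤ =
            <⇒≱ (<-by (+-pos-nonneg (*-pos (0<y-x x<m) 0<γ) (0≤y-x γ′≤))
                 (solve 4 (λ x m g g′ → :0 :- g′ := (m :- x) :* g :+ ((x :- m) :* g :- g′)) refl
                   x m γ γ′))

          decrement : ∀ {x} → 0# < x → x < 2# * s →
            Σ[ ε ∈ Carrier ] 0# < ε × 2# * 2# * x * ε ≈ 2# * 2# * q - x * x
          decrement {x} 0<x x<2s = from-inverse (inverse-pos (*-pos (*-pos 0<2 0<2) 0<x))
            where
            from-inverse : (Σ[ ι ∈ Carrier ] 0# < ι × 2# * 2# * x * ι ≈ 1#) →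
              Σ[ ε ∈ Carrier ] 0# < ε × 2# * 2# * x * ε ≈ 2# * 2# * q - x * x
            from-inverse (ι , 0<ι , 4xι≈1) =
              (2# * 2# * q - x * x) * ι ,
              *-pos (<-by (*-pos (0<y-x x<2s) (+-pos 0<2s 0<x))
                (≈-by (- (2# * 2#)) s²≈q (solve 3 (λ x s q → let t = :2 in
                  t :* t :* q :- x :* x :- :0 :- (t :* s :- x) :* (t :* s :+ x)
                  := :- (t :* t) :* (s :* s :- q)) refl x s q))) 0<ι ,
              ≈-by (2# * 2# * q - x * x) 4xι≈1
                (solve 3 (λ f p i → f :* (p :* i) :- p := p :* (f :* i :- :1)) refl
                  (2# * 2# * x) (2# * 2# * q - x * x) ι)

        -- If all g j x were positive, the ratios g (1+j) x / g j x would decrease by at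
        -- least ε = (4q − x²)/(4x) at every step.
        not-all-positive : ∀ {x} → 0# < x → x < 2# * s → ¬ (∀ i → 0# < g i x)
        not-all-positive {x} 0<x x<2s g-pos = at (decrement 0<x x<2s)
          where
          at : (Σ[ ε ∈ Carrier ] 0# < ε × 2# * 2# * x * ε ≈ 2# * 2# * q - x * x) → ⊥
          at (ε , 0<ε , 4xε≈) = let (j , x<jε) = archimedean x 0<ε (λ P → em) in
            eventually-negative x<jε (g-pos j) (decreasing-ratio 0<ε 4xε≈ g-pos j) (<⇒≤ (g-pos (suc j)))

        ρ-cofinal : ∀ {x} → 0# < x → x < 2# * s → Σ[ j ∈ ℕ ] x ≤ ρ j
        ρ-cofinal {x} 0<x x<2s with em {Σ[ j ∈ ℕ ] x ≤ ρ j}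
        ... | yes p = p
        ... | no ¬p = ⊥-elim (not-all-positive 0<x x<2s λ i → positive-last i (proj₁ (ρ<⇒positive i
            ([ (λ r<x → r<x) , (λ x≤r → contradiction (i , x≤r) ¬p) ]′ (<-≤-connex (ρ i) x)))))

-- Vectors, symmetric matrices and their quadratic forms.

module LinearAlgebra (ℝ : CompleteOrderedField) where
  open Real ℝ
  open import Algebra.Properties.Semiring.Sum semiring public
    using (sum; sum-syntax; sum-cong-≋; *-distribˡ-sum; *-distribʳ-sum; ∑-comm; ∑-distrib-+;
           sum-replicate-zero)

  V : ℕ → Set
  V n = Vector Carrier n

  infixl 7 _∙_ _⊛_

  _∙_ : ∀ {n} → V n → V n → Carrier
  _∙_ {n} x y = ∑[ i < n ] (x i * y i)

  _⊛_ : ∀ {n} → Matrix n → V n → V n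
  _⊛_ {n} A x i = ∑[ j < n ] (A i j * x j)

  Symmetric : ∀ {n} → Matrix n → Set
  Symmetric A = ∀ i j → A i j ≈ A j i

  δ : ∀ {n} → Fin n → Fin n → Carrier
  δ zero    zero    = 1#
  δ zero    (suc j) = 0#
  δ (suc i) zero    = 0#
  δ (suc i) (suc j) = δ i j

  δ-sym : ∀ {n} (i j : Fin n) → δ i j ≈ δ j i
  δ-sym zero    zero    = refl
  δ-sym zero    (suc j) = refl
  δ-sym (suc i) zero    = refl
  δ-sym (suc i) (suc j) = δ-sym i j

  sum-zero : ∀ {n} (f : V n) → (∀ i → f i ≈ 0#) → sum f ≈ 0#
  sum-zero {n} f f≈0 = trans (sum-cong-≋ f≈0) (sum-replicate-zero n)

  sum-δ : ∀ {n} i (x : V n) → ∑[ j < n ] (δ i j * x j) ≈ x i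
  sum-δ zero    x = trans (+-cong (*-identityˡ _) (sum-zero (λ j → 0# * x (suc j))
      (λ j → zeroˡ (x (suc j))))) (+-identityʳ _)
  sum-δ (suc i) x = trans (+-cong (zeroˡ _) (sum-δ i (x ∘ suc))) (+-identityˡ _)

  sum-linear : ∀ {n} a b (x y : V n) →
               ∑[ i < n ] (a * x i + b * y i) ≈ a * sum x + b * sum y
  sum-linear {n} a b x y = trans (∑-distrib-+ (λ i → a * x i) (λ i → b * y i))
    (+-cong (sym (*-distribˡ-sum a x)) (sym (*-distribˡ-sum b y)))

  sum-split : ∀ p {r} (f : V (p ℕ.+ r)) → sum f ≈ sum (λ i → f (i ↑ˡ r)) + sum (λ j → f (p ↑ʳ j))
  sum-split zero    f = sym (+-identityˡ _)
  sum-split (suc p) f = trans (+-congˡ (sum-split p (f ∘ suc))) (sym (+-assoc _ _ _))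

  sum-const : ∀ n c → sum {n} (λ _ → c) ≈ fromℕ n * c
  sum-const zero    c = sym (zeroˡ c)
  sum-const (suc n) c = trans (+-congˡ (sum-const n c)) (solve 2 (λ c n → c :+ n :* c := (:1 :+ n) :* c)
      refl c (fromℕ n))

  sum-nonneg : ∀ {n} (x : V n) → (∀ i → 0# ≤ x i) → 0# ≤ sum x
  sum-nonneg {zero}  x p = ≤-refl
  sum-nonneg {suc n} x p = +-nonneg (p zero) (sum-nonneg (x ∘ suc) (p ∘ suc))

  sum-mono : ∀ {n} (x y : V n) → (∀ i → x i ≤ y i) → sum x ≤ sum y
  sum-mono {zero}  x y p = ≤-refl
  sum-mono {suc n} x y p = ≤-by (+-nonneg (0≤y-x (p zero))
      (0≤y-x (sum-mono (x ∘ suc) (y ∘ suc) (p ∘ suc))))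
    (solve 4 (λ a b c d → (c :+ d) :- (a :+ b) := (c :- a) :+ (d :- b)) refl _ _ _ _)

  ∙-cong : ∀ {n} {x x′ y y′ : V n} → (∀ i → x i ≈ x′ i) → (∀ i → y i ≈ y′ i) → x ∙ y ≈ x′ ∙ y′
  ∙-cong p r = sum-cong-≋ (λ i → *-cong (p i) (r i))

  ∙-comm : ∀ {n} (x y : V n) → x ∙ y ≈ y ∙ x
  ∙-comm x y = sum-cong-≋ (λ i → *-comm (x i) (y i))

  ∙-linearʳ : ∀ {n} a b (x y z : V n) → z ∙ (λ i → a * x i + b * y i) ≈ a * (z ∙ x) + b * (z ∙ y)
  ∙-linearʳ a b x y z = trans
    (sum-cong-≋ (λ i → solve 5 (λ a b x y z → z :* (a :* x :+ b :* y) := a :* (z :* x) :+ b :* (z :* y))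
      refl a b (x i) (y i) (z i)))
    (sum-linear a b (λ i → z i * x i) (λ i → z i * y i))

  ∙-linearˡ : ∀ {n} a b (x y z : V n) → (λ i → a * x i + b * y i) ∙ z ≈ a * (x ∙ z) + b * (y ∙ z)
  ∙-linearˡ a b x y z = trans (∙-comm _ z) (trans (∙-linearʳ a b x y z)
    (+-cong (*-congˡ (∙-comm z x)) (*-congˡ (∙-comm z y))))

  ⊛-cong : ∀ {n} (A : Matrix n) {x y : V n} → (∀ i → x i ≈ y i) → ∀ i → (A ⊛ x) i ≈ (A ⊛ y) i
  ⊛-cong A p i = sum-cong-≋ (λ j → *-congˡ (p j))

  ⊛-linear : ∀ {n} (A : Matrix n) a b (x y : V n) i →
             (A ⊛ (λ j → a * x j + b * y j)) i ≈ a * (A ⊛ x) i + b * (A ⊛ y) i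
  ⊛-linear A a b x y i = ∙-linearʳ a b x y (A i)

  ⊛-symmetric : ∀ {n} (A : Matrix n) → Symmetric A → ∀ x y → x ∙ (A ⊛ y) ≈ (A ⊛ x) ∙ y
  ⊛-symmetric {n} A A-sym x y = begin-equality
    ∑[ i < n ] (x i * ∑[ j < n ] (A i j * y j))  
        ≈⟨ sum-cong-≋ (λ i → *-distribˡ-sum (x i) (λ j → A i j * y j)) ⟩
    ∑[ i < n ] ∑[ j < n ] (x i * (A i j * y j))   ≈⟨ ∑-comm (λ i j → x i * (A i j * y j)) ⟩
    ∑[ j < n ] ∑[ i < n ] (x i * (A i j * y j))   ≈⟨ sum-cong-≋ (λ j → sum-cong-≋ (λ i →
                                                       trans (*-congˡ (*-congʳ (A-sym i j)))
                                                         (solve 3 (λ a b c → a :* (b :* c) := b :* a :* c)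
                                                             refl _ _ _))) ⟩
    ∑[ j < n ] ∑[ i < n ] (A j i * x i * y j)    
        ≈⟨ sum-cong-≋ (λ j → *-distribʳ-sum (y j) (λ i → A j i * x i)) ⟨
    ∑[ j < n ] ((∑[ i < n ] (A j i * x i)) * y j) ∎

  ∙-nonneg : ∀ {n} (x : V n) → 0# ≤ x ∙ x
  ∙-nonneg x = sum-nonneg _ (λ i → sq-nonneg (x i))

  ∙-definite : ∀ {n} (x : V n) → x ∙ x ≤ 0# → ∀ i → x i ≈ 0#
  ∙-definite {suc n} x x∙x≤0 i with x zero ≟ 0#
  ... | no x₀≉0 = contradiction x∙x≤0 (<⇒≱ (+-pos-nonneg (sq-pos x₀≉0) (∙-nonneg (x ∘ suc))))
  ∙-definite {suc n} x x∙x≤0 zero    | yes x₀≈0 = x₀≈0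
  ∙-definite {suc n} x x∙x≤0 (suc i) | yes x₀≈0 = ∙-definite (x ∘ suc)
    (≤-trans (≤-by (sq-nonneg (x zero)) (solve 2 (λ a b → a :+ b :- b := a) refl _ _)) x∙x≤0) i

  -- Cauchy-Schwarz with a worse constant. Only the existence of a bound matters, and
  -- `(p + ℓ)² ≤ 2 (p² + ℓ²)` builds one coordinate by coordinate.
  functional-bound : ∀ {n} (b : V n) → Σ[ L ∈ Carrier ] 0# ≤ L × (∀ x → (b ∙ x) * (b ∙ x) ≤ L * (x ∙ x))
  functional-bound {zero}  b = 0# , ≤-refl , λ x → ≤-refl
  functional-bound {suc n} b = let (L , 0≤L , bound) = functional-bound (b ∘ suc) in
    2# * (b zero * b zero + L) , *-nonneg (<⇒≤ 0<2) (+-nonneg (sq-nonneg _) 0≤L) , λ x →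
    step (b zero) (x zero) 0≤L (∙-nonneg (x ∘ suc)) (bound (x ∘ suc))
    where
    step : ∀ {L ℓ X} b₀ x₀ → 0# ≤ L → 0# ≤ X → ℓ * ℓ ≤ L * X →
           (b₀ * x₀ + ℓ) * (b₀ * x₀ + ℓ) ≤ 2# * (b₀ * b₀ + L) * (x₀ * x₀ + X)
    step {L} {ℓ} {X} b₀ x₀ 0≤L 0≤X ℓ²≤LX = ≤-by
      (+-nonneg (+-nonneg (sq-nonneg (b₀ * x₀ - ℓ)) (*-nonneg (<⇒≤ 0<2) (0≤y-x ℓ²≤LX)))
        (*-nonneg (<⇒≤ 0<2) (+-nonneg (*-nonneg (sq-nonneg b₀) 0≤X) (*-nonneg 0≤L (sq-nonneg x₀)))))
      (solve 5 (λ b x L l X → let t = :2 in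
         t :* (b :* b :+ L) :* (x :* x :+ X) :- (b :* x :+ l) :* (b :* x :+ l)
         := (b :* x :- l) :* (b :* x :- l) :+ t :* (L :* X :- l :* l)
            :+ t :* (b :* b :* X :+ L :* (x :* x))) refl b₀ x₀ L ℓ X)

  -- By `a b ≤ a² + b²` in each row. It makes the set of Rayleigh quotients bounded, so that a
  -- supremum exists.
  form-bound : ∀ {n} (A : Matrix n) → Σ[ K ∈ Carrier ] (∀ x → x ∙ (A ⊛ x) ≤ K * (x ∙ x))
  form-bound {n} A = 1# + sum L , λ x → ≤-trans
      (sum-mono (λ i → x i * (A ⊛ x) i) (λ i → 1# * (x i * x i) + 1# * (L i * (x ∙ x)))
        (λ i → product-bound (x i) ((A ⊛ x) i) (proj₂ (proj₂ (functional-bound (A i))) x)))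
      (≤-reflexive (trans (sum-linear 1# 1# (λ i → x i * x i) (λ i → L i * (x ∙ x)))
        (trans (+-congˡ (*-congˡ (sym (*-distribʳ-sum (x ∙ x) L))))
          (solve 2 (λ X l → :1 :* X :+ :1 :* (l :* X) := (:1 :+ l) :* X) refl (x ∙ x) (sum L)))))
    where
    L : V n
    L i = proj₁ (functional-bound (A i))
    product-bound : ∀ a b {c} → b * b ≤ c → a * b ≤ 1# * (a * a) + 1# * c
    product-bound a b {c} b²≤c = *2-cancel (+-nonneg (+-nonneg (sq-nonneg (a - b)) (sq-nonneg a))
        (+-nonneg (sq-nonneg b) (*-nonneg (<⇒≤ 0<2) (0≤y-x b²≤c))))
      where
      *2-cancel : 0# ≤ (a - b) * (a - b) + a * a + (b * b + 2# * (c - b * b)) → _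
      *2-cancel p = ≤-by (*-cancel-nonneg 0<2 (≤-trans p (≤-reflexive
         (solve 3 (λ a b c → let t = :2 in
           (a :- b) :* (a :- b) :+ a :* a :+ (b :* b :+ t :* (c :- b :* b))
           := t :* (:1 :* (a :* a) :+ :1 :* c :- a :* b)) refl a b c)))) refl

  form-expand : ∀ {n} (A : Matrix n) → Symmetric A → ∀ α β x y →
    (λ i → α * x i + β * y i) ∙ (A ⊛ (λ i → α * x i + β * y i))
      ≈ α * α * (x ∙ (A ⊛ x)) + 2# * (α * β) * (y ∙ (A ⊛ x)) + β * β * (y ∙ (A ⊛ y))
  form-expand A A-sym α β x y = begin-equality
    z ∙ (A ⊛ z)                                      ≈⟨ ∙-cong (λ i → refl) (⊛-linear A α β x y) ⟩
    z ∙ (λ i → α * (A ⊛ x) i + β * (A ⊛ y) i)        ≈⟨ ∙-linearʳ α β (A ⊛ x) (A ⊛ y) z ⟩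
    α * (z ∙ (A ⊛ x)) + β * (z ∙ (A ⊛ y))            ≈⟨ +-cong (*-congˡ (∙-linearˡ α β x y (A ⊛ x)))
                                                               (*-congˡ (∙-linearˡ α β x y (A ⊛ y))) ⟩
    α * (α * (x ∙ (A ⊛ x)) + β * (y ∙ (A ⊛ x))) + β * (α * (x ∙ (A ⊛ y)) + β * (y ∙ (A ⊛ y)))
      ≈⟨ +-congˡ (*-congˡ (+-congʳ (*-congˡ (trans (⊛-symmetric A A-sym x y) (∙-comm (A ⊛ x) y))))) ⟩
    α * (α * (x ∙ (A ⊛ x)) + β * (y ∙ (A ⊛ x))) + β * (α * (y ∙ (A ⊛ x)) + β * (y ∙ (A ⊛ y)))
      ≈⟨ solve 5 (λ a b p r s → a :* (a :* p :+ b :* r) :+ b :* (a :* r :+ b :* s)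
           := a :* a :* p :+ :2 :* (a :* b) :* r :+ b :* b :* s) refl
           α β (x ∙ (A ⊛ x)) (y ∙ (A ⊛ x)) (y ∙ (A ⊛ y)) ⟩
    _ ∎
    where
    z : V _
    z i = α * x i + β * y i

  -- Semidefinite and coercive forms.

  Semidefinite : ∀ {n} → Matrix n → Set
  Semidefinite {n} A = ∀ (x : V n) → 0# ≤ x ∙ (A ⊛ x)

  -- Where a semidefinite form vanishes it has a minimum, so its gradient, a multiple of `A ⊛ x`,
  -- vanishes. This is tested along the combinations of `x` and `A ⊛ x`.
  semidefinite-kernel : ∀ {n} (A : Matrix n) → Symmetric A → Semidefinite A →
    ∀ x → x ∙ (A ⊛ x) ≤ 0# → ∀ i → (A ⊛ x) i ≈ 0#
  semidefinite-kernel A A-sym A-psd x Qx≤0 = ∙-definite (A ⊛ x) (at-minimum (A-psd (A ⊛ x)) Qx≤0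
      (λ α β → ≤-trans (A-psd (λ i → α * x i + β * (A ⊛ x) i))
          (≤-reflexive (form-expand A A-sym α β x (A ⊛ x)))))
    where
    at-minimum : ∀ {p r Q} → 0# ≤ r → Q ≤ 0# →
      (∀ α β → 0# ≤ α * α * Q + 2# * (α * β) * p + β * β * r) → p ≤ 0#
    at-minimum {p} {r} {Q} 0≤r Q≤0 f = ≮⇒≥ λ 0<p → <⇒≱
      (*-pos (*-pos 0<p 0<p) (+-nonneg-pos 0≤r 0<2))
      -- With `α = r + 1` and `β = − p` the form is at most `− (r + 2) p²`, which is negative unless
      -- `p` vanishes.
      (≤-by (+-nonneg (f (r + 1#) (- p)) (*-nonneg (sq-nonneg (r + 1#)) (neg-nonneg Q≤0)))
        (solve 3 (λ p r Q → let t = :2 ; r+1 = r :+ :1 in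
           :0 :- p :* p :* (r :+ t)
           := r+1 :* r+1 :* Q :+ t :* (r+1 :* :- p) :* p :+ :- p :* :- p :* r :+ r+1 :* r+1 :* :- Q) refl
               p r Q))

  Coercive : ∀ {n} → Matrix n → Set
  Coercive {n} A = Σ[ ε ∈ Carrier ] 0# < ε × (∀ (x : V n) → ε * (x ∙ x) ≤ x ∙ (A ⊛ x))

  NonpositiveVector : ∀ {n} → Matrix n → Set
  NonpositiveVector {n} A = Σ[ x ∈ V n ] 0# < x ∙ x × x ∙ (A ⊛ x) ≤ 0#

  private
    cons : ∀ {n} → Carrier → V n → V (suc n)
    cons a x zero    = a
    cons a x (suc i) = x i

    row : ∀ {n} → Matrix (suc n) → V n
    row A j = A zero (suc j)

    minor : ∀ {n} → Matrix (suc n) → Matrix n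
    minor A i j = A (suc i) (suc j)

    form-block : ∀ {n} (A : Matrix (suc n)) → Symmetric A → ∀ a x →
      cons a x ∙ (A ⊛ cons a x) ≈
      A zero zero * (a * a) + 2# * a * (row A ∙ x) + x ∙ (minor A ⊛ x)
    form-block A A-sym a x = trans (+-congˡ (begin-equality
        sum (λ i → x i * (A (suc i) zero * a + (minor A ⊛ x) i))
          ≈⟨ sum-cong-≋ (λ i → trans (*-congˡ (+-congʳ (*-congʳ (A-sym (suc i) zero))))
               (solve 4 (λ x b a m → x :* (b :* a :+ m) := a :* (b :* x) :+ :1 :* (x :* m)) refl _ _ _ _))
                   ⟩
        sum (λ i → a * (row A i * x i) + 1# * (x i * (minor A ⊛ x) i))
          ≈⟨ sum-linear a 1# (λ i → row A i * x i) (λ i → x i * (minor A ⊛ x) i) ⟩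
        a * (row A ∙ x) + 1# * (x ∙ (minor A ⊛ x)) ∎))
      (solve 4 (λ c a l m → a :* (c :* a :+ l) :+ (a :* l :+ :1 :* m)
                 := c :* (a :* a) :+ :2 :* a :* l :+ m) refl
         (A zero zero) a (row A ∙ x) (x ∙ (minor A ⊛ x)))

    module Schur {n} (A : Matrix (suc n)) {a⁻¹ : Carrier} where

      schur : Matrix n
      schur i j = minor A i j - row A i * row A j * a⁻¹

      schur-symmetric : Symmetric A → Symmetric schur
      schur-symmetric A-sym i j = +-cong (A-sym _ _) (-‿cong (*-congʳ (*-comm _ _)))

      schur-form : ∀ x → x ∙ (schur ⊛ x) ≈ x ∙ (minor A ⊛ x) - a⁻¹ * ((row A ∙ x) * (row A ∙ x))
      schur-form x = begin-equality
        sum (λ i → x i * sum (λ j → (minor A i j - row A i * row A j * a⁻¹) * x j))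
          ≈⟨ sum-cong-≋ (λ i → *-congˡ {x i} (trans (sum-cong-≋ (λ j →
               solve 5 (λ m b c v x → (m :- b :* c :* v) :* x := :1 :* (m :* x) :+ (:- v :* b) :*
                   (c :* x)) refl
                 (minor A i j) (row A i) (row A j) a⁻¹ (x j))) (sum-linear 1# (- a⁻¹ * row A i)
                     (λ j → minor A i j * x j) (λ j → row A j * x j)))) ⟩
        sum (λ i → x i * (1# * (minor A ⊛ x) i + (- a⁻¹ * row A i) * (row A ∙ x)))
          ≈⟨ sum-cong-≋ (λ i → solve 5 (λ x m v b l → x :* (:1 :* m :+ (:- v :* b) :* l)
                := :1 :* (x :* m) :+ (:- v :* l) :* (b :* x)) refl (x i) ((minor A ⊛ x) i) a⁻¹ (row A i)
                    (row A ∙ x)) ⟩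
        sum (λ i → 1# * (x i * (minor A ⊛ x) i) + (- a⁻¹ * (row A ∙ x)) * (row A i * x i))
          ≈⟨ sum-linear 1# (- a⁻¹ * (row A ∙ x)) (λ i → x i * (minor A ⊛ x) i) (λ i → row A i * x i) ⟩
        1# * (x ∙ (minor A ⊛ x)) + (- a⁻¹ * (row A ∙ x)) * (row A ∙ x)
          ≈⟨ solve 3 (λ m v l → :1 :* m :+ (:- v :* l) :* l := m :- v :* (l :* l)) refl _ _ _ ⟩
        _ ∎

    -- Completing the square: a Q(x₀, x) = (a x₀ + ℓ)² + a S, with S the Schur complement.
    coercive-step : ∀ {a a⁻¹ ε L} → 0# < a → a * a⁻¹ ≈ 1# → 0# < ε → 0# ≤ L →
      Σ[ η ∈ Carrier ] 0# < η × (∀ x₀ ℓ X m → ℓ * ℓ ≤ L * X → ε * X ≤ m - a⁻¹ * (ℓ * ℓ) → 0# ≤ X →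
        η * (x₀ * x₀ + X) ≤ a * (x₀ * x₀) + 2# * x₀ * ℓ + m)
    coercive-step {a} {a⁻¹} {ε} {L} 0<a aa⁻¹≈1 0<ε 0≤L = with-inverse (inverse-pos 0<D)
      where
      -- Chosen so that `η = a² ε / D` leaves both `a − 2 η` and `a² ε − η (2 L + a²)` nonnegative.
      -- These are the coefficients of the completed square and of `X` once the norm is bounded by
      -- writing `a x₀` as `(a x₀ + ℓ) − ℓ`.
      D = 2# * L + a * a + 2# * (a * ε)
      0<a² = *-pos 0<a 0<a
      0<D : 0# < D
      0<D = +-pos (+-nonneg-pos (*-nonneg (<⇒≤ 0<2) 0≤L) 0<a²) (*-pos 0<2 (*-pos 0<a 0<ε))
      norm-bound : ∀ {x₀ ℓ X} → ℓ * ℓ ≤ L * X →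
        a * a * (x₀ * x₀ + X) ≤ 2# * ((a * x₀ + ℓ) * (a * x₀ + ℓ)) + (2# * L + a * a) * X
      norm-bound {x₀} {ℓ} {X} ℓ²≤ = ≤-by (+-nonneg (*-nonneg (<⇒≤ 0<2) (0≤y-x ℓ²≤))
          (sq-nonneg (a * x₀ + 2# * ℓ)))
        (solve 5 (λ a x l X L → let t = :2 ; y = a :* x :+ l ; w = a :* x :+ t :* l in
           t :* (y :* y) :+ (t :* L :+ a :* a) :* X :- a :* a :* (x :* x :+ X)
           := t :* (L :* X :- l :* l) :+ w :* w) refl a x₀ ℓ X L)
      form-lower : ∀ {x₀ ℓ X m} → ε * X ≤ m - a⁻¹ * (ℓ * ℓ) →
        a * ((a * x₀ + ℓ) * (a * x₀ + ℓ)) + a * a * (ε * X) ≤ a * a * (a * (x₀ * x₀) + 2# * x₀ * ℓ + m)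
      form-lower {x₀} {ℓ} {X} {m} εX≤ = ≤-by (*-nonneg (<⇒≤ 0<a²) (0≤y-x εX≤))
        (≈-by (a * (ℓ * ℓ)) aa⁻¹≈1
          (solve 6 (λ a v x l m e → let t = :2 ; y = a :* x :+ l in
             a :* a :* (a :* (x :* x) :+ t :* x :* l :+ m) :- (a :* (y :* y) :+ a :* a :* e)
             :- a :* a :* ((m :- v :* (l :* l)) :- e)
             := a :* (l :* l) :* (a :* v :- :1)) refl a a⁻¹ x₀ ℓ m (ε * X)))
      with-inverse : (Σ[ d ∈ Carrier ] 0# < d × D * d ≈ 1#) → _
      with-inverse (d , 0<d , Dd≈1) = a * a * ε * d , *-pos (*-pos 0<a² 0<ε) 0<d , λ x₀ ℓ X m ℓ²≤ εX≤ 0≤X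
          →
        combine (norm-bound {x₀} ℓ²≤) (form-lower {x₀} εX≤) (sq-nonneg _) 0≤X
        where
        η = a * a * ε * d
        Dη≈ : D * η ≈ a * a * ε
        Dη≈ = ≈-by (a * a * ε) Dd≈1 (solve 3 (λ D p d → D :* (p :* d) :- p := p :* (D :* d :- :1)) refl D
            (a * a * ε) d)
        0≤a-2η : 0# ≤ a - 2# * η
        0≤a-2η = *-cancel-nonneg 0<D
            (≤-by (*-nonneg (<⇒≤ 0<a) (+-nonneg (*-nonneg (<⇒≤ 0<2) 0≤L) (<⇒≤ 0<a²)))
          (≈-by (- 2#) Dη≈ (solve 4 (λ a L e n → let t = :2 ; D = t :* L :+ a :* a :+ t :* (a :* e) in
            D :* (a :- t :* n) :- :0 :- a :* (t :* L :+ a :* a) := :- t :* (D :* n :- a :* a :* e)) refl a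
                L ε η)))
        0≤coeff : 0# ≤ a * a * ε - η * (2# * L + a * a)
        0≤coeff = *-cancel-nonneg 0<D
            (≤-by (*-nonneg (*-nonneg (<⇒≤ 0<a²) (<⇒≤ 0<ε))
            (*-nonneg (<⇒≤ 0<2) (*-nonneg (<⇒≤ 0<a) (<⇒≤ 0<ε))))
          (≈-by (- (2# * L + a * a)) Dη≈
              (solve 4 (λ a L e n → let t = :2 ; D = t :* L :+ a :* a :+ t :* (a :* e) in
            D :* (a :* a :* e :- n :* (t :* L :+ a :* a)) :- :0 :- a :* a :* e :* (t :* (a :* e))
            := :- (t :* L :+ a :* a) :* (D :* n :- a :* a :* e)) refl a L ε η)))
        combine : ∀ {N y² X Q} → a * a * N ≤ 2# * y² + (2# * L + a * a) * X →
          a * y² + a * a * (ε * X) ≤ a * a * Q → 0# ≤ y² → 0# ≤ X → η * N ≤ Q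
        combine {N} {y²} {X} {Q} N≤ ≤Q 0≤y² 0≤X = ≤-by (*-cancel-nonneg 0<a² (≤-by
            (+-nonneg (+-nonneg (*-nonneg (<⇒≤ (*-pos (*-pos 0<a² 0<ε) 0<d)) (0≤y-x N≤)) (0≤y-x ≤Q))
              (+-nonneg (*-nonneg 0≤a-2η 0≤y²) (*-nonneg 0≤coeff 0≤X)))
            (solve 8 (λ a L e n N y X Q → let t = :2 in
               a :* a :* (Q :- n :* N) :- :0
               := n :* (t :* y :+ (t :* L :+ a :* a) :* X :- a :* a :* N) :+
                   (a :* a :* Q :- (a :* y :+ a :* a :* (e :* X)))
                  :+ ((a :- t :* n) :* y :+ (a :* a :* e :- n :* (t :* L :+ a :* a)) :* X)) refl a L ε η N
                      y² X Q))) refl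

  -- Symmetric elimination in place of compactness. A nonpositive pivot exhibits a unit vector; a
  -- positive one reduces the question to the Schur complement, from which either answer lifts.
  coercive-or-nonpositive : ∀ {n} (A : Matrix n) → Symmetric A → Coercive A ⊎ NonpositiveVector A
  coercive-or-nonpositive {zero}  A A-sym = inj₁ (1# , 0<1 , λ x → ≤-reflexive (*-identityˡ 0#))
  coercive-or-nonpositive {suc n} A A-sym with <-≤-connex 0# (A zero zero)
  ... | inj₂ a≤0 = inj₂ (e , 0<e∙e , ≤-trans (≤-reflexive (trans (form-block A A-sym 1# (λ _ → 0#))
          (trans (+-cong (+-congˡ (*-congˡ (sum-zero (λ j → row A j * 0#) (λ j → zeroʳ _))))
              (sum-zero (λ j → 0# * (minor A ⊛ (λ _ → 0#)) j) (λ j → zeroˡ _)))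
            (solve 1 (λ a → a :* (:1 :* :1) :+ :2 :* :1 :* :0 :+ :0 := a) refl (A zero zero))))) a≤0)
    where
    e = cons 1# (λ _ → 0#)
    0<e∙e : 0# < e ∙ e
    0<e∙e = +-pos-nonneg (*-pos 0<1 0<1) (∙-nonneg {n} (λ _ → 0#))
  ... | inj₁ 0<a with inverse-pos 0<a
  ... | a⁻¹ , 0<a⁻¹ , aa⁻¹≈1 with coercive-or-nonpositive (Schur.schur A {a⁻¹})
      (Schur.schur-symmetric A A-sym)
  ... | inj₁ (ε , 0<ε , lower) =
    let (L , 0≤L , bound) = functional-bound (row A)
        (η , 0<η , step)  = coercive-step 0<a aa⁻¹≈1 0<ε 0≤L
    in inj₁ (η , 0<η , λ x →
         let x′ = x ∘ suc in
         ≤-trans (step (x zero) (row A ∙ x′) (x′ ∙ x′) (x′ ∙ (minor A ⊛ x′)) (bound x′)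
             (≤-trans (lower x′) (≤-reflexive (Schur.schur-form A x′))) (∙-nonneg x′))
                 (≤-reflexive (sym (form-block A A-sym (x zero) x′))))
  -- The new first coordinate annihilates the completed square, so that the whole form equals the
  -- Schur form at `x`.
  ... | inj₂ (x , 0<x∙x , Sx≤0) = inj₂ (cons (- a⁻¹ * (row A ∙ x)) x ,
          +-nonneg-pos (sq-nonneg _) 0<x∙x ,
          ≤-trans (≤-reflexive (trans (form-block A A-sym _ x) (trans eq (sym (Schur.schur-form A x)))))
              Sx≤0)
    where
    ℓ = row A ∙ x
    eq : A zero zero * ((- a⁻¹ * ℓ) * (- a⁻¹ * ℓ)) + 2# * (- a⁻¹ * ℓ) * ℓ + x ∙ (minor A ⊛ x)
         ≈ x ∙ (minor A ⊛ x) - a⁻¹ * (ℓ * ℓ)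
    eq = ≈-by (a⁻¹ * (ℓ * ℓ)) aa⁻¹≈1 (solve 4 (λ a v l m →
       a :* ((:- v :* l) :* (:- v :* l)) :+ :2 :* (:- v :* l) :* l :+ m :- (m :- v :* (l :* l))
       := v :* (l :* l) :* (a :* v :- :1)) refl (A zero zero) a⁻¹ ℓ (x ∙ (minor A ⊛ x)))

-- The largest eigenvalue of a symmetric matrix.

module Spectral (em : ExcludedMiddle 0ℓ) (ℝ : CompleteOrderedField) where
  open Real ℝ
  open LinearAlgebra ℝ

  -- The supremum μ of the quadratic form on the unit sphere is attained: μ − B is
  -- semidefinite but not coercive, so it has a kernel.
  module _ {n} (B : Matrix n) (B-sym : Symmetric B) where

    Eigenpair : Carrier → V n → Set
    Eigenpair μ x = 0# < x ∙ x × (∀ i → (B ⊛ x) i ≈ μ * x i)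

    private
      -- Says without division that some Rayleigh quotient is larger than `t`. The strict inequality
      -- forces `x` to be nonzero.
      Exceeded : Carrier → Set
      Exceeded t = Σ[ x ∈ V n ] t * (x ∙ x) < x ∙ (B ⊛ x)

      shift : Carrier → Matrix n
      shift μ i j = μ * δ i j - B i j

      shift-⊛ : ∀ μ x i → (shift μ ⊛ x) i ≈ μ * x i - (B ⊛ x) i
      shift-⊛ μ x i = begin-equality
        sum (λ j → (μ * δ i j - B i j) * x j)
          ≈⟨ sum-cong-≋ (λ j → solve 4 (λ m d b x → (m :* d :- b) :* x := m :* (d :* x) :+ :- :1 :*
              (b :* x)) refl μ (δ i j) (B i j) (x j)) ⟩
        sum (λ j → μ * (δ i j * x j) + - 1# * (B i j * x j))
          ≈⟨ sum-linear μ (- 1#) (λ j → δ i j * x j) (λ j → B i j * x j) ⟩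
        μ * sum (λ j → δ i j * x j) + - 1# * (B ⊛ x) i
          ≈⟨ +-cong (*-congˡ (sum-δ i x)) (solve 1 (λ b → :- :1 :* b := :- b) refl _) ⟩
        μ * x i - (B ⊛ x) i ∎

      shift-form : ∀ μ x → x ∙ (shift μ ⊛ x) ≈ μ * (x ∙ x) - x ∙ (B ⊛ x)
      shift-form μ x = begin-equality
        x ∙ (shift μ ⊛ x)                             ≈⟨ ∙-cong (λ i → refl) (λ i → trans (shift-⊛ μ x i)
              (solve 2 (λ a b → a :- b := a :+ :- :1 :* b) refl (μ * x i) ((B ⊛ x) i))) ⟩
        x ∙ (λ i → μ * x i + - 1# * (B ⊛ x) i)        ≈⟨ ∙-linearʳ μ (- 1#) x (B ⊛ x) x ⟩
        μ * (x ∙ x) + - 1# * (x ∙ (B ⊛ x))            ≈⟨ solve 2 (λ a b → a :+ :- :1 :* b := a :- b) refl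
            _ _ ⟩
        μ * (x ∙ x) - x ∙ (B ⊛ x)                     ∎

      shift-symmetric : ∀ μ → Symmetric (shift μ)
      shift-symmetric μ i j = +-cong (*-congˡ (δ-sym i j)) (-‿cong (B-sym i j))

      -- The slack `d` leaves room to raise `t` by `d / (x ∙ x + 1)`; the added one makes the
      -- denominator positive at once. Hence a supremum of exceeded values is itself not exceeded.
      exceeded-beyond : ∀ {t} → Exceeded t → Σ[ t′ ∈ Carrier ] t < t′ × Exceeded t′
      exceeded-beyond {t} (x , tX<Q) = at (inverse-pos (+-nonneg-pos (∙-nonneg x) 0<1)) (0<y-x tX<Q)
        where
        gap : ∀ {X Q r d} → 0# < r → (X + 1#) * r ≈ 1# → 0# < d → d ≈ Q - t * X → (t + d * r) * X < Q
        gap {X} {Q} {r} {d} 0<r eq 0<d d≈ = <-by (*-pos 0<d 0<r)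
          (≈-by₂ (- d) (- 1#) eq d≈ (solve 5 (λ X Q r d t → Q :- (t :+ d :* r) :* X :- d :* r
              := :- d :* ((X :+ :1) :* r :- :1) :+ :- :1 :* (d :- (Q :- t :* X))) refl X Q r d t))
        at : (Σ[ r ∈ Carrier ] 0# < r × (x ∙ x + 1#) * r ≈ 1#) → 0# < x ∙ (B ⊛ x) - t * (x ∙ x) → _
        at (r , 0<r , eq) 0<d = t + (x ∙ (B ⊛ x) - t * (x ∙ x)) * r ,
          <-by (*-pos 0<d 0<r) (solve 2 (λ t e → t :+ e :- t := e) refl _ _) ,
          x , gap 0<r eq 0<d refl

      exceeded-bounded : ∃ (IsUpperBound Exceeded)
      exceeded-bounded = let (K , bound) = form-bound B in K , λ t (x , tX<Q) →
        ≮⇒≥ λ K<t → <⇒≱ tX<Q (≤-trans (bound x) (≤-by (*-nonneg (<⇒≤ (0<y-x K<t)) (∙-nonneg x))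
          (solve 3 (λ t K X → t :* X :- K :* X := (t :- K) :* X) refl _ _ _)))

      attained : ∀ {θ μ} → Exceeded θ → IsUpperBound Exceeded μ → (∀ u → IsUpperBound Exceeded u → μ ≤ u)
          →
                 θ < μ × ∃ (Eigenpair μ)
      attained {θ} {μ} θ-exc upper least = θ<μ , eigenvector (coercive-or-nonpositive (shift μ)
          (shift-symmetric μ))
        where
        not-exceeded : ¬ Exceeded μ
        not-exceeded exc = let (t , μ<t , exc′) = exceeded-beyond exc in <⇒≱ μ<t (upper t exc′)
        θ<μ : θ < μ
        θ<μ = let (t , θ<t , exc) = exceeded-beyond θ-exc in <-≤-trans θ<t (upper t exc)
        psd : Semidefinite (shift μ)
        psd x = ≤-trans (0≤y-x (≮⇒≥ λ lt → not-exceeded (x , lt))) (≤-reflexive (sym (shift-form μ x)))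
        eigenvector : Coercive (shift μ) ⊎ NonpositiveVector (shift μ) → ∃ (Eigenpair μ)
        eigenvector (inj₂ (x , 0<X , Q≤0)) = x , 0<X , λ i → sym (x-y≈0⇒x≈y (trans (sym (shift-⊛ μ x i))
          (semidefinite-kernel (shift μ) (shift-symmetric μ) psd x Q≤0 i)))
        -- A coercive `shift μ` would make `μ - ε` an upper bound too, against the choice of `μ` as
        -- the least one.
        eigenvector (inj₁ (ε , 0<ε , lower)) = ⊥-elim
            (<⇒≱ (<-by 0<ε (solve 2 (λ m e → m :- (m :- e) := e) refl μ ε))
          (least (μ - ε) λ t (x , tX<Q) → ≮⇒≥ λ μ-ε<t → <⇒≱ tX<Q
            (≤-by (+-nonneg (0≤y-x (≤-trans (lower x) (≤-reflexive (shift-form μ x))))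
                            (*-nonneg (<⇒≤ (0<y-x μ-ε<t)) (∙-nonneg x)))
              (solve 5 (λ t X Q m e → t :* X :- Q := (m :* X :- Q :- e :* X) :+ (t :- (m :- e)) :* X) refl
                  t (x ∙ x) (x ∙ (B ⊛ x)) μ ε))))

    spectral-bound : ∀ {θ} → (∀ μ → θ < μ → ∀ x → ¬ Eigenpair μ x) → ∀ x → x ∙ (B ⊛ x) ≤ θ * (x ∙ x)
    spectral-bound {θ} none x = ≮⇒≥ λ lt →
      let (μ , upper , least) = sup Exceeded (θ , x , lt) exceeded-bounded
          (θ<μ , v , pair)    = attained (x , lt) upper least
      in none μ θ<μ v pair

-- What a bound on the second eigenvalue says about eigenvectors.

module SecondEigenvalue (ℝ : CompleteOrderedField) where
  open Real ℝ
  open LinearAlgebra ℝ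

  InEigenspace-cong : ∀ {n} (A : Matrix n) {μ ν} → μ ≈ ν → ∀ x → InEigenspace A μ x → InEigenspace A ν x
  InEigenspace-cong A μ≈ν x Ax i = trans (Ax i) (*-congʳ μ≈ν)

  parallel : ∀ {n} {x y : V n} a b v → (∀ i → x i ≈ a * v i) → (∀ i → y i ≈ b * v i) →
             (x ∙ y) * (x ∙ y) ≈ (x ∙ x) * (y ∙ y)
  parallel {n} {x} {y} a b v x≈ y≈ = trans (*-cong x∙y x∙y) (trans
      (solve 3 (λ a b V → (a :* b :* V) :* (a :* b :* V) := (a :* a :* V) :* (b :* b :* V)) refl a b
          (v ∙ v))
      (sym (*-cong x∙x y∙y)))
    where
    scaled : ∀ {x y : V n} c d → (∀ i → x i ≈ c * v i) → (∀ i → y i ≈ d * v i) → x ∙ y ≈ c * d * (v ∙ v)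
    scaled {x} {y} c d x≈ y≈ = trans
      (sum-cong-≋ (λ i → trans (*-cong (x≈ i) (y≈ i))
        (solve 3 (λ c d v → (c :* v) :* (d :* v) := c :* d :* (v :* v)) refl c d (v i))))
      (sym (*-distribˡ-sum (c * d) (λ i → v i * v i)))
    x∙y = scaled a b x≈ y≈
    x∙x = scaled a a x≈ x≈
    y∙y = scaled b b y≈ y≈

  module _ {n} (A : Matrix n) {θ : Carrier} where

    count-above : ∀ {μ₂ μs μ} → Linked _≥_ (μ₂ ∷ μs) → μ₂ ≤ θ → θ < μ → count μ (μ₂ ∷ μs) ≡ 0
    count-above {μ₂} {μs} {μ} sorted μ₂≤θ θ<μ with Linked⇒AllPairs (λ p q → ≤-trans q p) sorted
    ... | μ₂≥ ∷ _ = ≡.cong length (List.filter-none (μ ≟_)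
          (<⇒≉ (≤-<-trans μ₂≤θ θ<μ) ∷
            All.map (λ y≤μ₂ → <⇒≉ (≤-<-trans (≤-trans y≤μ₂ μ₂≤θ) θ<μ)) μ₂≥))

    -- Above `θ` only the head `μ₁` of the list can occur, and it is counted once. A value other
    -- than `μ₁` has an empty spanning family, hence no eigenvector of positive norm; and two
    -- eigenvectors for `μ₁` are multiples of one vector, where equality in Cauchy-Schwarz excludes
    -- orthogonality.
    at-most-one-above : ∀ {μ₂} → IsSecondEigenvalue A μ₂ → μ₂ ≤ θ → ∀ {μ ν x y} → θ < μ → θ < ν →
      InEigenspace A μ x → InEigenspace A ν y → 0# < x ∙ x → 0# < y ∙ y → ¬ (x ∙ y ≈ 0#)
    at-most-one-above {μ₂} (μ₁ , μs , sorted , multiplicity) μ₂≤θ {μ} {ν} {x} {y} θ<μ θ<ν Ax Ay 0<xx 0<yy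
        xy≈0 =
      conclude (μ ≟ μ₁) (ν ≟ μ₁)
      where
      tail-sorted : Linked _≥_ (μ₂ ∷ μs)
      tail-sorted = Linked.tail sorted

      empty-span : ∀ {ν y} → θ < ν → ν ≉ μ₁ → InEigenspace A ν y → ¬ (0# < y ∙ y)
      empty-span {ν} {y} θ<ν ν≉μ₁ Ay 0<yy
        with ≡.subst (HasMultiplicity A ν) (≡.trans (≡.cong length (List.filter-reject (ν ≟_) ν≉μ₁))
                       (count-above tail-sorted μ₂≤θ θ<ν)) (multiplicity ν)
      ... | _ , _ , _ , spans = <⇒≉ 0<yy (sum-zero _ (λ i →
              trans (*-congʳ (proj₂ (spans y Ay) i)) (zeroˡ (y i))))

      one-dimensional : θ < μ₁ → HasMultiplicity A μ₁ 1
      one-dimensional θ<μ₁ = ≡.subst (HasMultiplicity A μ₁)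
        (≡.trans (≡.cong length (List.filter-accept (μ₁ ≟_) refl))
                 (≡.cong suc (count-above tail-sorted μ₂≤θ θ<μ₁))) (multiplicity μ₁)

      conclude : Dec (μ ≈ μ₁) → Dec (ν ≈ μ₁) → ⊥
      conclude (no μ≉μ₁) _ = empty-span θ<μ μ≉μ₁ Ax 0<xx
      conclude (yes _) (no ν≉μ₁) = empty-span θ<ν ν≉μ₁ Ay 0<yy
      conclude (yes μ≈μ₁) (yes ν≈μ₁) with one-dimensional (<-respʳ-≈ μ≈μ₁ θ<μ)
      ... | v , _ , _ , spans with spans x (InEigenspace-cong A μ≈μ₁ x Ax) | spans y
          (InEigenspace-cong A ν≈μ₁ y Ay)
      ... | a , x≈ | b , y≈ = <⇒≉ (*-pos 0<xx 0<yy) (trans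
        (sym (parallel (a zero) (b zero) (v zero) (λ i → trans (x≈ i) (+-identityʳ _))
            (λ i → trans (y≈ i) (+-identityʳ _))))
        (trans (*-congʳ xy≈0) (zeroˡ _)))

-- Bipartite regular matrices and their deflation.

module BipartiteRegular (em : ExcludedMiddle 0ℓ) (ℝ : CompleteOrderedField) where
  open Real ℝ
  open LinearAlgebra ℝ
  open SecondEigenvalue ℝ

  -- σ is the ±1 indicator of the two colour classes.
  record IsBipartiteRegular {n} (A : Matrix n) (σ : V n) (κ : Carrier) : Set where
    field
      A-sym   : Symmetric A
      row-sum : ∀ i → sum (A i) ≈ κ
      σ²≈1    : ∀ i → σ i * σ i ≈ 1#
      A-flip  : ∀ i j → A i j * σ j ≈ - (σ i * A i j)

  𝟙 : ∀ {n} → V n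
  𝟙 _ = 1#

  𝟙∙ : ∀ {n} (x : V n) → 𝟙 ∙ x ≈ sum x
  𝟙∙ x = sum-cong-≋ (λ i → *-identityˡ (x i))

  module _ {n} {A : Matrix n} {σ : V n} {κ : Carrier} (structure : IsBipartiteRegular A σ κ) where
    open IsBipartiteRegular structure

    A𝟙 : InEigenspace A κ 𝟙
    A𝟙 i = trans (sum-cong-≋ (λ j → *-identityʳ (A i j))) (trans (row-sum i) (sym (*-identityʳ κ)))

    Aσ : InEigenspace A (- κ) σ
    Aσ i = begin-equality
      sum (λ j → A i j * σ j)      
          ≈⟨ sum-cong-≋ (λ j → trans (A-flip i j) (solve 2 (λ s a → :- (s :* a) := :- s :* a) refl _ _)) ⟩
      sum (λ j → - σ i * A i j)     ≈⟨ *-distribˡ-sum (- σ i) (A i) ⟨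
      - σ i * sum (A i)             ≈⟨ *-congˡ (row-sum i) ⟩
      - σ i * κ                     ≈⟨ solve 2 (λ s k → :- s :* k := :- k :* s) refl (σ i) κ ⟩
      - κ * σ i                     ∎

    eigenvector-∙ : ∀ {μ v} → InEigenspace A μ v → ∀ x → v ∙ (A ⊛ x) ≈ μ * (v ∙ x)
    eigenvector-∙ {μ} {v} Av x = begin-equality
      v ∙ (A ⊛ x)                  ≈⟨ ⊛-symmetric A A-sym v x ⟩
      (A ⊛ v) ∙ x                  ≈⟨ sum-cong-≋ (λ i → trans (*-congʳ (Av i)) (*-assoc μ (v i) (x i))) ⟩
      sum (λ i → μ * (v i * x i))  ≈⟨ *-distribˡ-sum μ (λ i → v i * x i) ⟨
      μ * (v ∙ x)                  ∎

    σ∙σ : σ ∙ σ ≈ 𝟙 {n} ∙ 𝟙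
    σ∙σ = sum-cong-≋ (λ i → trans (σ²≈1 i) (sym (*-identityˡ 1#)))

    -- By symmetry of `A`, since the eigenvalues `κ` and `- κ` are distinct. For a graph this says
    -- that the colour classes have the same size.
    𝟙∙σ : 0# < κ → 𝟙 ∙ σ ≈ 0#
    𝟙∙σ 0<κ = *-nonzero (<⇒≉ (+-pos 0<κ 0<κ)) (≈-by₂ (- 1#) 1#
      (eigenvector-∙ A𝟙 σ) (trans (∙-cong (λ i → refl) Aσ) (trans
        (sum-cong-≋ {n} (λ i → solve 2 (λ k s → :1 :* (k :* s) := k :* (:1 :* s)) refl (- κ) (σ i)))
        (sym (*-distribˡ-sum (- κ) (λ i → 1# * σ i)))))
      (solve 3 (λ X k s → (k :+ k) :* s :- :0 := :- :1 :* (X :- k :* s) :+ :1 :* (X :- :- k :* s))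
         refl (𝟙 ∙ (A ⊛ σ)) κ (𝟙 ∙ σ)))

    module Deflation {θ ι : Carrier} (0<κ : 0# < κ) (ι-inverse : (𝟙 {n} ∙ 𝟙) * ι ≈ 1#) where

      private
        N η : Carrier
        N = 𝟙 {n} ∙ 𝟙
        -- Subtracting `η 𝟙 𝟙ᵀ` lowers the eigenvalue of `𝟙` by `η N = κ − θ`, and adding `η σ σᵀ`
        -- raises that of `σ` as much. Stopping at `±θ`, not at zero, yields the constant `κ² − θ²`
        -- in `A-norm≤`.
        η = (κ - θ) * ι

        ηN≈κ-θ : η * N ≈ κ - θ
        ηN≈κ-θ = ≈-by (κ - θ) ι-inverse
          (solve 3 (λ d i N → (d :* i) :* N :- d := d :* (N :* i :- :1)) refl (κ - θ) ι N)

      -- Moves the eigenvalues ±κ of 𝟙 and σ to ±θ.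
      B : Matrix n
      B i j = A i j - η * (1# - σ i * σ j)

      B-sym : Symmetric B
      B-sym i j = +-cong (A-sym i j) (-‿cong (*-congˡ (+-congˡ (-‿cong (*-comm (σ i) (σ j))))))

      B⊛ : ∀ x i → (B ⊛ x) i ≈ 1# * (A ⊛ x) i + - η * ((𝟙 ∙ x) * 1# + - (σ ∙ x) * σ i)
      B⊛ x i = begin-equality
        sum (λ j → (A i j - η * (1# - σ i * σ j)) * x j)
          ≈⟨ sum-cong-≋ (λ j → solve 5 (λ a h s t x → (a :- h :* (:1 :- s :* t)) :* x
               := :1 :* (a :* x) :+ :- h :* (:1 :* (:1 :* x) :+ :- s :* (t :* x))) refl (A i j) η (σ i)
                   (σ j) (x j)) ⟩
        sum (λ j → 1# * (A i j * x j) + - η * (1# * (1# * x j) + - σ i * (σ j * x j)))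
          ≈⟨ sum-linear 1# (- η) (λ j → A i j * x j) (λ j → 1# * (1# * x j) + - σ i * (σ j * x j)) ⟩
        1# * (A ⊛ x) i + - η * sum (λ j → 1# * (1# * x j) + - σ i * (σ j * x j))
          ≈⟨ +-congˡ (*-congˡ (trans (sum-linear 1# (- σ i) (λ j → 1# * x j) (λ j → σ j * x j))
               (solve 3 (λ a s b → :1 :* a :+ :- s :* b := a :* :1 :+ :- b :* s) refl (𝟙 ∙ x) (σ i)
                   (σ ∙ x)))) ⟩
        1# * (A ⊛ x) i + - η * ((𝟙 ∙ x) * 1# + - (σ ∙ x) * σ i) ∎

      ∙B⊛ : ∀ x y → y ∙ (B ⊛ x) ≈ y ∙ (A ⊛ x) - η * ((𝟙 ∙ x) * (y ∙ 𝟙) - (σ ∙ x) * (y ∙ σ))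
      ∙B⊛ x y = begin-equality
        y ∙ (B ⊛ x)
          ≈⟨ ∙-cong (λ i → refl) (B⊛ x) ⟩
        y ∙ (λ i → 1# * (A ⊛ x) i + - η * ((𝟙 ∙ x) * 1# + - (σ ∙ x) * σ i))
          ≈⟨ ∙-linearʳ 1# (- η) (A ⊛ x) (λ i → (𝟙 ∙ x) * 1# + - (σ ∙ x) * σ i) y ⟩
        1# * (y ∙ (A ⊛ x)) + - η * (y ∙ (λ i → (𝟙 ∙ x) * 1# + - (σ ∙ x) * σ i))
          ≈⟨ +-congˡ (*-congˡ (∙-linearʳ (𝟙 ∙ x) (- (σ ∙ x)) 𝟙 σ y)) ⟩
        1# * (y ∙ (A ⊛ x)) + - η * ((𝟙 ∙ x) * (y ∙ 𝟙) + - (σ ∙ x) * (y ∙ σ))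
          ≈⟨ solve 6 (λ p h a b c d → :1 :* p :+ :- h :* (a :* b :+ :- c :* d) := p :- h :*
              (a :* b :- c :* d)) refl
               (y ∙ (A ⊛ x)) η (𝟙 ∙ x) (y ∙ 𝟙) (σ ∙ x) (y ∙ σ) ⟩
        y ∙ (A ⊛ x) - η * ((𝟙 ∙ x) * (y ∙ 𝟙) - (σ ∙ x) * (y ∙ σ)) ∎

      𝟙∙B⊛ : ∀ x → 𝟙 ∙ (B ⊛ x) ≈ θ * (𝟙 ∙ x)
      𝟙∙B⊛ x = trans (∙B⊛ x 𝟙) (≈-by₃ 1# (- (𝟙 ∙ x)) (η * (σ ∙ x)) (eigenvector-∙ A𝟙 x) ηN≈κ-θ (𝟙∙σ 0<κ)
        (solve 8 (λ p h a N b c k t → p :- h :* (a :* N :- b :* c) :- t :* a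
           := :1 :* (p :- k :* a) :+ :- a :* (h :* N :- (k :- t)) :+ h :* b :* (c :- :0)) refl
           (𝟙 ∙ (A ⊛ x)) η (𝟙 ∙ x) N (σ ∙ x) (𝟙 ∙ σ) κ θ))

      σ∙B⊛ : ∀ x → σ ∙ (B ⊛ x) ≈ - θ * (σ ∙ x)
      σ∙B⊛ x = trans (∙B⊛ x σ)
          (trans (+-congˡ (-‿cong (*-congˡ (+-cong (*-congˡ (∙-comm σ 𝟙)) (-‿cong (*-congˡ σ∙σ))))))
        (≈-by₃ 1# (σ ∙ x) (- (η * (𝟙 ∙ x))) (eigenvector-∙ Aσ x) ηN≈κ-θ (𝟙∙σ 0<κ)
        (solve 8 (λ p h a N b c k t → p :- h :* (a :* c :- b :* N) :- :- t :* b
           := :1 :* (p :- :- k :* b) :+ b :* (h :* N :- (k :- t)) :+ :- (h :* a) :* (c :- :0)) refl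
           (σ ∙ (A ⊛ x)) η (𝟙 ∙ x) N (σ ∙ x) (𝟙 ∙ σ) κ θ)))

      B-norm : ∀ w → (B ⊛ w) ∙ (B ⊛ w) ≈
        (A ⊛ w) ∙ (A ⊛ w) - η * (κ + θ) * ((𝟙 ∙ w) * (𝟙 ∙ w) + (σ ∙ w) * (σ ∙ w))
      B-norm w = begin-equality
        (B ⊛ w) ∙ (B ⊛ w)
          ≈⟨ ∙B⊛ w (B ⊛ w) ⟩
        (B ⊛ w) ∙ (A ⊛ w) - η * (α * ((B ⊛ w) ∙ 𝟙) - β * ((B ⊛ w) ∙ σ))
          ≈⟨ +-cong (trans (∙-comm (B ⊛ w) (A ⊛ w)) (∙B⊛ w (A ⊛ w))) (-‿cong (*-congˡ (+-cong
               (*-congˡ (trans (∙-comm (B ⊛ w) 𝟙) (𝟙∙B⊛ w)))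
               (-‿cong (*-congˡ (trans (∙-comm (B ⊛ w) σ) (σ∙B⊛ w))))))) ⟩
        (A ⊛ w) ∙ (A ⊛ w) - η * (α * ((A ⊛ w) ∙ 𝟙) - β * ((A ⊛ w) ∙ σ)) - η *
            (α * (θ * α) - β * (- θ * β))
          ≈⟨ +-congʳ (+-congˡ (-‿cong (*-congˡ (+-cong
               (*-congˡ (trans (∙-comm (A ⊛ w) 𝟙) (eigenvector-∙ A𝟙 w)))
               (-‿cong (*-congˡ (trans (∙-comm (A ⊛ w) σ) (eigenvector-∙ Aσ w)))))))) ⟩
        (A ⊛ w) ∙ (A ⊛ w) - η * (α * (κ * α) - β * (- κ * β)) - η * (α * (θ * α) - β * (- θ * β))
          ≈⟨ solve 6 (λ p h a b k t → p :- h :* (a :* (k :* a) :- b :* (:- k :* b)) :- h :*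
              (a :* (t :* a) :- b :* (:- t :* b))
                := p :- h :* (k :+ t) :* (a :* a :+ b :* b)) refl ((A ⊛ w) ∙ (A ⊛ w)) η α β κ θ ⟩
        (A ⊛ w) ∙ (A ⊛ w) - η * (κ + θ) * (α * α + β * β) ∎
        where
        α = 𝟙 ∙ w
        β = σ ∙ w

      B-flip : ∀ i j → B i j * σ j ≈ - (σ i * B i j)
      B-flip i j = ≈-by₃ 1# (η * σ i) (η * σ j) (A-flip i j) (σ²≈1 j) (σ²≈1 i)
        (solve 4 (λ a h s t → (a :- h :* (:1 :- s :* t)) :* t :- :- (s :* (a :- h :* (:1 :- s :* t)))
           := :1 :* (a :* t :- :- (s :* a)) :+ h :* s :* (t :* t :- :1) :+ h :* t :* (s :* s :- :1))
         refl (A i j) η (σ i) (σ j))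

      flip : V n → V n
      flip x i = σ i * x i

      flip-norm : ∀ x → flip x ∙ flip x ≈ x ∙ x
      flip-norm x = sum-cong-≋ (λ i → ≈-by (x i * x i) (σ²≈1 i)
        (solve 2 (λ s x → (s :* x) :* (s :* x) :- x :* x := x :* x :* (s :* s :- :1)) refl (σ i) (x i)))

      -- Conjugation by the diagonal matrix of `σ` turns `B` into its negative, as for every
      -- bipartite matrix. It makes an upper bound for the form a lower bound as well.
      flip-form : ∀ x → flip x ∙ (B ⊛ flip x) ≈ - (x ∙ (B ⊛ x))
      flip-form x = begin-equality
        flip x ∙ (B ⊛ flip x)
          ≈⟨ sum-cong-≋ (λ i → *-congˡ (trans (sum-cong-≋ (λ j → ≈-by (x j) (B-flip i j)
               (solve 4 (λ b s t x → b :* (t :* x) :- :- s :* (b :* x) := x :* (b :* t :- :- (s :* b)))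
                   refl (B i j) (σ i) (σ j) (x j))))
               (sym (*-distribˡ-sum (- σ i) (λ j → B i j * x j))))) ⟩
        sum (λ i → σ i * x i * (- σ i * (B ⊛ x) i))
          ≈⟨ sum-cong-≋ (λ i → ≈-by (- (x i * (B ⊛ x) i)) (σ²≈1 i)
               (solve 3 (λ s x y → s :* x :* (:- s :* y) :- :- :1 :* (x :* y) := :- (x :* y) :*
                   (s :* s :- :1)) refl (σ i) (x i) ((B ⊛ x) i))) ⟩
        sum (λ i → - 1# * (x i * (B ⊛ x) i))
          ≈⟨ *-distribˡ-sum (- 1#) (λ i → x i * (B ⊛ x) i) ⟨
        - 1# * (x ∙ (B ⊛ x))
          ≈⟨ solve 1 (λ a → :- :1 :* a := :- a) refl (x ∙ (B ⊛ x)) ⟩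
        - (x ∙ (B ⊛ x)) ∎

      module _ {μ₂} (isSecond : IsSecondEigenvalue A μ₂) (μ₂≤θ : μ₂ ≤ θ)
               (0<θ : 0# < θ) (θ<κ : θ < κ) (0<N : 0# < N) where

        -- On `𝟙` and `σ` the matrix `B` acts by `±θ`, so an eigenvector for `μ > θ` is orthogonal
        -- to both. There `B` and `A` agree, and `A` would have two orthogonal eigenvectors above
        -- `θ`, namely `x` and `𝟙`.
        no-eigenpair : ∀ μ → θ < μ → ∀ x → ¬ Spectral.Eigenpair em ℝ B B-sym μ x
        no-eigenpair μ θ<μ x (0<xx , Bx) =
          at-most-one-above A isSecond μ₂≤θ θ<κ θ<μ A𝟙 Ax 0<N 0<xx 𝟙∙x≈0
          where
          scaled : ∀ v → v ∙ (B ⊛ x) ≈ μ * (v ∙ x)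
          scaled v = trans (sum-cong-≋ (λ i → trans (*-congˡ (Bx i))
              (solve 3 (λ v m x → v :* (m :* x) := m :* (v :* x)) refl (v i) μ (x i))))
            (sym (*-distribˡ-sum μ (λ i → v i * x i)))
          𝟙∙x≈0 : 𝟙 ∙ x ≈ 0#
          𝟙∙x≈0 = *-nonzero (<⇒≉ (0<y-x θ<μ)) (≈-by₂ 1# (- 1#) (𝟙∙B⊛ x) (scaled 𝟙)
            (solve 4 (λ m t a b → (m :- t) :* a :- :0 := :1 :* (b :- t :* a) :+ :- :1 :* (b :- m :* a))
                refl
              μ θ (𝟙 ∙ x) (𝟙 ∙ (B ⊛ x))))
          σ∙x≈0 : σ ∙ x ≈ 0#
          σ∙x≈0 = *-nonzero (<⇒≉ (+-pos (<-trans 0<θ θ<μ) 0<θ)) (≈-by₂ 1# (- 1#) (σ∙B⊛ x) (scaled σ)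
            (solve 4 (λ m t a b → (m :+ t) :* a :- :0 := :1 :* (b :- :- t :* a) :+ :- :1 :* (b :- m :* a))
                refl
              μ θ (σ ∙ x) (σ ∙ (B ⊛ x))))
          Ax : InEigenspace A μ x
          Ax i = trans (sym (≈-by₃ 1# (- η) (η * σ i) (B⊛ x i) 𝟙∙x≈0 σ∙x≈0
            (solve 6 (λ b p h a c s → b :- p
               := :1 :* (b :- (:1 :* p :+ :- h :* (a :* :1 :+ :- c :* s)))
                  :+ :- h :* (a :- :0) :+ h :* s :* (c :- :0)) refl
              ((B ⊛ x) i) ((A ⊛ x) i) η (𝟙 ∙ x) (σ ∙ x) (σ i)))) (Bx i)

        form≤ : ∀ x → x ∙ (B ⊛ x) ≤ θ * (x ∙ x)
        form≤ = Spectral.spectral-bound em ℝ B B-sym no-eigenpair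

        -form≤ : ∀ x → - (x ∙ (B ⊛ x)) ≤ θ * (x ∙ x)
        -form≤ x = ≤-trans (≤-reflexive (sym (flip-form x)))
          (≤-trans (form≤ (flip x)) (≤-reflexive (*-congˡ (flip-norm x))))

        ∙-expand : ∀ α β (x y : V n) → (λ i → α * x i + β * y i) ∙ (λ i → α * x i + β * y i)
                   ≈ α * α * (x ∙ x) + 2# * (α * β) * (x ∙ y) + β * β * (y ∙ y)
        ∙-expand α β x y = trans (∙-linearˡ α β x y z) (trans (+-cong (*-congˡ (∙-linearʳ α β x y x))
          (*-congˡ (trans (∙-linearʳ α β x y y) (+-congʳ (*-congˡ (∙-comm y x))))))
          (solve 5 (λ a b X P Y → a :* (a :* X :+ b :* P) :+ b :* (a :* P :+ b :* Y)
             := a :* a :* X :+ :2 :* (a :* b) :* P :+ b :* b :* Y) refl α β (x ∙ x) (x ∙ y) (y ∙ y)))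
          where
          z : V n
          z i = α * x i + β * y i

        -- 2θ(θ² − B²) = (θ − B)(θ + B)(θ − B) + (θ + B)(θ − B)(θ + B)
        B-norm≤ : ∀ w → (B ⊛ w) ∙ (B ⊛ w) ≤ θ * θ * (w ∙ w)
        B-norm≤ w = combine
            (≤-trans (≤-reflexive (-‿cong (sym (form-expand B B-sym θ (- 1#) w v))))
              (≤-trans (-form≤ (λ i → θ * w i + - 1# * v i))
                  (≤-reflexive (*-congˡ (∙-expand θ (- 1#) w v)))))
            (≤-trans (≤-reflexive (sym (form-expand B B-sym θ 1# w v)))
              (≤-trans (form≤ (λ i → θ * w i + 1# * v i)) (≤-reflexive (*-congˡ (∙-expand θ 1# w v)))))
          where
          v = B ⊛ w
          combine : ∀ {W p r s} →
            - (θ * θ * p + 2# * (θ * - 1#) * r + - 1# * - 1# * s) ≤ θ * (θ * θ * W + 2# * (θ * - 1#) * p +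
                - 1# * - 1# * r) →
            θ * θ * p + 2# * (θ * 1#) * r + 1# * 1# * s ≤ θ * (θ * θ * W + 2# * (θ * 1#) * p + 1# * 1# *
                r) →
            r ≤ θ * θ * W
          combine {W} {p} {r} {s} h₁ h₂ = ≤-by (*-cancel-nonneg (*-pos 0<2 0<θ)
              (≤-by (+-nonneg (0≤y-x h₁) (0≤y-x h₂))
            (solve 5 (λ t W p r s → let o = :1 ; 2o = :2 in
               2o :* t :* (t :* t :* W :- r) :- :0
               := (t :* (t :* t :* W :+ 2o :* (t :* :- o) :* p :+ :- o :* :- o :* r) :- :-
                   (t :* t :* p :+ 2o :* (t :* :- o) :* r :+ :- o :* :- o :* s))
                  :+ (t :* (t :* t :* W :+ 2o :* (t :* o) :* p :+ o :* o :* r) :-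
                      (t :* t :* p :+ 2o :* (t :* o) :* r :+ o :* o :* s)))
              refl θ W p r s))) refl

        -- `B-norm≤` rewritten for `A`, with `η N = κ − θ`. This is the form in which the second
        -- eigenvalue enters the bound on the order.
        A-norm≤ : ∀ w → N * ((A ⊛ w) ∙ (A ⊛ w) - θ * θ * (w ∙ w)) ≤
                  (κ - θ) * (κ + θ) * ((𝟙 ∙ w) * (𝟙 ∙ w) + (σ ∙ w) * (σ ∙ w))
        A-norm≤ w = combine (≤-trans (≤-reflexive (sym (B-norm w))) (B-norm≤ w)) ηN≈κ-θ
          where
          combine : ∀ {P W s} → P - η * (κ + θ) * s ≤ θ * θ * W → η * N ≈ κ - θ →
                    N * (P - θ * θ * W) ≤ (κ - θ) * (κ + θ) * s
          combine {P} {W} {s} h e = ≤-by (*-nonneg (<⇒≤ 0<N) (0≤y-x h)) (≈-by (- ((κ + θ) * s)) e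
            (solve 7 (λ N P W t k h s → (k :- t) :* (k :+ t) :* s :- N :* (P :- t :* t :* W) :- N :*
                (t :* t :* W :- (P :- h :* (k :+ t) :* s))
               := :- ((k :+ t) :* s) :* (h :* N :- (k :- t))) refl N P W θ κ η s))

-- From the sequence `F` to the sequence `G`.

module AlternateSums (ℝ : CompleteOrderedField) where
  open Real ℝ
  open LinearAlgebra ℝ

  -- Turns the sequence F into the sequence G.
  altSum : (ℕ → Carrier) → ℕ → Carrier
  altSum f 0             = f 0
  altSum f 1             = f 1
  altSum f (suc (suc i)) = f (suc (suc i)) + altSum f i

  altSum-scale : ∀ a f i → altSum (λ j → a * f j) i ≈ a * altSum f i
  altSum-scale a f 0             = refl
  altSum-scale a f 1             = refl
  altSum-scale a f (suc (suc i)) = trans (+-congˡ (altSum-scale a f i)) (sym (distribˡ a _ _))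

  altSum-∙ : ∀ {n} (u : V n) (f : ℕ → V n) i →
             u ∙ (λ j → altSum (λ l → f l j) i) ≈ altSum (λ l → u ∙ f l) i
  altSum-∙ u f 0             = refl
  altSum-∙ u f 1             = refl
  altSum-∙ u f (suc (suc i)) = begin-equality
    u ∙ (λ j → f (suc (suc i)) j + altSum (λ l → f l j) i)
      ≈⟨ ∙-cong {x = u} (λ j → refl) (λ j → sym (+-cong (*-identityˡ _) (*-identityˡ _))) ⟩
    u ∙ (λ j → 1# * f (suc (suc i)) j + 1# * altSum (λ l → f l j) i)
      ≈⟨ ∙-linearʳ 1# 1# (f (suc (suc i))) (λ j → altSum (λ l → f l j) i) u ⟩
    1# * (u ∙ f (suc (suc i))) + 1# * (u ∙ (λ j → altSum (λ l → f l j) i))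
      ≈⟨ +-cong (*-identityˡ _) (trans (*-identityˡ _) (altSum-∙ u f i)) ⟩
    altSum (λ l → u ∙ f l) (suc (suc i)) ∎

  module _ {q κ} (κ≈q+1 : κ ≈ q + 1#) (f Lf : ℕ → Carrier)
    (f₁ : f 1 ≈ Lf 0) (f₂ : f 2 ≈ Lf 1 - κ * f 0)
    (f₊ : ∀ i → f (suc (suc (suc i))) ≈ Lf (suc (suc i)) - q * f (suc i)) where

    -- The irregular start, with `κ` in place of `q`, is absorbed by the extra term `f 0` because
    -- `κ = q + 1`; the sums then obey one recurrence throughout. `Lf` is `f` multiplied by `x` for
    -- polynomials, and `A` applied to `f` for walk vectors.
    altSum-recurrence : ∀ i → altSum f (suc (suc i)) ≈ altSum Lf (suc i) - q * altSum f i
    altSum-recurrence 0 = ≈-by₂ 1# (- f 0) f₂ κ≈q+1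
      (solve 5 (λ f₂ f₀ l k q → f₂ :+ f₀ :- (l :- q :* f₀)
         := :1 :* (f₂ :- (l :- k :* f₀)) :+ :- f₀ :* (k :- (q :+ :1))) refl (f 2) (f 0) (Lf 1) κ q)
    altSum-recurrence 1 = ≈-by₂ 1# 1# (f₊ 0) f₁
      (solve 5 (λ f₃ f₁ l₂ l₀ q → f₃ :+ f₁ :- (l₂ :+ l₀ :- q :* f₁)
         := :1 :* (f₃ :- (l₂ :- q :* f₁)) :+ :1 :* (f₁ :- l₀)) refl (f 3) (f 1) (Lf 2) (Lf 0) q)
    altSum-recurrence (suc (suc i)) = ≈-by₂ 1# 1# (f₊ (suc i)) (altSum-recurrence i)
      (solve 7 (λ f₄ l₃ f₂ s₂ p₁ s₀ q → f₄ :+ s₂ :- (l₃ :+ p₁ :- q :* (f₂ :+ s₀))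
         := :1 :* (f₄ :- (l₃ :- q :* f₂)) :+ :1 :* (s₂ :- (p₁ :- q :* s₀))) refl
        (f (suc (suc (suc (suc i))))) (Lf (suc (suc (suc i)))) (f (suc (suc i))) (altSum f (suc (suc i)))
            (altSum Lf (suc i)) (altSum f i) q)

module Polynomials (ℝ : CompleteOrderedField) (k : ℕ) where
  open Real ℝ
  open LinearAlgebra ℝ
  open AlternateSums ℝ

  κ q : Carrier
  κ = fromℕ k
  q = κ - 1#

  open Chebyshev ℝ q

  κ≈q+1 : κ ≈ q + 1#
  κ≈q+1 = solve 1 (λ k → k := k :- :1 :+ :1) refl κ

  G≈altSum : ∀ i x → G k i x ≈ altSum (λ j → F k j x) i
  G≈altSum 0             x = +-identityʳ _
  G≈altSum 1             x = +-identityʳ _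
  G≈altSum (suc (suc i)) x = +-congˡ (trans
    (sum-cong-≋ {suc ⌊ i /2⌋} (λ j → reflexive (≡.cong (λ m → F k m x) (shift (toℕ j))))) (G≈altSum i x))
    where
    shift : ∀ m → suc (suc i) ∸ 2 ℕ.* suc m ≡ i ∸ 2 ℕ.* m
    shift m rewrite ℕ.+-suc m (m ℕ.+ 0) = ≡.refl

  altSumF≈g : ∀ i x → altSum (λ j → F k j x) i ≈ g i x
  altSumF≈g 0             x = refl
  altSumF≈g 1             x = refl
  altSumF≈g (suc (suc i)) x = trans
    (altSum-recurrence κ≈q+1 (λ j → F k j x) (λ j → x * F k j x)
      (sym (*-identityʳ x))
      (solve 2 (λ x k → x :* (x :* :1) :- k := x :* x :- k :* :1) refl x κ)
      (λ j → refl) i)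
    (+-cong (trans (altSum-scale x (λ j → F k j x) (suc i)) (*-congˡ (altSumF≈g (suc i) x)))
            (-‿cong (*-congˡ (altSumF≈g i x))))

  G≈g : ∀ i x → G k i x ≈ g i x
  G≈g i x = trans (G≈altSum i x) (altSumF≈g i x)

  -- The alternate sums telescope. This is what rewrites `c` through the values of `g` at `θ`.
  F≈g-g : ∀ i x → F k (suc (suc i)) x ≈ g (suc (suc i)) x - g i x
  F≈g-g i x = ≈-by₂ (- 1#) 1# (sym (altSumF≈g (suc (suc i)) x)) (sym (altSumF≈g i x))
    (solve 4 (λ f s G₂ G₀ → f :- (G₂ :- G₀) := :- :1 :* (G₂ :- (f :+ s)) :+ :1 :* (G₀ :- s)) refl
      (F k (suc (suc i)) x) (altSum (λ j → F k j x) i) (g (suc (suc i)) x) (g i x))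

-- Non-backtracking walks.

module WalkCounts (ℝ : CompleteOrderedField) {n : ℕ} where
  open Real ℝ
  open LinearAlgebra ℝ
  open AlternateSums ℝ

  -- What is used of the fact that walk counts are natural numbers.
  ZeroOrLarge : Carrier → Set
  ZeroOrLarge x = x ≈ 0# ⊎ 1# ≤ x

  zeroOrLarge-nonneg : ∀ {x} → ZeroOrLarge x → 0# ≤ x
  zeroOrLarge-nonneg (inj₁ x≈0) = ≤-reflexive (sym x≈0)
  zeroOrLarge-nonneg (inj₂ 1≤x) = ≤-trans 0≤1 1≤x

  zeroOrLarge-resp : ∀ {x y} → x ≈ y → ZeroOrLarge x → ZeroOrLarge y
  zeroOrLarge-resp x≈y (inj₁ x≈0) = inj₁ (trans (sym x≈y) x≈0)
  zeroOrLarge-resp x≈y (inj₂ 1≤x) = inj₂ (≤-trans 1≤x (≤-reflexive x≈y))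

  zeroOrLarge-+ : ∀ {x y} → ZeroOrLarge x → ZeroOrLarge y → ZeroOrLarge (x + y)
  zeroOrLarge-+ (inj₁ x≈0) y = zeroOrLarge-resp (sym (trans (+-congʳ x≈0) (+-identityˡ _))) y
  zeroOrLarge-+ {x} {y} (inj₂ 1≤x) yL = inj₂ (≤-by (+-nonneg (0≤y-x 1≤x) (zeroOrLarge-nonneg yL))
    (solve 2 (λ x y → x :+ y :- :1 := (x :- :1) :+ y) refl x y))

  zeroOrLarge-* : ∀ {x y} → ZeroOrLarge x → ZeroOrLarge y → ZeroOrLarge (x * y)
  zeroOrLarge-* {x} {y} (inj₁ x≈0) _          = inj₁ (trans (*-congʳ x≈0) (zeroˡ y))
  zeroOrLarge-* {x} {y} (inj₂ _)   (inj₁ y≈0) = inj₁ (trans (*-congˡ y≈0) (zeroʳ x))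
  zeroOrLarge-* {x} {y} (inj₂ 1≤x) (inj₂ 1≤y) = inj₂ (≤-by
    (+-nonneg (*-nonneg (0≤y-x 1≤x) (≤-trans 0≤1 1≤y)) (0≤y-x 1≤y))
    (solve 2 (λ x y → x :* y :- :1 := (x :- :1) :* y :+ (y :- :1)) refl x y))

  zeroOrLarge-sum : ∀ {m} (x : V m) → (∀ i → ZeroOrLarge (x i)) → ZeroOrLarge (sum x)
  zeroOrLarge-sum {zero}  x p = inj₁ refl
  zeroOrLarge-sum {suc m} x p = zeroOrLarge-+ (p zero) (zeroOrLarge-sum (x ∘ suc) (p ∘ suc))

  δ-01 : ∀ {m} (i j : Fin m) → δ i j ≈ 0# ⊎ δ i j ≈ 1#
  δ-01 zero    zero    = inj₂ refl
  δ-01 zero    (suc j) = inj₁ refl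
  δ-01 (suc i) zero    = inj₁ refl
  δ-01 (suc i) (suc j) = δ-01 i j

  δ-zeroOrLarge : ∀ {m} (i j : Fin m) → ZeroOrLarge (δ i j)
  δ-zeroOrLarge i j = [ inj₁ , (λ e → inj₂ (≤-reflexive (sym e))) ]′ (δ-01 i j)

  1-δ-zeroOrLarge : ∀ {m} (i j : Fin m) → ZeroOrLarge (1# - δ i j)
  1-δ-zeroOrLarge i j =
    [ (λ e → inj₂ (≤-reflexive (≈-by 1# e (solve 1 (λ d → :1 :- (:1 :- d) := :1 :* (d :- :0)) refl _))))
    , (λ e → inj₁ (≈-by (- 1#) e (solve 1 (λ d → :1 :- d :- :0 := :- :1 :* (d :- :1)) refl _))) ]′
        (δ-01 i j)

  module _ (A : Matrix n) {q κ} (κ≈q+1 : κ ≈ q + 1#)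
    (A-sym : Symmetric A) (A-idem : ∀ i j → A i j * A i j ≈ A i j)
    (A-zeroOrLarge : ∀ i j → ZeroOrLarge (A i j)) (row-sum : ∀ i → sum (A i) ≈ κ) (u : Fin n) where

    -- walks i x w counts the non-backtracking walks of length 1+i from u whose last step is w → x.
    walks : ℕ → Fin n → Fin n → Carrier
    walks zero    x w = A x w * δ u w
    walks (suc i) x w = A x w * sum (λ y → (1# - δ x y) * walks i w y)

    φ : ℕ → V n
    φ zero    x = δ u x
    φ (suc i) x = sum (walks i x)

    walks-zeroOrLarge : ∀ i x w → ZeroOrLarge (walks i x w)
    walks-zeroOrLarge zero    x w = zeroOrLarge-* (A-zeroOrLarge x w) (δ-zeroOrLarge u w)
    walks-zeroOrLarge (suc i) x w = zeroOrLarge-* (A-zeroOrLarge x w)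
      (zeroOrLarge-sum _ (λ y → zeroOrLarge-* (1-δ-zeroOrLarge x y) (walks-zeroOrLarge i w y)))

    φ-zeroOrLarge : ∀ i x → ZeroOrLarge (φ i x)
    φ-zeroOrLarge zero    x = δ-zeroOrLarge u x
    φ-zeroOrLarge (suc i) x = zeroOrLarge-sum _ (walks-zeroOrLarge i x)

    walks-step : ∀ i x w → walks (suc i) x w ≈ A x w * (φ (suc i) w - walks i w x)
    walks-step i x w = *-congˡ (begin-equality
      sum (λ y → (1# - δ x y) * walks i w y)
        ≈⟨ sum-cong-≋ (λ y → solve 2 (λ d v → (:1 :- d) :* v := :1 :* v :+ :- :1 :* (d :* v)) refl (δ x y)
            (walks i w y)) ⟩
      sum (λ y → 1# * walks i w y + - 1# * (δ x y * walks i w y))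
        ≈⟨ sum-linear 1# (- 1#) (walks i w) (λ y → δ x y * walks i w y) ⟩
      1# * φ (suc i) w + - 1# * sum (λ y → δ x y * walks i w y)
        ≈⟨ +-congˡ (*-congˡ (sum-δ x (walks i w))) ⟩
      1# * φ (suc i) w + - 1# * walks i w x
        ≈⟨ solve 2 (λ a b → :1 :* a :+ :- :1 :* b := a :- b) refl _ _ ⟩
      φ (suc i) w - walks i w x ∎)

    walks-edge : ∀ i x w → A x w * walks i x w ≈ walks i x w
    walks-edge zero    x w = trans (sym (*-assoc _ _ _)) (*-congʳ (A-idem x w))
    walks-edge (suc i) x w = trans (sym (*-assoc _ _ _)) (*-congʳ (A-idem x w))

    -- The walks of length 2+i are one-step extensions of those of length 1+i, less the
    -- extensions that backtrack.
    φ-extend : ∀ i x → φ (suc (suc i)) x ≈ (A ⊛ φ (suc i)) x - sum (λ w → A x w * walks i w x)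
    φ-extend i x = begin-equality
      sum (walks (suc i) x)
        ≈⟨ sum-cong-≋ (λ w → trans (walks-step i x w)
             (solve 3 (λ a f v → a :* (f :- v) := :1 :* (a :* f) :+ :- :1 :* (a :* v)) refl (A x w)
                 (φ (suc i) w) (walks i w x))) ⟩
      sum (λ w → 1# * (A x w * φ (suc i) w) + - 1# * (A x w * walks i w x))
        ≈⟨ sum-linear 1# (- 1#) (λ w → A x w * φ (suc i) w) (λ w → A x w * walks i w x) ⟩
      1# * (A ⊛ φ (suc i)) x + - 1# * sum (λ w → A x w * walks i w x)
        ≈⟨ solve 2 (λ a b → :1 :* a :+ :- :1 :* b := a :- b) refl _ _ ⟩
      (A ⊛ φ (suc i)) x - sum (λ w → A x w * walks i w x) ∎

    A*Aᵀ : ∀ x w → A x w * A w x ≈ A x w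
    A*Aᵀ x w = trans (*-congˡ (A-sym w x)) (A-idem x w)

    -- The walk of length zero has no last step, so all `κ` of its extensions can be undone, where a
    -- longer walk has `q`.
    φ₂ : ∀ x → φ 2 x ≈ (A ⊛ φ 1) x - κ * φ 0 x
    φ₂ x = trans (φ-extend 0 x) (+-congˡ (-‿cong (begin-equality
      sum (λ w → A x w * (A w x * δ u x)) 
          ≈⟨ sum-cong-≋ (λ w → trans (sym (*-assoc _ _ _)) (*-congʳ (A*Aᵀ x w))) ⟩
      sum (λ w → A x w * δ u x)            ≈⟨ *-distribʳ-sum (δ u x) (A x) ⟨
      sum (A x) * δ u x                    ≈⟨ *-congʳ (row-sum x) ⟩
      κ * δ u x                            ∎)))

    -- A walk ending at `x` extends without backtracking to the `q` neighbours other than its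
    -- last-but-one vertex. Returning from each of these to `x` accounts for the subtracted
    -- backtracking extensions.
    φ₊ : ∀ i x → φ (suc (suc (suc i))) x ≈ (A ⊛ φ (suc (suc i))) x - q * φ (suc i) x
    φ₊ i x = trans (φ-extend (suc i) x) (+-congˡ (-‿cong (begin-equality
      sum (λ w → A x w * walks (suc i) w x)
        ≈⟨ sum-cong-≋ (λ w → trans (*-congˡ (walks-step i w x)) (trans (sym (*-assoc _ _ _))
            (trans (*-congʳ (A*Aᵀ x w))
             (trans (solve 3 (λ a f v → a :* (f :- v) := f :* a :+ :- :1 :* (a :* v)) refl (A x w)
                 (φ (suc i) x) (walks i x w))
                    (+-congˡ (*-congˡ (walks-edge i x w))))))) ⟩
      sum (λ w → φ (suc i) x * A x w + - 1# * walks i x w)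
        ≈⟨ sum-linear (φ (suc i) x) (- 1#) (A x) (walks i x) ⟩
      φ (suc i) x * sum (A x) + - 1# * φ (suc i) x
        ≈⟨ ≈-by₂ (φ (suc i) x) (φ (suc i) x) (row-sum x) κ≈q+1
             (solve 4 (λ f s k q → f :* s :+ :- :1 :* f :- q :* f := f :* (s :- k) :+ f :*
                 (k :- (q :+ :1))) refl (φ (suc i) x) (sum (A x)) κ q) ⟩
      q * φ (suc i) x ∎)))

    γ : ℕ → V n
    γ i x = altSum (λ j → φ j x) i

    γ-zeroOrLarge : ∀ i x → ZeroOrLarge (γ i x)
    γ-zeroOrLarge 0             x = φ-zeroOrLarge 0 x
    γ-zeroOrLarge 1             x = φ-zeroOrLarge 1 x
    γ-zeroOrLarge (suc (suc i)) x = zeroOrLarge-+ (φ-zeroOrLarge (suc (suc i)) x) (γ-zeroOrLarge i x)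

    γ-recurrence : ∀ i x → γ (suc (suc i)) x ≈ (A ⊛ γ (suc i)) x - q * γ i x
    γ-recurrence i x = trans
      (altSum-recurrence κ≈q+1 (λ j → φ j x) (λ j → (A ⊛ φ j) x) refl (φ₂ x) (λ j → φ₊ j x) i)
      (+-congʳ (sym (altSum-∙ (A x) φ (suc i))))

    Aγ : ∀ i x → (A ⊛ γ (suc i)) x ≈ 1# * γ (suc (suc i)) x + q * γ i x
    Aγ i x = ≈-by (- 1#) (γ-recurrence i x)
      (solve 4 (λ a g₂ g₀ q → a :- (:1 :* g₂ :+ q :* g₀) := :- :1 :* (g₂ :- (a :- q :* g₀))) refl
        ((A ⊛ γ (suc i)) x) (γ (suc (suc i)) x) (γ i x) q)

    A²γ₀ : ∀ x → (A ⊛ (A ⊛ γ 0)) x ≈ γ 2 x + q * γ 0 x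
    A²γ₀ x = trans (Aγ 0 x) (+-congʳ (*-identityˡ _))

    A²γ₁ : ∀ x → (A ⊛ (A ⊛ γ 1)) x ≈ γ 3 x + 2# * q * γ 1 x
    A²γ₁ x = begin-equality
      (A ⊛ (A ⊛ γ 1)) x                     ≈⟨ ⊛-cong A (Aγ 0) x ⟩
      (A ⊛ (λ y → 1# * γ 2 y + q * γ 0 y)) x ≈⟨ ⊛-linear A 1# q (γ 2) (γ 0) x ⟩
      1# * (A ⊛ γ 2) x + q * (A ⊛ γ 0) x    ≈⟨ +-congʳ (*-congˡ (Aγ 1 x)) ⟩
      1# * (1# * γ 3 x + q * γ 1 x) + q * γ 1 x
        ≈⟨ solve 3 (λ g₃ g₁ q → :1 :* (:1 :* g₃ :+ q :* g₁) :+ q :* g₁ := g₃ :+ :2 :* q :* g₁) refl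
            (γ 3 x) (γ 1 x) q ⟩
      γ 3 x + 2# * q * γ 1 x                ∎

    A²γ : ∀ i x → (A ⊛ (A ⊛ γ (suc (suc i)))) x ≈
                  γ (suc (suc (suc (suc i)))) x + 2# * q * γ (suc (suc i)) x + q * q * γ i x
    A²γ i x = begin-equality
      (A ⊛ (A ⊛ γ (suc (suc i)))) x
        ≈⟨ ⊛-cong A (Aγ (suc i)) x ⟩
      (A ⊛ (λ y → 1# * γ (suc (suc (suc i))) y + q * γ (suc i) y)) x
        ≈⟨ ⊛-linear A 1# q (γ (suc (suc (suc i)))) (γ (suc i)) x ⟩
      1# * (A ⊛ γ (suc (suc (suc i)))) x + q * (A ⊛ γ (suc i)) x
        ≈⟨ +-cong (*-congˡ (Aγ (suc (suc i)) x)) (*-congˡ (Aγ i x)) ⟩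
      1# * (1# * γ (suc (suc (suc (suc i)))) x + q * γ (suc (suc i)) x) + q * (1# * γ (suc (suc i)) x + q
          * γ i x)
        ≈⟨ solve 4 (λ g₄ g₂ g₀ q → :1 :* (:1 :* g₄ :+ q :* g₂) :+ q :* (:1 :* g₂ :+ q :* g₀)
             := g₄ :+ :2 :* q :* g₂ :+ q :* q :* g₀) refl
             (γ (suc (suc (suc (suc i)))) x) (γ (suc (suc i)) x) (γ i x) q ⟩
      _ ∎

    -- The Christoffel-Darboux vector `W`.

    module _ {θ} (a : ℕ → Carrier) (a₀ : a 0 ≈ 1#) (a₁ : a 1 ≈ θ)
      (a-recurrence : ∀ i → a (suc (suc i)) ≈ θ * a (suc i) - q * a i) where

      W : ℕ → V n
      W 0             x = a 0 * γ 0 x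
      W 1             x = a 1 * γ 1 x
      W (suc (suc i)) x = a (suc (suc i)) * γ (suc (suc i)) x + q * q * W i x

      private
        A²-scale : ∀ c (v : V n) x → (A ⊛ (A ⊛ (λ y → c * v y))) x ≈ c * (A ⊛ (A ⊛ v)) x
        A²-scale c v x = trans (⊛-cong A (scale v) x) (scale (A ⊛ v) x)
          where
          scale : ∀ (v : V n) x → (A ⊛ (λ y → c * v y)) x ≈ c * (A ⊛ v) x
          scale v x = trans (sum-cong-≋ (λ y → solve 3 (λ a c v → a :* (c :* v) := c :* (a :* v)) refl
              (A x y) c (v y)))
            (sym (*-distribˡ-sum c (λ y → A x y * v y)))

        A²-linear : ∀ c d (v w : V n) x →
          (A ⊛ (A ⊛ (λ y → c * v y + d * w y))) x ≈ c * (A ⊛ (A ⊛ v)) x + d * (A ⊛ (A ⊛ w)) x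
        A²-linear c d v w x = trans (⊛-cong A (⊛-linear A c d v w) x) (⊛-linear A c d (A ⊛ v) (A ⊛ w) x)

        a₁′ : a 1 ≈ θ * a 0
        a₁′ = ≈-by₂ 1# (- θ) a₁ a₀
          (solve 3 (λ x y t → x :- t :* y := :1 :* (x :- t) :+ :- t :* (y :- :1)) refl (a 1) (a 0) θ)

        θ²a : ∀ i → θ * θ * a (suc (suc i)) ≈ a (suc (suc (suc (suc i)))) + 2# * q * a (suc (suc i)) + q *
            q * a i
        θ²a i = ≈-by₃ (- 1#) (- θ) (- q) (a-recurrence (suc (suc i))) (a-recurrence (suc i))
            (a-recurrence i)
          (solve 7 (λ t q a₀ a₁ a₂ a₃ a₄ → t :* t :* a₂ :- (a₄ :+ :2 :* q :* a₂ :+ q :* q :* a₀)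
             := :- :1 :* (a₄ :- (t :* a₃ :- q :* a₂)) :+ :- t :* (a₃ :- (t :* a₂ :- q :* a₁)) :+ :- q :*
                 (a₂ :- (t :* a₁ :- q :* a₀)))
           refl θ q (a i) (a (suc i)) (a (suc (suc i))) (a (suc (suc (suc i))))
               (a (suc (suc (suc (suc i))))))

      -- In steps of two, `A²` on `γ` and `θ²` on `a` obey the same recurrence with coefficients
      -- `1`, `2 q`, `q²`. The diagonal terms cancel, and the factor `q²` in front of the previous
      -- `W` makes its boundary terms cancel too. Both parities need a base case, since the
      -- recurrence is shorter at its start.
      christoffel-darboux : ∀ i x → (A ⊛ (A ⊛ W i)) x - θ * θ * W i x ≈ a i * γ (suc (suc i)) x - a
          (suc (suc i)) * γ i x
      christoffel-darboux 0 x = trans (+-congʳ (trans (A²-scale (a 0) (γ 0) x) (*-congˡ (A²γ₀ x))))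
        (≈-by₂ (γ 0 x) (θ * γ 0 x) (a-recurrence 0) a₁′
          (solve 7 (λ t q a₀ a₁ a₂ g₀ g₂ → a₀ :* (g₂ :+ q :* g₀) :- t :* t :* (a₀ :* g₀) :-
              (a₀ :* g₂ :- a₂ :* g₀)
             := g₀ :* (a₂ :- (t :* a₁ :- q :* a₀)) :+ t :* g₀ :* (a₁ :- t :* a₀)) refl
             θ q (a 0) (a 1) (a 2) (γ 0 x) (γ 2 x)))
      christoffel-darboux 1 x = trans (+-congʳ (trans (A²-scale (a 1) (γ 1) x) (*-congˡ (A²γ₁ x))))
        (≈-by₃ (γ 1 x) (θ * γ 1 x) (q * γ 1 x) (a-recurrence 1) (a-recurrence 0) a₁′
          (solve 8 (λ t q a₀ a₁ a₂ a₃ g₁ g₃ → a₁ :* (g₃ :+ :2 :* q :* g₁) :- t :* t :* (a₁ :* g₁) :-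
              (a₁ :* g₃ :- a₃ :* g₁)
             := g₁ :* (a₃ :- (t :* a₂ :- q :* a₁)) :+ t :* g₁ :* (a₂ :- (t :* a₁ :- q :* a₀)) :+ q :* g₁
                 :* (a₁ :- t :* a₀)) refl
             θ q (a 0) (a 1) (a 2) (a 3) (γ 1 x) (γ 3 x)))
      christoffel-darboux (suc (suc i)) x = trans
        (+-congʳ (trans (A²-linear (a (suc (suc i))) (q * q) (γ (suc (suc i))) (W i) x)
            (+-congʳ (*-congˡ (A²γ i x)))))
        (≈-by₂ (q * q) (- γ (suc (suc i)) x) (christoffel-darboux i x) (θ²a i)
          (step θ q (a i) (a (suc (suc i))) (a (suc (suc (suc (suc i)))))
             (γ i x) (γ (suc (suc i)) x) (γ (suc (suc (suc (suc i)))) x) ((A ⊛ (A ⊛ W i)) x) (W i x)))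
        where
        step : ∀ t q a₀ a₂ a₄ g₀ g₂ g₄ X w →
          a₂ * (g₄ + 2# * q * g₂ + q * q * g₀) + q * q * X - t * t * (a₂ * g₂ + q * q * w) -
              (a₂ * g₄ - a₄ * g₂)
          ≈ q * q * (X - t * t * w - (a₀ * g₂ - a₂ * g₀)) + - g₂ *
              (t * t * a₂ - (a₄ + 2# * q * a₂ + q * q * a₀))
        step = solve 10 (λ t q a₀ a₂ a₄ g₀ g₂ g₄ X w → let 2q = :2 :* q in
          a₂ :* (g₄ :+ 2q :* g₂ :+ q :* q :* g₀) :+ q :* q :* X :- t :* t :* (a₂ :* g₂ :+ q :* q :* w) :-
              (a₂ :* g₄ :- a₄ :* g₂)
          := q :* q :* (X :- t :* t :* w :- (a₀ :* g₂ :- a₂ :* g₀)) :+ :- g₂ :*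
              (t :* t :* a₂ :- (a₄ :+ 2q :* a₂ :+ q :* q :* a₀))) refl

      PositiveUpTo : ℕ → Set
      PositiveUpTo i = ∀ j → j ℕ.≤ i → 0# < a j

      private
        weaken : ∀ i → PositiveUpTo (suc (suc i)) → PositiveUpTo i
        weaken i p j j≤i = p j (ℕ.m≤n⇒m≤1+n (ℕ.m≤n⇒m≤1+n j≤i))

      W-nonneg : ∀ i → PositiveUpTo i → ∀ x → 0# ≤ W i x
      W-nonneg 0             p x = *-nonneg (<⇒≤ (p 0 ℕ.≤-refl)) (zeroOrLarge-nonneg (γ-zeroOrLarge 0 x))
      W-nonneg 1             p x = *-nonneg (<⇒≤ (p 1 ℕ.≤-refl)) (zeroOrLarge-nonneg (γ-zeroOrLarge 1 x))
      W-nonneg (suc (suc i)) p x = +-nonneg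
        (*-nonneg (<⇒≤ (p (suc (suc i)) ℕ.≤-refl)) (zeroOrLarge-nonneg (γ-zeroOrLarge (suc (suc i)) x)))
        (*-nonneg (sq-nonneg q) (W-nonneg i (weaken i p) x))

      -- Since `γ (i + 2)` is `γ i` plus a walk count, a zero of the last `γ` is a zero of all
      -- earlier ones of its parity, hence of `W`. Elsewhere integrality gives at least one.
      W-support : ∀ i x → W i x ≈ 0# ⊎ 1# ≤ γ i x
      W-support 0 x with γ-zeroOrLarge 0 x
      ... | inj₁ γ≈0 = inj₁ (trans (*-congˡ γ≈0) (zeroʳ _))
      ... | inj₂ 1≤γ = inj₂ 1≤γ
      W-support 1 x with γ-zeroOrLarge 1 x
      ... | inj₁ γ≈0 = inj₁ (trans (*-congˡ γ≈0) (zeroʳ _))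
      ... | inj₂ 1≤γ = inj₂ 1≤γ
      W-support (suc (suc i)) x with γ-zeroOrLarge (suc (suc i)) x | W-support i x
      ... | inj₂ 1≤γ | _         = inj₂ 1≤γ
      ... | inj₁ γ≈0 | inj₁ W≈0  = inj₁
          (trans (+-cong (trans (*-congˡ γ≈0) (zeroʳ _)) (trans (*-congˡ W≈0) (zeroʳ _)))
          (+-identityˡ 0#))
      ... | inj₁ γ≈0 | inj₂ 1≤γ′ = contradiction
        (+-nonneg-pos (zeroOrLarge-nonneg (φ-zeroOrLarge (suc (suc i)) x)) (<-≤-trans 0<1 1≤γ′))
        (<-irrefl (sym γ≈0))

      W≤Wγ : ∀ i → PositiveUpTo i → ∀ x → W i x ≤ W i x * γ i x
      W≤Wγ i p x with W-support i x
      ... | inj₁ W≈0 = ≤-reflexive (trans W≈0 (sym (trans (*-congʳ W≈0) (zeroˡ _))))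
      ... | inj₂ 1≤γ = ≤-by (*-nonneg (W-nonneg i p x) (0≤y-x 1≤γ))
        (solve 2 (λ w g → w :* g :- w := w :* (g :- :1)) refl (W i x) (γ i x))

-- The bound on the number of vertices.

module OrderBound (em : ExcludedMiddle 0ℓ) (ℝ : CompleteOrderedField) where
  open Real ℝ
  open LinearAlgebra ℝ
  open AlternateSums ℝ
  open BipartiteRegular em ℝ
  open import Algebra.Properties.Semiring.Exp semiring using (_^_)

  geometric : Carrier → ℕ → Carrier
  geometric q e = ∑[ i < suc e ] (q ^ toℕ i)

  geometric-head : ∀ q e → geometric q (suc e) ≈ 1# + q * geometric q e
  geometric-head q e = +-congˡ (sym (*-distribˡ-sum q (λ i → q ^ toℕ {suc e} i)))

  geometric-last : ∀ q e → geometric q (suc e) ≈ geometric q e + q ^ suc e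
  geometric-last q zero    = solve 1 (λ q → :1 :+ (q :* :1 :+ :0) := :1 :+ :0 :+ q :* :1) refl q
  geometric-last q (suc e) = trans (geometric-head q (suc e)) (≈-by₂ q (- 1#) (geometric-last q e)
      (geometric-head q e)
    (solve 4 (λ q h′ h p → :1 :+ q :* h′ :- (h′ :+ q :* p)
      := q :* (h′ :- (h :+ p)) :+ :- :1 :* (h′ :- (:1 :+ q :* h))) refl q (geometric q (suc e))
          (geometric q e) (q ^ suc e)))

  module _ {n} {A : Matrix n} {σ : V n} {q κ : Carrier} (κ≈q+1 : κ ≈ q + 1#) (0<q : 0# < q)
    (structure : IsBipartiteRegular A σ κ)
    (A-idem : ∀ i j → A i j * A i j ≈ A i j)
    (A-zeroOrLarge : ∀ i j → WalkCounts.ZeroOrLarge ℝ {n} (A i j)) (u : Fin n) where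

    open IsBipartiteRegular structure
    open WalkCounts ℝ {n}

    private
      φ′ γ′ : ℕ → V n
      φ′ = φ A κ≈q+1 A-sym A-idem A-zeroOrLarge row-sum u
      γ′ = γ A κ≈q+1 A-sym A-idem A-zeroOrLarge row-sum u

    sum-A⊛ : ∀ x → sum (A ⊛ x) ≈ κ * sum x
    sum-A⊛ x = trans (sym (𝟙∙ (A ⊛ x))) (trans (eigenvector-∙ structure (A𝟙 structure) x)
        (*-congˡ (𝟙∙ x)))

    sum-φ₀ : sum (φ′ 0) ≈ 1#
    sum-φ₀ = trans (sum-cong-≋ (λ j → sym (*-identityʳ (δ u j)))) (sum-δ u (λ _ → 1#))

    -- There are `κ qⁱ` non-backtracking walks of length `i + 1` from `u`. Split as two consecutive
    -- powers, the counts of every second length add up to a full geometric sum, as `sum-γ` records.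
    sum-φ : ∀ i → sum (φ′ (suc i)) ≈ q ^ suc i + q ^ i
    sum-φ 0 = trans (sum-A⊛ (φ′ 0)) (≈-by₂ κ 1# sum-φ₀ κ≈q+1
      (solve 3 (λ k q s → k :* s :- (q :* :1 :+ :1) := k :* (s :- :1) :+ :1 :* (k :- (q :+ :1))) refl κ q
          (sum (φ′ 0))))
    sum-φ 1 = begin-equality
      sum (φ′ 2)
        ≈⟨ sum-cong-≋ (λ x → trans (φ₂ A κ≈q+1 A-sym A-idem A-zeroOrLarge row-sum u x)
             (solve 3 (λ a k f → a :- k :* f := :1 :* a :+ :- k :* f) refl ((A ⊛ φ′ 1) x) κ (φ′ 0 x))) ⟩
      sum (λ x → 1# * (A ⊛ φ′ 1) x + - κ * φ′ 0 x)
        ≈⟨ sum-linear 1# (- κ) (A ⊛ φ′ 1) (φ′ 0) ⟩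
      1# * sum (A ⊛ φ′ 1) + - κ * sum (φ′ 0)
        ≈⟨ +-cong (*-congˡ (trans (sum-A⊛ (φ′ 1)) (*-congˡ (sum-φ 0)))) (*-congˡ sum-φ₀) ⟩
      1# * (κ * (q * 1# + 1#)) + - κ * 1#
        ≈⟨ ≈-by q κ≈q+1 (solve 2 (λ k q → :1 :* (k :* (q :* :1 :+ :1)) :+ :- k :* :1 :-
            (q :* (q :* :1) :+ q :* :1)
             := q :* (k :- (q :+ :1))) refl κ q) ⟩
      q ^ 2 + q ^ 1 ∎
    sum-φ (suc (suc i)) = begin-equality
      sum (φ′ (suc (suc (suc i))))
        ≈⟨ sum-cong-≋ (λ x → trans (φ₊ A κ≈q+1 A-sym A-idem A-zeroOrLarge row-sum u i x)
             (solve 3 (λ a k f → a :- k :* f := :1 :* a :+ :- k :* f) refl ((A ⊛ φ′ (suc (suc i))) x) q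
                 (φ′ (suc i) x))) ⟩
      sum (λ x → 1# * (A ⊛ φ′ (suc (suc i))) x + - q * φ′ (suc i) x)
        ≈⟨ sum-linear 1# (- q) (A ⊛ φ′ (suc (suc i))) (φ′ (suc i)) ⟩
      1# * sum (A ⊛ φ′ (suc (suc i))) + - q * sum (φ′ (suc i))
        ≈⟨ +-cong (*-congˡ (trans (sum-A⊛ (φ′ (suc (suc i)))) (*-congˡ (sum-φ (suc i)))))
            (*-congˡ (sum-φ i)) ⟩
      1# * (κ * (q ^ suc (suc i) + q ^ suc i)) + - q * (q ^ suc i + q ^ i)
        ≈⟨ ≈-by (q * (q * q ^ i) + q * q ^ i) κ≈q+1
            (solve 3 (λ k q p → :1 :* (k :* (q :* (q :* p) :+ q :* p)) :+ :- q :* (q :* p :+ p) :-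
            (q :* (q :* (q :* p)) :+ q :* (q :* p))
             := (q :* (q :* p) :+ q :* p) :* (k :- (q :+ :1))) refl κ q (q ^ i)) ⟩
      q ^ suc (suc (suc i)) + q ^ suc (suc i) ∎

    sum-γ : ∀ e → sum (γ′ e) ≈ geometric q e
    sum-γ 0 = trans sum-φ₀ (sym (+-identityʳ 1#))
    sum-γ 1 = trans (sum-φ 0) (solve 1 (λ q → q :* :1 :+ :1 := :1 :+ (q :* :1 :+ :0)) refl q)
    sum-γ (suc (suc e)) = trans (∑-distrib-+ (φ′ (suc (suc e))) (γ′ e))
        (trans (+-cong (sum-φ (suc e)) (sum-γ e))
      (≈-by₂ (- 1#) (- 1#) (geometric-last q (suc e)) (geometric-last q e)
        (solve 5 (λ h h′ h″ p p′ → p′ :+ p :+ h :- h″ := :- :1 :* (h″ :- (h′ :+ p′)) :+ :- :1 :*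
            (h′ :- (h :+ p))) refl
          (geometric q e) (geometric q (suc e)) (geometric q (suc (suc e))) (q ^ suc e)
              (q ^ suc (suc e)))))

    geometric-pos : ∀ e → 0# < geometric q e
    geometric-pos zero    = +-pos-nonneg 0<1 ≤-refl
    geometric-pos (suc e) = <-respʳ-≈ (sym (geometric-head q e)) (+-pos 0<1 (*-pos 0<q (geometric-pos e)))

    -- The entries of `σ` are `±1`. This bounds the contribution of `- κ` by that of `κ` and so
    -- produces the factor 2.
    σ-bound : ∀ w → (∀ i → 0# ≤ w i) → (σ ∙ w) * (σ ∙ w) ≤ (𝟙 ∙ w) * (𝟙 ∙ w)
    σ-bound w 0≤w = ≤-by (*-nonneg (0≤y-x (sum-mono (λ i → σ i * w i) (λ i → 1# * w i) below))
        (0≤y-x (≤-trans (≤-reflexive -σ∙w) (sum-mono (λ i → - σ i * w i) (λ i → 1# * w i) above))))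
      (solve 2 (λ a b → b :* b :- a :* a := (b :- a) :* (b :- :- a)) refl (σ ∙ w) (𝟙 ∙ w))
      where
      |s|≤1 : ∀ {s} → s * s ≈ 1# → 0# ≤ 1# - s × 0# ≤ 1# + s
      |s|≤1 {s} s²≈1 =
        *-cancel-nonneg 0<2 (≤-by (sq-nonneg (1# - s)) (≈-by (- 1#) s²≈1
          (solve 1 (λ s → let o = :1 in :2 :* (o :- s) :- :0 :- (o :- s) :* (o :- s) := :- o :*
              (s :* s :- o)) refl s))) ,
        *-cancel-nonneg 0<2 (≤-by (sq-nonneg (1# + s)) (≈-by (- 1#) s²≈1
          (solve 1 (λ s → let o = :1 in :2 :* (o :+ s) :- :0 :- (o :+ s) :* (o :+ s) := :- o :*
              (s :* s :- o)) refl s)))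
      below : ∀ i → σ i * w i ≤ 1# * w i
      below i = ≤-by (*-nonneg (proj₁ (|s|≤1 (σ²≈1 i))) (0≤w i))
          (solve 2 (λ s w → :1 :* w :- s :* w := (:1 :- s) :* w) refl (σ i) (w i))
      above : ∀ i → - σ i * w i ≤ 1# * w i
      above i = ≤-by (*-nonneg (proj₂ (|s|≤1 (σ²≈1 i))) (0≤w i))
          (solve 2 (λ s w → :1 :* w :- :- s :* w := (:1 :+ s) :* w) refl (σ i) (w i))
      -σ∙w : - (σ ∙ w) ≈ sum (λ i → - σ i * w i)
      -σ∙w = trans (solve 1 (λ a → :- a := :- :1 :* a) refl (σ ∙ w))
          (trans (*-distribˡ-sum (- 1#) (λ i → σ i * w i))
        (sum-cong-≋ {n} (λ i → solve 2 (λ s w → :- :1 :* (s :* w) := :- s :* w) refl (σ i) (w i))))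

    module _ {θ} (a : ℕ → Carrier) (a₀ : a 0 ≈ 1#) (a₁ : a 1 ≈ θ)
      (a-recurrence : ∀ i → a (suc (suc i)) ≈ θ * a (suc i) - q * a i)
      (N : Carrier) (0<N : 0# < N) (0<θ : 0# < θ) (θ<κ : θ < κ)
      (A-norm : ∀ w → N * ((A ⊛ w) ∙ (A ⊛ w) - θ * θ * (w ∙ w)) ≤
                      (κ - θ) * (κ + θ) * ((𝟙 ∙ w) * (𝟙 ∙ w) + (σ ∙ w) * (σ ∙ w)))
      (e : ℕ) (a-pos : ∀ j → j ℕ.≤ e → 0# < a j) (a-last : a (suc (suc e)) ≤ 0#) where

      private
        W′ : ℕ → V n
        W′ = W A κ≈q+1 A-sym A-idem A-zeroOrLarge row-sum u a a₀ a₁ a-recurrence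

        W′-nonneg : ∀ x → 0# ≤ W′ e x
        W′-nonneg = W-nonneg A κ≈q+1 A-sym A-idem A-zeroOrLarge row-sum u a a₀ a₁ a-recurrence e a-pos

        a″ = a (suc (suc e))

        0<a-a″ : 0# < a e - a″
        0<a-a″ = +-pos-nonneg (a-pos e ℕ.≤-refl) (neg-nonneg a-last)

        P : V n
        P x = a e * γ′ (suc (suc e)) x - a″ * γ′ e x

        sum-W-pos : ∀ i → (∀ j → j ℕ.≤ i → 0# < a j) → 0# < sum (W′ i)
        sum-W-pos 0 p = <-respʳ-≈ (*-distribˡ-sum (a 0) (γ′ 0))
          (*-pos (p 0 ℕ.≤-refl) (<-respʳ-≈ (sym (sum-γ 0)) (geometric-pos 0)))
        sum-W-pos 1 p = <-respʳ-≈ (*-distribˡ-sum (a 1) (γ′ 1))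
          (*-pos (p 1 ℕ.≤-refl) (<-respʳ-≈ (sym (sum-γ 1)) (geometric-pos 1)))
        sum-W-pos (suc (suc i)) p = <-respʳ-≈
            (sym (sum-linear (a (suc (suc i))) (q * q) (γ′ (suc (suc i))) (W′ i)))
          (+-pos (*-pos (p _ ℕ.≤-refl) (<-respʳ-≈ (sym (sum-γ (suc (suc i))))
              (geometric-pos (suc (suc i)))))
                 (*-pos (*-pos 0<q 0<q) (sum-W-pos i (λ j j≤i → p j (ℕ.m≤n⇒m≤1+n (ℕ.m≤n⇒m≤1+n j≤i))))))

        darboux : ∀ v → v ∙ (A ⊛ (A ⊛ W′ e)) - θ * θ * (v ∙ W′ e) ≈ v ∙ P
        darboux v = begin-equality
          v ∙ (A ⊛ (A ⊛ W′ e)) - θ * θ * (v ∙ W′ e)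
            ≈⟨ solve 3 (λ a t b → a :- t :* b := :1 :* a :+ :- t :* b) refl _ _ _ ⟩
          1# * (v ∙ (A ⊛ (A ⊛ W′ e))) + - (θ * θ) * (v ∙ W′ e)
            ≈⟨ ∙-linearʳ 1# (- (θ * θ)) (A ⊛ (A ⊛ W′ e)) (W′ e) v ⟨
          v ∙ (λ x → 1# * (A ⊛ (A ⊛ W′ e)) x + - (θ * θ) * W′ e x)
            ≈⟨ ∙-cong {x = v} (λ x → refl) (λ x → trans
                 (solve 3 (λ a t b → :1 :* a :+ :- t :* b := a :- t :* b) refl _ _ _)
                 (christoffel-darboux A κ≈q+1 A-sym A-idem A-zeroOrLarge row-sum u a a₀ a₁ a-recurrence e
                     x)) ⟩
          v ∙ P ∎

        form≈ : (A ⊛ W′ e) ∙ (A ⊛ W′ e) - θ * θ * (W′ e ∙ W′ e) ≈ W′ e ∙ P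
        form≈ = trans (+-congʳ (sym (⊛-symmetric A A-sym (W′ e) (A ⊛ W′ e)))) (darboux (W′ e))

        total≈ : (κ - θ) * (κ + θ) * (𝟙 ∙ W′ e) ≈ sum P
        total≈ = trans (≈-by₂ (- 1#) (- κ)
            (eigenvector-∙ structure (A𝟙 structure) (A ⊛ W′ e)) (eigenvector-∙ structure (A𝟙 structure)
                (W′ e))
            (solve 5 (λ k t w p r → (k :- t) :* (k :+ t) :* w :- (p :- t :* t :* w) := :- :1 :*
                (p :- k :* r) :+ :- k :* (r :- k :* w)) refl
              κ θ (𝟙 ∙ W′ e) (𝟙 ∙ (A ⊛ (A ⊛ W′ e))) (𝟙 ∙ (A ⊛ W′ e))))
          (trans (darboux 𝟙) (𝟙∙ P))

        -- The shape of `M`: after division by `a e - a″`, which is `c` times `a e`, the second term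
        -- gives the sum and the first the two quotients.
        sum-P : sum P ≈ a e * (q ^ suc (suc e) + q ^ suc e) + (a e - a″) * geometric q e
        sum-P = begin-equality
          sum P
            ≈⟨ sum-cong-≋ (λ x → solve 4 (λ a b f g → a :* (f :+ g) :- b :* g := a :* f :+ (a :- b) :* g)
                refl (a e) a″ (φ′ (suc (suc e)) x) (γ′ e x)) ⟩
          sum (λ x → a e * φ′ (suc (suc e)) x + (a e - a″) * γ′ e x)
            ≈⟨ sum-linear (a e) (a e - a″) (φ′ (suc (suc e))) (γ′ e) ⟩
          a e * sum (φ′ (suc (suc e))) + (a e - a″) * sum (γ′ e)
            ≈⟨ +-cong (*-congˡ (sum-φ (suc e))) (*-congˡ (sum-γ e)) ⟩
          a e * (q ^ suc (suc e) + q ^ suc e) + (a e - a″) * geometric q e ∎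

        lower : (a e - a″) * (𝟙 ∙ W′ e) ≤ W′ e ∙ P
        lower = ≤-trans (≤-reflexive (*-distribˡ-sum (a e - a″) (λ x → 1# * W′ e x)))
          (sum-mono (λ x → (a e - a″) * (1# * W′ e x)) (λ x → W′ e x * P x) (λ x → pointwise
            (W′-nonneg x) (zeroOrLarge-nonneg (φ-zeroOrLarge A κ≈q+1 A-sym A-idem A-zeroOrLarge row-sum u
                (suc (suc e)) x))
            (W≤Wγ A κ≈q+1 A-sym A-idem A-zeroOrLarge row-sum u a a₀ a₁ a-recurrence e a-pos x)
            (<⇒≤ (a-pos e ℕ.≤-refl)) (<⇒≤ 0<a-a″)))
          where
          -- Here `f + g` stands for `γ (e + 2)`, which unfolds to `φ (e + 2)` plus `γ e`. The share
          -- of `f` is nonnegative and dropped.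
          pointwise : ∀ {w f g a b} → 0# ≤ w → 0# ≤ f → w ≤ w * g → 0# ≤ a → 0# ≤ a - b →
                      (a - b) * (1# * w) ≤ w * (a * (f + g) - b * g)
          pointwise {w} {f} {g} {a} {b} 0≤w 0≤f w≤wg 0≤a 0≤a-b = ≤-by
            (+-nonneg (*-nonneg (*-nonneg 0≤w 0≤a) 0≤f) (*-nonneg 0≤a-b (0≤y-x w≤wg)))
            (solve 5 (λ w f g a b → w :* (a :* (f :+ g) :- b :* g) :- (a :- b) :* (:1 :* w)
               := w :* a :* f :+ (a :- b) :* (w :* g :- w)) refl w f g a b)

      order-bound : N * (a e - a (suc (suc e))) ≤
        2# * (a e * (q ^ suc (suc e) + q ^ suc e) + (a e - a (suc (suc e))) * geometric q e)
      order-bound = ≤-trans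
        (combine (<-respʳ-≈ (sym (𝟙∙ (W′ e))) (sum-W-pos e a-pos)) lower
          (≤-trans (≤-reflexive (*-congˡ (sym form≈))) (A-norm (W′ e)))
          (σ-bound (W′ e) W′-nonneg) (total≈))
        (≤-reflexive (*-congˡ sum-P))
        where
        combine : ∀ {c ω β T S} → 0# < ω → c * ω ≤ T → N * T ≤ (κ - θ) * (κ + θ) * (ω * ω + β * β) →
                  β * β ≤ ω * ω → (κ - θ) * (κ + θ) * ω ≈ S → N * c ≤ 2# * S
        -- With `d = κ² − θ²` the chain is `N c ω ≤ N T ≤ d (ω² + β²) ≤ 2 d ω² = 2 ω
        -- S`, from which the positive `ω` is cancelled.
        combine {c} {ω} {β} {T} {S} 0<ω cω≤T NT≤ β²≤ω² total = ≤-by (*-cancel-nonneg 0<ω (≤-by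
          (+-nonneg (+-nonneg (*-nonneg (<⇒≤ 0<N) (0≤y-x cω≤T)) (0≤y-x NT≤))
            (*-nonneg (<⇒≤ (*-pos (0<y-x θ<κ) (+-pos (<-trans 0<θ θ<κ) 0<θ))) (0≤y-x β²≤ω²)))
          (≈-by (- (2# * ω)) total (solve 7 (λ N c w b T S d → let t = :2 in
            w :* (t :* S :- N :* c) :- :0
              :- (N :* (T :- c :* w) :+ (d :* (w :* w :+ b :* b) :- N :* T) :+ d :* (w :* w :- b :* b))
            := :- (t :* w) :* (d :* w :- S)) refl N c ω β T S ((κ - θ) * (κ + θ)))))) refl

-- Adjacency matrices of bipartite regular graphs.

module AdjacencyMatrix (em : ExcludedMiddle 0ℓ) (ℝ : CompleteOrderedField) where
  open Real ℝ
  open LinearAlgebra ℝ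
  open BipartiteRegular em ℝ

  sum-indicator : ∀ {n} (f : Fin n → Bool) → sum (λ j → indicator (f j)) ≈ fromℕ ∣ Vec.tabulate f ∣
  sum-indicator {zero}  f = refl
  sum-indicator {suc n} f with f zero
  ... | true  = +-congˡ (sum-indicator (f ∘ suc))
  ... | false = trans (+-identityˡ _) (sum-indicator (f ∘ suc))

  sign : Bool → Carrier
  sign true  = 1#
  sign false = - 1#

  module _ {n k} (Γ : Graph n) (bipartite : Graph.Bipartite Γ) (regular : Graph.Regular Γ k) where
    open Graph Γ

    private
      A : Matrix n
      A = adjacencyMatrix Γ
      side = proj₁ bipartite

    isBipartiteRegular : IsBipartiteRegular A (sign ∘ side) (fromℕ k)
    isBipartiteRegular = record
      { A-sym   = λ i j → reflexive (≡.cong indicator (symmetric i j))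
      ; row-sum = λ i → trans (sum-indicator (adj i)) (reflexive (≡.cong fromℕ (regular i)))
      ; σ²≈1    = λ i → sign² (side i)
      ; A-flip  = λ i j → flip (adj i j) (side i) (side j) (proj₂ bipartite i j)
      }
      where
      sign² : ∀ b → sign b * sign b ≈ 1#
      sign² true  = *-identityˡ 1#
      sign² false = solve 0 (:- :1 :* :- :1 := :1) refl
      flip : ∀ b s t → (T b → ¬ s ≡ t) → indicator b * sign t ≈ - (sign s * indicator b)
      flip false s t _ = solve 2 (λ s t → :0 :* t := :- (s :* :0)) refl (sign s) (sign t)
      flip true true  true  p = contradiction ≡.refl (p _)
      flip true false false p = contradiction ≡.refl (p _)
      flip true true  false p = solve 0 (:1 :* :- :1 := :- (:1 :* :1)) refl
      flip true false true  p = solve 0 (:1 :* :1 := :- (:- :1 :* :1)) refl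

    indicator-idem : ∀ b → indicator b * indicator b ≈ indicator b
    indicator-idem true  = *-identityˡ 1#
    indicator-idem false = zeroˡ 0#

    indicator-zeroOrLarge : ∀ b → WalkCounts.ZeroOrLarge ℝ {n} (indicator b)
    indicator-zeroOrLarge true  = inj₂ ≤-refl
    indicator-zeroOrLarge false = inj₁ refl

-- The complete bipartite graph on `k + k` vertices.

module CompleteBipartite (m : ℕ) where

  k = suc m

  Vertex : Set
  Vertex = Fin (k ℕ.+ k)

  left right : Fin k → Vertex
  left  i = i ↑ˡ k
  right i = k ↑ʳ i

  left′ right′ : Fin m → Fin (m ℕ.+ m)
  left′  i = i ↑ˡ m
  right′ i = m ↑ʳ i

  vertex-elim : ∀ p {r} (P : Fin (p ℕ.+ r) → Set) → (∀ i → P (i ↑ˡ r)) → (∀ i → P (p ↑ʳ i)) → ∀ v → P v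
  vertex-elim p {r} P left right v = ≡.subst P (join-splitAt p r v) (onJoin (splitAt p v))
    where
    onJoin : ∀ s → P (join p r s)
    onJoin (inj₁ i) = left i
    onJoin (inj₂ i) = right i

  side : Vertex → Bool
  side v = [ (λ _ → true) , (λ _ → false) ]′ (splitAt k v)

  side-left : ∀ i → side (left i) ≡ true
  side-left i = ≡.cong [ (λ _ → true) , (λ _ → false) ]′ (splitAt-↑ˡ k i k)

  side-right : ∀ i → side (right i) ≡ false
  side-right i = ≡.cong [ (λ _ → true) , (λ _ → false) ]′ (splitAt-↑ʳ k k i)

  Kₖₖ : Graph (k ℕ.+ k)
  Kₖₖ = record
    { adj       = λ i j → side i xor side j
    ; symmetric = λ i j → xor-comm (side i) (side j)
    ; loopless  = λ i → ≡.subst T (xor-same (side i))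
    }

  open Graph Kₖₖ

  bipartite : Bipartite
  bipartite = side , λ i j e s≡s′ → ≡.subst T (xor-same (side j)) (≡.subst (λ b → T (b xor side j)) s≡s′
      e)

  size : ∀ {n} → (Fin n → Bool) → ℕ
  size f = ∣ Vec.tabulate f ∣

  size-cong : ∀ {n} {f g : Fin n → Bool} → (∀ i → f i ≡ g i) → size f ≡ size g
  size-cong {zero}          p = ≡.refl
  size-cong {suc n} {f} {g} p with f zero | g zero | p zero
  ... | true  | .true  | ≡.refl = ≡.cong suc (size-cong (p ∘ suc))
  ... | false | .false | ≡.refl = size-cong (p ∘ suc)

  size-true : ∀ n → size {n} (λ _ → true) ≡ n
  size-true zero    = ≡.refl
  size-true (suc n) = ≡.cong suc (size-true n)

  size-false : ∀ n → size {n} (λ _ → false) ≡ 0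
  size-false zero    = ≡.refl
  size-false (suc n) = size-false n

  size-split : ∀ p {r} (f : Fin (p ℕ.+ r) → Bool) → size f ≡ size (λ i → f (i ↑ˡ r)) ℕ.+ size
      (λ j → f (p ↑ʳ j))
  size-split zero    f = ≡.refl
  size-split (suc p) f with f zero
  ... | true  = ≡.cong suc (size-split p (f ∘ suc))
  ... | false = size-split p (f ∘ suc)

  regular : Regular k
  regular i = ≡.trans (size-split k (λ j → side i xor side j)) (≡.trans
    (≡.cong₂ ℕ._+_ (size-cong (λ j → ≡.cong (side i xor_) (side-left j)))
                   (size-cong (λ j → ≡.cong (side i xor_) (side-right j)))) (degrees (side i)))
    where
    degrees : ∀ b → size {k} (λ _ → b xor true) ℕ.+ size {k} (λ _ → b xor false) ≡ k
    degrees true  = ≡.cong₂ ℕ._+_ (size-false k) (size-true k)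
    degrees false = ≡.trans (≡.cong₂ ℕ._+_ (size-true k) (size-false k)) (ℕ.+-identityʳ k)

  connected : Connected
  connected i j = path (side i) (side j) ≡.refl ≡.refl
    where
    edge : ∀ i j b → side i ≡ b → side j ≡ not b → Adjacent i j
    edge i j true  p r rewrite p | r = _
    edge i j false p r rewrite p | r = _
    l r : Vertex
    l = left zero
    r = right zero
    path : ∀ b c → side i ≡ b → side j ≡ c → Star Adjacent i j
    path true  false p s = edge i j true p s ◅ Closure.ε
    path false true  p s = edge i j false p s ◅ Closure.ε
    path true  true  p s = _◅_ {j = r} (edge i r true p (side-right zero))
        (edge r j false (side-right zero) s ◅ Closure.ε)
    path false false p s = _◅_ {j = l} (edge i l false p (side-left zero)) (edge l j true (side-left zero)
        s ◅ Closure.ε)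

  -- Its spectrum: `κ`, zero with multiplicity `m + m`, and `- κ`.

  module Spectrum (em : ExcludedMiddle 0ℓ) (ℝ : CompleteOrderedField) where
    open Real ℝ
    open LinearAlgebra ℝ
    open SecondEigenvalue ℝ using (InEigenspace-cong)
    open BipartiteRegular em ℝ
    open AdjacencyMatrix em ℝ

    private
      A : Matrix (k ℕ.+ k)
      A = adjacencyMatrix Kₖₖ

      κ : Carrier
      κ = fromℕ k

      structure = isBipartiteRegular Kₖₖ bipartite regular

    0<κ : 0# < κ
    0<κ = +-pos-nonneg 0<1 (fromℕ-nonneg m)

    sumˡ sumʳ : V (k ℕ.+ k) → Carrier
    sumˡ w = sum (λ i → w (left i))
    sumʳ w = sum (λ j → w (right j))

    opposite : Bool → V (k ℕ.+ k) → Carrier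
    opposite true  w = sumʳ w
    opposite false w = sumˡ w

    A⊛ : ∀ w v → (A ⊛ w) v ≈ opposite (side v) w
    A⊛ w v = trans (sum-split k (λ j → A v j * w j)) (trans
      (+-cong (sum-cong-≋ (λ j → *-congʳ {w (left j)}
          (reflexive (≡.cong (λ b → indicator (side v xor b)) (side-left j)))))
              (sum-cong-≋ (λ j → *-congʳ {w (right j)}
                  (reflexive (≡.cong (λ b → indicator (side v xor b)) (side-right j))))))
      (byside (side v)))
      where
      byside : ∀ b → sum (λ j → indicator (b xor true) * w (left j)) + sum (λ j → indicator (b xor false)
          * w (right j)) ≈ opposite b w
      byside true  = trans (+-cong (sum-zero (λ j → 0# * w (left j)) (λ j → zeroˡ _))
          (sum-cong-≋ {k} (λ j → *-identityˡ (w (right j))))) (+-identityˡ _)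
      byside false = trans (+-cong (sum-cong-≋ {k} (λ j → *-identityˡ (w (left j))))
          (sum-zero (λ j → 0# * w (right j)) (λ j → zeroˡ _))) (+-identityʳ _)

    A⊛ˡ : ∀ w i → (A ⊛ w) (left i) ≈ sumʳ w
    A⊛ˡ w i = trans (A⊛ w (left i)) (reflexive (≡.cong (λ b → opposite b w) (side-left i)))

    A⊛ʳ : ∀ w i → (A ⊛ w) (right i) ≈ sumˡ w
    A⊛ʳ w i = trans (A⊛ w (right i)) (reflexive (≡.cong (λ b → opposite b w) (side-right i)))

    module _ {μ w} (Aw : InEigenspace A μ w) where

      coordˡ : ∀ i → μ * w (left i) ≈ sumʳ w
      coordˡ i = trans (sym (Aw (left i))) (A⊛ˡ w i)

      coordʳ : ∀ i → μ * w (right i) ≈ sumˡ w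
      coordʳ i = trans (sym (Aw (right i))) (A⊛ʳ w i)

      sumsˡ : μ * sumˡ w ≈ κ * sumʳ w
      sumsˡ = trans (*-distribˡ-sum μ (λ i → w (left i))) (trans (sum-cong-≋ coordˡ)
          (sum-const k (sumʳ w)))

      sumsʳ : μ * sumʳ w ≈ κ * sumˡ w
      sumsʳ = trans (*-distribˡ-sum μ (λ i → w (right i))) (trans (sum-cong-≋ coordʳ)
          (sum-const k (sumˡ w)))

    -- The normalisation at `left zero` makes independence a matter of reading off one coordinate.
    one-dimensional : ∀ {μ} v → InEigenspace A μ v → v (left zero) ≈ 1# →
      (∀ w → InEigenspace A μ w → Σ[ a ∈ Carrier ] (∀ i → w i ≈ a * v i)) → HasMultiplicity A μ 1
    one-dimensional v Av v₀≈1 spans = (λ _ → v) , (λ _ → Av) ,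
      (λ { a combo zero → ≈-by₂ 1# (- a zero) (combo (left zero)) v₀≈1
         (solve 2 (λ a v → a :- :0 := :1 :* (a :* v :+ :0 :- :0) :+ :- a :* (v :- :1)) refl (a zero)
             (v (left zero))) }) ,
      (λ w Aw → let (a , w≈) = spans w Aw in (λ _ → a) , λ i → trans (w≈ i) (sym (+-identityʳ _)))

    multiplicity-κ : HasMultiplicity A κ 1
    multiplicity-κ = one-dimensional 𝟙 (A𝟙 structure) refl λ w Aw →
      let (κ⁻¹ , _ , κκ⁻¹≈1) = inverse-pos 0<κ
          sums = *-nonzero (<⇒≉ 0<κ)
              (≈-by 1# (sumsˡ Aw) (solve 3 (λ k l r → k :* (l :- r) :- :0 := :1 :* (k :* l :- k :* r))
              refl κ (sumˡ w) (sumʳ w)))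
      in κ⁻¹ * sumˡ w , vertex-elim k (λ v → w v ≈ κ⁻¹ * sumˡ w * 1#)
        (λ i → ≈-by₃ (- w (left i)) κ⁻¹ (- κ⁻¹) κκ⁻¹≈1 (coordˡ Aw i) sums
          (solve 5 (λ w v l k r → w :- v :* l :* :1 := :- w :* (k :* v :- :1) :+ v :* (k :* w :- r) :+ :-
              v :* (l :- r :- :0)) refl
            (w (left i)) κ⁻¹ (sumˡ w) κ (sumʳ w)))
        (λ i → ≈-by₂ (- w (right i)) κ⁻¹ κκ⁻¹≈1 (coordʳ Aw i)
          (solve 4 (λ w v l k → w :- v :* l :* :1 := :- w :* (k :* v :- :1) :+ v :* (k :* w :- l)) refl
            (w (right i)) κ⁻¹ (sumˡ w) κ))

    multiplicity-neg-κ : HasMultiplicity A (- κ) 1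
    multiplicity-neg-κ = one-dimensional σ (Aσ structure) (reflexive (≡.cong sign (side-left zero))) λ w
        Aw →
      let (κ⁻¹ , _ , κκ⁻¹≈1) = inverse-pos 0<κ
          sums = *-nonzero (<⇒≉ 0<κ)
              (≈-by (- 1#) (sumsˡ Aw)
              (solve 3 (λ k l r → k :* (l :+ r) :- :0 := :- :1 :* (:- k :* l :- k :* r)) refl κ (sumˡ w)
              (sumʳ w)))
      in κ⁻¹ * sumˡ w , vertex-elim k (λ v → w v ≈ κ⁻¹ * sumˡ w * σ v)
        (λ i → trans (≈-by₃ (- w (left i)) (- κ⁻¹) (- κ⁻¹) κκ⁻¹≈1 (coordˡ Aw i) sums
          (solve 5 (λ w v l k r → w :- v :* l :* :1 := :- w :* (k :* v :- :1) :+ :- v :* (:- k :* w :- r)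
              :+ :- v :* (l :+ r :- :0)) refl
            (w (left i)) κ⁻¹ (sumˡ w) κ (sumʳ w)))
                (*-congˡ (reflexive (≡.sym (≡.cong sign (side-left i))))))
        (λ i → trans (≈-by₂ (- w (right i)) (- κ⁻¹) κκ⁻¹≈1 (coordʳ Aw i)
          (solve 4 (λ w v l k → w :- v :* l :* :- :1 := :- w :* (k :* v :- :1) :+ :- v :*
              (:- k :* w :- l)) refl
            (w (right i)) κ⁻¹ (sumˡ w) κ)) (*-congˡ (reflexive (≡.sym (≡.cong sign (side-right i))))))
      where
      σ : V (k ℕ.+ k)
      σ v = sign (side v)

    -- Adding and subtracting the equations for the two block sums gives `(μ − κ) (l + r) = 0` and
    -- `(μ + κ) (l − r) = 0`. Both sums vanish, and with them `μ w`.
    multiplicity-none : ∀ {μ} → μ ≉ 0# → μ ≉ κ → μ ≉ - κ → HasMultiplicity A μ 0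
    multiplicity-none {μ} μ≉0 μ≉κ μ≉-κ = (λ ()) , (λ ()) , (λ { a combo () }) , λ w Aw → (λ ()) , λ v →
      *-nonzero μ≉0 (trans (sym (Aw v)) (trans (A⊛ w v) (opposite≈0 (side v) (sums w Aw))))
      where
      opposite≈0 : ∀ {w} b → sumˡ w ≈ 0# × sumʳ w ≈ 0# → opposite b w ≈ 0#
      opposite≈0 true  (l , r) = r
      opposite≈0 false (l , r) = l
      sums : ∀ w → InEigenspace A μ w → sumˡ w ≈ 0# × sumʳ w ≈ 0#
      sums w Aw = solve-sums (sumsˡ Aw) (sumsʳ Aw)
        where
        solve-sums : ∀ {l r} → μ * l ≈ κ * r → μ * r ≈ κ * l → l ≈ 0# × r ≈ 0#
        solve-sums {l} {r} e₁ e₂ =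
          *-nonzero (<⇒≉ 0<2)
              (≈-by₂ 1# 1# l+r≈0 l-r≈0 (solve 2 (λ l r → :2 :* l :- :0 := :1 :* (l :+ r :- :0) :+ :1 :*
              (l :- r :- :0)) refl l r)) ,
          *-nonzero (<⇒≉ 0<2) (≈-by₂ 1# (- 1#) l+r≈0 l-r≈0
              (solve 2 (λ l r → :2 :* r :- :0 := :1 :* (l :+ r :- :0) :+ :- :1 :* (l :- r :- :0)) refl l
              r))
          where
          l+r≈0 : l + r ≈ 0#
          l+r≈0 = *-nonzero (λ e → μ≉κ (x-y≈0⇒x≈y e)) (≈-by₂ 1# 1# e₁ e₂
            (solve 4 (λ m k l r → (m :- k) :* (l :+ r) :- :0 := :1 :* (m :* l :- k :* r) :+ :1 :*
                (m :* r :- k :* l)) refl μ κ l r))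
          l-r≈0 : l - r ≈ 0#
          l-r≈0 = *-nonzero {μ - - κ} (λ e → μ≉-κ (x-y≈0⇒x≈y e)) (≈-by₂ 1# (- 1#) e₁ e₂
            (solve 4 (λ m k l r → (m :- :- k) :* (l :- r) :- :0 := :1 :* (m :* l :- k :* r) :+ :- :1 :*
                (m :* r :- k :* l)) refl μ κ l r))

    onBlocks : ∀ {X : Set} p {r} → (Fin p → X) → (Fin r → X) → Fin (p ℕ.+ r) → X
    onBlocks p f g x = [ f , g ]′ (splitAt p x)

    onBlocksˡ : ∀ {X : Set} p {r} (f : Fin p → X) (g : Fin r → X) i → onBlocks p f g (i ↑ˡ r) ≡ f i
    onBlocksˡ p {r} f g i = ≡.cong [ f , g ]′ (splitAt-↑ˡ p i r)

    onBlocksʳ : ∀ {X : Set} p {r} (f : Fin p → X) (g : Fin r → X) i → onBlocks p f g (p ↑ʳ i) ≡ g i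
    onBlocksʳ p {r} f g i = ≡.cong [ f , g ]′ (splitAt-↑ʳ p r i)

    -- The basis `e (suc a) − e zero` of the vectors with sum zero. Coordinate `suc b` of a
    -- combination is its coefficient at `b`.
    difference : Fin m → V k
    difference a zero    = - 1#
    difference a (suc b) = δ a b

    sum-difference : ∀ a → sum (difference a) ≈ 0#
    sum-difference a = trans (+-congˡ (trans (sum-cong-≋ (λ b → sym (*-identityʳ (δ a b))))
        (sum-δ a (λ _ → 1#)))) (-‿inverseˡ 1#)

    combine-difference : ∀ (c : V m) b → sum (λ a → c a * difference a (suc b)) ≈ c b
    combine-difference c b = trans (sum-cong-≋ (λ a → trans (*-comm (c a) (δ a b)) (*-congʳ (δ-sym a b))))
        (sum-δ b c)

    expand-difference : ∀ (w : V k) → sum w ≈ 0# → ∀ i → sum (λ a → w (suc a) * difference a i) ≈ w i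
    expand-difference w Σw≈0 (suc b) = combine-difference (w ∘ suc) b
    expand-difference w Σw≈0 zero    = trans (sym (*-distribʳ-sum (- 1#) (w ∘ suc))) (≈-by (- 1#) Σw≈0
      (solve 2 (λ s w → s :* :- :1 :- w := :- :1 :* (w :+ s :- :0)) refl (sum (w ∘ suc)) (w zero)))

    kernelˡ kernelʳ : Fin m → V (k ℕ.+ k)
    kernelˡ a = onBlocks k (difference a) (λ _ → 0#)
    kernelʳ a = onBlocks k (λ _ → 0#) (difference a)

    kernel : Fin (m ℕ.+ m) → V (k ℕ.+ k)
    kernel = onBlocks m kernelˡ kernelʳ

    kernel-ll : ∀ a i → kernel (left′ a) (left i) ≈ difference a i
    kernel-ll a i = reflexive
        (≡.trans (≡.cong (λ (f : V (k ℕ.+ k)) → f (left i)) (onBlocksˡ m kernelˡ kernelʳ a))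
        (onBlocksˡ k (difference a) (λ _ → 0#) i))

    kernel-lr : ∀ a i → kernel (left′ a) (right i) ≈ 0#
    kernel-lr a i = reflexive
        (≡.trans (≡.cong (λ (f : V (k ℕ.+ k)) → f (right i)) (onBlocksˡ m kernelˡ kernelʳ a))
        (onBlocksʳ k (difference a) (λ _ → 0#) i))

    kernel-rl : ∀ a i → kernel (right′ a) (left i) ≈ 0#
    kernel-rl a i = reflexive
        (≡.trans (≡.cong (λ (f : V (k ℕ.+ k)) → f (left i)) (onBlocksʳ m kernelˡ kernelʳ a))
        (onBlocksˡ k (λ _ → 0#) (difference a) i))

    kernel-rr : ∀ a i → kernel (right′ a) (right i) ≈ difference a i
    kernel-rr a i = reflexive
        (≡.trans (≡.cong (λ (f : V (k ℕ.+ k)) → f (right i)) (onBlocksʳ m kernelˡ kernelʳ a))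
        (onBlocksʳ k (λ _ → 0#) (difference a) i))

    combine-kernelˡ : ∀ (c : V (m ℕ.+ m)) i → sum (λ l → c l * kernel l (left i)) ≈ sum
        (λ a → c (left′ a) * difference a i)
    combine-kernelˡ c i = trans (sum-split m (λ l → c l * kernel l (left i))) (trans
      (+-cong (sum-cong-≋ (λ a → *-congˡ {c (left′ a)} (kernel-ll a i)))
              (sum-zero (λ a → c (right′ a) * kernel (right′ a) (left i))
                  (λ a → trans (*-congˡ (kernel-rl a i)) (zeroʳ _))))
      (+-identityʳ _))

    combine-kernelʳ : ∀ (c : V (m ℕ.+ m)) i → sum (λ l → c l * kernel l (right i)) ≈ sum
        (λ a → c (right′ a) * difference a i)
    combine-kernelʳ c i = trans (sum-split m (λ l → c l * kernel l (right i))) (trans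
      (+-cong (sum-zero (λ a → c (left′ a) * kernel (left′ a) (right i))
          (λ a → trans (*-congˡ (kernel-lr a i)) (zeroʳ _)))
              (sum-cong-≋ (λ a → *-congˡ {c (right′ a)} (kernel-rr a i))))
      (+-identityˡ _))

    -- The kernel consists of the vectors whose two block sums vanish. Coordinates other than the
    -- first of each block serve as coefficients, so independence and spanning are both read off
    -- from them.
    multiplicity-0 : HasMultiplicity A 0# (m ℕ.+ m)
    multiplicity-0 = kernel , in-kernel , independent , spanning
      where
      null : ∀ w → sumˡ w ≈ 0# → sumʳ w ≈ 0# → InEigenspace A 0# w
      null w l≈0 r≈0 = vertex-elim k (λ v → (A ⊛ w) v ≈ 0# * w v)
        (λ i → trans (A⊛ˡ w i) (trans r≈0 (sym (zeroˡ _))))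
        (λ i → trans (A⊛ʳ w i) (trans l≈0 (sym (zeroˡ _))))
      in-kernel : ∀ l → InEigenspace A 0# (kernel l)
      in-kernel = vertex-elim m (λ l → InEigenspace A 0# (kernel l))
        (λ a → null (kernel (left′ a)) (trans (sum-cong-≋ (kernel-ll a)) (sum-difference a))
                                      (sum-zero (λ j → kernel (left′ a) (right j)) (kernel-lr a)))
        (λ a → null (kernel (right′ a)) (sum-zero (λ j → kernel (right′ a) (left j)) (kernel-rl a))
                                      (trans (sum-cong-≋ (kernel-rr a)) (sum-difference a)))
      independent : LinearlyIndependent kernel
      independent c combo = vertex-elim m (λ l → c l ≈ 0#)
        (λ a → trans (sym (combine-difference (λ b → c (left′ b)) a))
            (trans (sym (combine-kernelˡ c (suc a))) (combo (left (suc a)))))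
        (λ a → trans (sym (combine-difference (λ b → c (right′ b)) a))
            (trans (sym (combine-kernelʳ c (suc a))) (combo (right (suc a)))))
      spanning : ∀ w → InEigenspace A 0# w → InSpan kernel w
      spanning w Aw = c , vertex-elim k (λ v → w v ≈ sum (λ l → c l * kernel l v))
        (λ i → sym (trans (combine-kernelˡ c i) (trans
          (sum-cong-≋ (λ a → *-congʳ (reflexive (onBlocksˡ m cˡ cʳ a))))
          (expand-difference (λ j → w (left j)) (trans (sym (coordʳ Aw zero)) (zeroˡ _)) i))))
        (λ i → sym (trans (combine-kernelʳ c i) (trans
          (sum-cong-≋ (λ a → *-congʳ (reflexive (onBlocksʳ m cˡ cʳ a))))
          (expand-difference (λ j → w (right j)) (trans (sym (coordˡ Aw zero)) (zeroˡ _)) i))))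
        where
        cˡ cʳ : V m
        cˡ a = w (left (suc a))
        cʳ a = w (right (suc a))
        c : V (m ℕ.+ m)
        c = onBlocks m cˡ cʳ

    eigenvalues : ℕ → List Carrier
    eigenvalues r = replicate r 0# ++ [ - κ ]

    count-accept : ∀ {μ x} xs → μ ≈ x → count μ (x ∷ xs) ≡ suc (count μ xs)
    count-accept {μ} xs μ≈x = ≡.cong length (List.filter-accept (μ ≟_) μ≈x)

    count-reject : ∀ {μ x} xs → μ ≉ x → count μ (x ∷ xs) ≡ count μ xs
    count-reject {μ} xs μ≉x = ≡.cong length (List.filter-reject (μ ≟_) μ≉x)

    count-zeros-accept : ∀ {μ} r → μ ≈ 0# → count μ (eigenvalues r) ≡ r ℕ.+ count μ [ - κ ]
    count-zeros-accept zero    μ≈0 = ≡.refl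
    count-zeros-accept (suc r) μ≈0 = ≡.trans (count-accept (eigenvalues r) μ≈0)
        (≡.cong suc (count-zeros-accept r μ≈0))

    count-zeros-reject : ∀ {μ} r → μ ≉ 0# → count μ (eigenvalues r) ≡ count μ [ - κ ]
    count-zeros-reject zero    μ≉0 = ≡.refl
    count-zeros-reject (suc r) μ≉0 = ≡.trans (count-reject (eigenvalues r) μ≉0) (count-zeros-reject r μ≉0)

    -κ<0 : - κ < 0#
    -κ<0 = <-by 0<κ (solve 1 (λ k → :0 :- :- k := k) refl κ)

    zeros-sorted : ∀ r → Linked _≥_ (0# ∷ eigenvalues r)
    zeros-sorted zero    = <⇒≤ -κ<0 ∷ [-]
    zeros-sorted (suc r) = ≤-refl ∷ zeros-sorted r

    HasMultiplicity-cong : ∀ {μ ν n} → μ ≈ ν → HasMultiplicity A μ n → HasMultiplicity A ν n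
    HasMultiplicity-cong μ≈ν (v , Av , ind , spans) = v , (λ l → InEigenspace-cong A μ≈ν (v l) (Av l)) ,
        ind ,
      λ w Aw → spans w (InEigenspace-cong A (sym μ≈ν) w Aw)

    multiplicity : ∀ μ → HasMultiplicity A μ (count μ (κ ∷ eigenvalues (m ℕ.+ m)))
    multiplicity μ = by-cases (μ ≟ κ) (μ ≟ 0#) (μ ≟ (- κ))
      where
      by-cases : Dec (μ ≈ κ) → Dec (μ ≈ 0#) → Dec (μ ≈ - κ) →
                 HasMultiplicity A μ (count μ (κ ∷ eigenvalues (m ℕ.+ m)))
      by-cases (yes μ≈κ) _ _ = ≡.subst (HasMultiplicity A μ) (≡.sym
            (≡.trans (count-accept (eigenvalues (m ℕ.+ m)) μ≈κ)
                (≡.cong suc (≡.trans (count-zeros-reject (m ℕ.+ m) (<⇒≉ 0<μ))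
              (count-reject [] (<⇒≉ (<-trans -κ<0 0<μ)))))))
            (HasMultiplicity-cong (sym μ≈κ) multiplicity-κ)
        where
        0<μ : 0# < μ
        0<μ = <-respʳ-≈ (sym μ≈κ) 0<κ
      by-cases (no μ≉κ) (yes μ≈0) _ = ≡.subst (HasMultiplicity A μ) (≡.sym
            (≡.trans (count-reject (eigenvalues (m ℕ.+ m)) μ≉κ)
                (≡.trans (count-zeros-accept (m ℕ.+ m) μ≈0)
              (≡.trans (≡.cong (m ℕ.+ m ℕ.+_) (count-reject [] (<⇒≉ (<-respʳ-≈ (sym μ≈0) -κ<0))))
                  (ℕ.+-identityʳ _)))))
            (HasMultiplicity-cong (sym μ≈0) multiplicity-0)
      by-cases (no μ≉κ) (no μ≉0) (yes μ≈-κ) = ≡.subst (HasMultiplicity A μ) (≡.sym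
            (≡.trans (count-reject (eigenvalues (m ℕ.+ m)) μ≉κ)
                (≡.trans (count-zeros-reject (m ℕ.+ m) μ≉0) (count-accept [] μ≈-κ))))
            (HasMultiplicity-cong (sym μ≈-κ) multiplicity-neg-κ)
      by-cases (no μ≉κ) (no μ≉0) (no μ≉-κ) = ≡.subst (HasMultiplicity A μ) (≡.sym
            (≡.trans (count-reject (eigenvalues (m ℕ.+ m)) μ≉κ)
                (≡.trans (count-zeros-reject (m ℕ.+ m) μ≉0) (count-reject [] μ≉-κ))))
            (multiplicity-none μ≉0 μ≉κ μ≉-κ)

  module _ (em : ExcludedMiddle 0ℓ) (ℝ : CompleteOrderedField) where
    open Real ℝ

    second-eigenvalue : 1 ℕ.≤ m → IsSecondEigenvalue (adjacencyMatrix Kₖₖ) 0#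
    -- For `m = suc m′` the list of `m + m` zeros visibly begins with a zero, the entry after `κ`;
    -- the remaining zeros number `m′ + suc m′`.
    second-eigenvalue (ℕ.s≤s {n = m′} _) = fromℕ k , Spectrum.eigenvalues em ℝ (m′ ℕ.+ suc m′) ,
      <⇒≤ (Spectrum.0<κ em ℝ) ∷ Spectrum.zeros-sorted em ℝ (m′ ℕ.+ suc m′) , Spectrum.multiplicity em ℝ

    admissible : ∀ {θ} → 1 ℕ.≤ m → 0# < θ → Admissible k θ Kₖₖ
    admissible 1≤m 0<θ = connected , bipartite , regular , 0# , second-eigenvalue 1≤m , <⇒≤ 0<θ

-- Existence of the maximum order, and the theorem.

bounded-maximum : ExcludedMiddle 0ℓ → (P : ℕ → Set) → ∀ B → (∀ n → P n → n ℕ.≤ B) → ∃ P →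
                  Σ[ b ∈ ℕ ] P b × (∀ n → P n → n ℕ.≤ b)
bounded-maximum em P B bound (n , p) with em {P B}
... | yes pB = B , pB , bound
bounded-maximum em P zero bound (n , p) | no ¬pB =
  contradiction (≡.subst P (ℕ.n≤0⇒n≡0 (bound n p)) p) ¬pB
bounded-maximum em P (suc B) bound (n , p) | no ¬pB = bounded-maximum em P B
  (λ n p → ℕ.≤-pred (ℕ.≤∧≢⇒< (bound n p) (λ n≡B → ¬pB (≡.subst P n≡B p)))) (n , p)

module MaximumOrder (em : ExcludedMiddle 0ℓ) (ℝ : CompleteOrderedField) (k-2 : ℕ) where
  open Real ℝ
  open LinearAlgebra ℝ using (sum-const)
  open import Algebra.Properties.Semiring.Exp semiring using (_^_)

  k : ℕ
  k = suc (suc k-2)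

  open Polynomials ℝ k
  open Chebyshev ℝ q
  open BipartiteRegular em ℝ using (𝟙; module Deflation)
  open OrderBound em ℝ using (geometric; order-bound)
  open AdjacencyMatrix em ℝ

  0<q : 0# < q
  0<q = <-respʳ-≈ (solve 1 (λ n → :1 :+ n := :1 :+ (:1 :+ n) :- :1) refl (fromℕ k-2))
    (+-pos-nonneg 0<1 (fromℕ-nonneg k-2))

  0<κ : 0# < κ
  0<κ = +-pos-nonneg 0<1 (fromℕ-nonneg (suc k-2))

  fromℕ-mono : ∀ {m n} → m ℕ.≤ n → fromℕ m ≤ fromℕ n
  fromℕ-mono {n = n} ℕ.z≤n = fromℕ-nonneg n
  fromℕ-mono (ℕ.s≤s m≤n)   = ≤-by (0≤y-x (fromℕ-mono m≤n))
    (solve 2 (λ m n → :1 :+ n :- (:1 :+ m) := n :- m) refl _ _)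

  module _ {s} (0<s : 0# < s) (s²≈q : s * s ≈ q) where

    -- As `κ = s² + 1`, the difference is `(s − 1)²`. It places every `θ` below `2s` strictly below
    -- the eigenvalue `κ` of `𝟙`.
    2s≤κ : 2# * s ≤ κ
    2s≤κ = ≤-by (sq-nonneg (s - 1#)) (≈-by₂ 1# (- 1#) κ≈q+1 s²≈q
      (solve 3 (λ k q s → let o = :1 in k :- (o :+ o) :* s :- (s :- o) :* (s :- o)
         := o :* (k :- (q :+ o)) :+ :- o :* (s :* s :- q)) refl κ q s))

    module _ {e θ} (g-pos : ∀ j → j ℕ.≤ e → 0# < g j θ) (g-last : g (suc (suc e)) θ ≤ 0#)
             (0<θ : 0# < θ) (θ<κ : θ < κ) where

      G-pos : 0# < G k e θ
      G-pos = <-respʳ-≈ (sym (G≈g e θ)) (g-pos e ℕ.≤-refl)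

      module _ (G≉0 : G k e θ ≉ 0#) where

        c : Carrier
        c = (- F k (suc (suc e)) θ) ÷ G k e θ [ G≉0 ]

        gc≈ : g e θ * c ≈ g e θ - g (suc (suc e)) θ
        gc≈ = ≈-by₃ (- F k (suc (suc e)) θ) (F k (suc (suc e)) θ * proj₁ (inverse (G k e θ) G≉0)) (- 1#)
            (proj₂ (inverse (G k e θ) G≉0)) (G≈g e θ) (F≈g-g e θ)
          (solve 5 (λ f i G g g″ → g :* (:- f :* i) :- (g :- g″) := :- f :* (G :* i :- :1) :+ f :* i :*
              (G :- g) :+ :- :1 :* (f :- (g″ :- g)))
            refl (F k (suc (suc e)) θ) (proj₁ (inverse (G k e θ) G≉0)) (G k e θ) (g e θ)
                (g (suc (suc e)) θ))

        c-pos : 0# < c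
        c-pos = *-cancel-pos (g-pos e ℕ.≤-refl) (<-respʳ-≈ (sym gc≈) (+-pos-nonneg (g-pos e ℕ.≤-refl)
            (neg-nonneg g-last)))

        module _ (c≉0 : c ≉ 0#) where

          bound : Carrier
          bound = M k (suc (suc (suc (suc e)))) c c≉0

          nonempty-order≤ : ∀ n (Γ : Graph (suc n)) → Admissible k θ Γ → fromℕ (suc n) ≤ bound
          nonempty-order≤ n Γ (_ , bipartite , regular , μ₂ , isSecond , μ₂≤θ) =
            cancel (proj₂ (inverse c c≉0)) gc≈ (g-pos e ℕ.≤-refl) c-pos
                (≤-trans (≤-reflexive (*-congʳ (sym N≈)))
              (order-bound κ≈q+1 0<q structure (λ i j → indicator-idem Γ bipartite regular
                  (Graph.adj Γ i j))
                 (λ i j → indicator-zeroOrLarge Γ bipartite regular (Graph.adj Γ i j)) zero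
                 (λ i → g i θ) refl refl (λ i → refl) N 0<N 0<θ θ<κ
                 (Deflation.A-norm≤ structure 0<κ (proj₂ (proj₂ (inverse-pos 0<N))) isSecond μ₂≤θ 0<θ θ<κ
                     0<N)
                 e g-pos g-last))
            where
            structure = isBipartiteRegular Γ bipartite regular
            N = LinearAlgebra._∙_ ℝ {suc n} 𝟙 𝟙
            N≈ : N ≈ fromℕ (suc n)
            N≈ = trans (sum-const (suc n) (1# * 1#)) (solve 1 (λ n → n :* (:1 :* :1) := n) refl
                (fromℕ (suc n)))
            0<N : 0# < N
            0<N = <-respʳ-≈ (sym N≈) (+-pos-nonneg 0<1 (fromℕ-nonneg n))
            cancel : ∀ {N c c⁻¹ a a″ h Q₁ Q₂} → c * c⁻¹ ≈ 1# → a * c ≈ a - a″ → 0# < a → 0# < c →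
              N * (a - a″) ≤ 2# * (a * (Q₂ + Q₁) + (a - a″) * h) → N ≤ fromℕ 2 * (h + Q₁ * c⁻¹ + Q₂ * c⁻¹)
            cancel {N} {c} {c⁻¹} {a} {a″} {h} {Q₁} {Q₂} cc⁻¹≈1 ac≈ 0<a 0<c N≤ = ≤-by
              (*-cancel-nonneg (*-pos 0<a 0<c) (≤-by (0≤y-x N≤) (≈-by₂ (2# * a * (Q₁ + Q₂)) (2# * h - N)
                  cc⁻¹≈1 ac≈
                (solve 8 (λ N c i a b h Q₁ Q₂ → let o = :1 ; t = o :+ o in
                  a :* c :* ((o :+ (o :+ :0)) :* (h :+ Q₁ :* i :+ Q₂ :* i) :- N) :- :0
                  :- (t :* (a :* (Q₂ :+ Q₁) :+ (a :- b) :* h) :- N :* (a :- b))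
                  := t :* a :* (Q₁ :+ Q₂) :* (c :* i :- o) :+ (t :* h :- N) :* (a :* c :- (a :- b))) refl
                      N c c⁻¹ a a″ h Q₁ Q₂)))) refl

          open CompleteBipartite (suc k-2) using (Kₖₖ; admissible)

          order≤ : ∀ n (Γ : Graph n) → Admissible k θ Γ → fromℕ n ≤ bound
          order≤ (suc n) Γ adm = nonempty-order≤ n Γ adm
          -- Without a vertex there is no starting point `u` for walks. That the bound is
          -- nonnegative follows from its validity for `Kₖₖ`.
          order≤ zero    _ _   = ≤-trans (fromℕ-nonneg (k ℕ.+ k))
              (nonempty-order≤ _ Kₖₖ (admissible em ℝ (ℕ.s≤s ℕ.z≤n) 0<θ))

          -- The bound is real, so a natural number above it is taken as the start of the downward
          -- search for the largest admissible order.
          maximum-order : ∃ λ b → IsMaxOrder k θ b × fromℕ b ≤ bound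
          maximum-order = extract (bounded-maximum em (λ n → Σ[ Γ ∈ Graph n ] Admissible k θ Γ)
              (proj₁ arch)
              (λ n (Γ , adm) → ℕ.<⇒≤ (ℕ.≰⇒> λ B≤n → <⇒≱ (proj₂ arch)
                (≤-trans (≤-reflexive (*-identityʳ _)) (≤-trans (fromℕ-mono B≤n) (order≤ n Γ adm)))))
              (k ℕ.+ k , Kₖₖ , admissible em ℝ (ℕ.s≤s ℕ.z≤n) 0<θ))
            where
            arch = archimedean bound 0<1 (λ P → em)
            extract : (Σ[ b ∈ ℕ ] (Σ[ Γ ∈ Graph b ] Admissible k θ Γ) ×
                (∀ n → (Σ[ Γ ∈ Graph n ] Admissible k θ Γ) → n ℕ.≤ b)) →
                      ∃ λ b → IsMaxOrder k θ b × fromℕ b ≤ bound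
            extract (b , (Γ , adm) , largest) = b , ((Γ , adm) , λ n Γ′ adm′ → largest n (Γ′ , adm′)) ,
                order≤ b Γ adm

theorem4p7 : ExcludedMiddle 0ℓ → (ℝ : CompleteOrderedField) →
    let open CompleteOrderedField ℝ
        open Theory ℝ
    in
    (k : ℕ) → 2 ℕ.≤ k →
    Σ[ Λ ∈ (ℕ → Carrier) ] Σ[ s ∈ Carrier ]
      (∀ j → 1 ℕ.≤ j → IsLargestZero (G k j) (Λ j)) ×
      IsSqrt s (fromℕ k - 1#) ×
      (∀ x → (∃ λ j → 1 ℕ.≤ j × Λ j < x × x ≤ Λ (suc j))
             ⇔ (0# < x × x < fromℕ 2 * s)) ×
      (∀ t → 4 ℕ.≤ t → ∀ θ → Λ (t ∸ 3) < θ → θ ≤ Λ (t ∸ 2) →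
        Σ[ G≉0 ∈ G k (t ∸ 4) θ ≉ 0# ]
        let c = (- F k (t ∸ 2) θ) ÷ G k (t ∸ 4) θ [ G≉0 ] in
        Σ[ c≉0 ∈ c ≉ 0# ]
        ∃ λ b → IsMaxOrder k θ b × fromℕ b ≤ M k t c c≉0)
theorem4p7 em ℝ (suc (suc k-2)) (ℕ.s≤s (ℕ.s≤s ℕ.z≤n)) = from-sqrt (sqrt-q 0<q)
  where
  open Real ℝ
  open MaximumOrder em ℝ k-2
  open Polynomials ℝ k
  open Chebyshev ℝ q
  from-sqrt : (Σ[ s ∈ Carrier ] 0# < s × s * s ≈ q) → _
  -- `ρ j` is the largest zero of `G k (suc j)`, hence the shift; the value at index zero is a
  -- default.
  from-sqrt (s , 0<s , s²≈q) = (λ j → ρ₀ (j ∸ 1)) , s , largest , (<⇒≤ 0<s , s²≈q) , union , bounded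
    where
    ρ₀ : ℕ → Carrier
    ρ₀ = ρ 0<q 0<s s²≈q
    root : ∀ j → LargestRoot 0<q 0<s s²≈q j
    root = largestRoot 0<q 0<s s²≈q
    2s≈ : 2# * s ≈ fromℕ 2 * s
    2s≈ = solve 1 (λ s → :2 :* s := (:1 :+ (:1 :+ :0)) :* s) refl s
    largest : ∀ j → 1 ℕ.≤ j → IsLargestZero (G k j) (ρ₀ (j ∸ 1))
    largest (suc j) _ = trans (G≈g (suc j) _) (LargestRoot.isRoot (root j)) ,
      λ y Gy≈0 → ρ-largest 0<q 0<s s²≈q j y (trans (sym (G≈g (suc j) y)) Gy≈0)
    union : ∀ x → (∃ λ j → 1 ℕ.≤ j × ρ₀ (j ∸ 1) < x × x ≤ ρ₀ j) ⇔ (0# < x × x < fromℕ 2 * s)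
    union x = mk⇔
      (λ (j , _ , ρ<x , x≤ρ) → ≤-<-trans (LargestRoot.0≤root (root (j ∸ 1))) ρ<x ,
        <-respʳ-≈ 2s≈ (≤-<-trans x≤ρ (LargestRoot.root<2s (root j))))
      (λ (0<x , x<2s) →
        let (j , x≤ρ) = ρ-cofinal 0<q 0<s s²≈q em 0<x (<-respʳ-≈ (sym 2s≈) x<2s)
            (i , ρ<x , x≤ρ′) = bracket 0<q 0<s s²≈q j 0<x x≤ρ
        in suc i , ℕ.s≤s ℕ.z≤n , ρ<x , x≤ρ′)
    bounded : ∀ t → 4 ℕ.≤ t → ∀ θ → ρ₀ (t ∸ 3 ∸ 1) < θ → θ ≤ ρ₀ (t ∸ 2 ∸ 1) →
        Σ[ G≉0 ∈ G k (t ∸ 4) θ ≉ 0# ]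
        Σ[ c≉0 ∈ (- F k (t ∸ 2) θ) ÷ G k (t ∸ 4) θ [ G≉0 ] ≉ 0# ]
        ∃ λ b → IsMaxOrder k θ b × fromℕ b ≤ M k t ((- F k (t ∸ 2) θ) ÷ G k (t ∸ 4) θ [ G≉0 ]) c≉0
    bounded (suc (suc (suc (suc e)))) (ℕ.s≤s (ℕ.s≤s (ℕ.s≤s (ℕ.s≤s ℕ.z≤n)))) θ ρ<θ θ≤ρ =
      G≉0 , c≉0 , maximum-order 0<s s²≈q g-pos g-last 0<θ θ<κ G≉0 c≉0
      where
      -- With `t = e + 4` the hypotheses read `ρ e < θ ≤ ρ (suc e)`: at `θ`, `g` is positive up to
      -- index `e + 1` and nonpositive at `e + 2`.
      positive = ρ<⇒positive 0<q 0<s s²≈q e ρ<θ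
      g-pos : ∀ j → j ℕ.≤ e → 0# < g j θ
      g-pos j j≤e = positive-all 0<q (suc e) positive j (ℕ.m≤n⇒m≤1+n j≤e)
      g-last = ≤ρ⇒nonpositive 0<q 0<s s²≈q (suc e) positive θ≤ρ
      0<θ = ≤-<-trans (LargestRoot.0≤root (root e)) ρ<θ
      θ<κ = ≤-<-trans θ≤ρ (<-≤-trans (LargestRoot.root<2s (root (suc e))) (2s≤κ 0<s s²≈q))
      G≉0 = <⇒≉ (G-pos 0<s s²≈q g-pos g-last 0<θ θ<κ)
      c≉0 = <⇒≉ (c-pos 0<s s²≈q g-pos g-last 0<θ θ<κ G≉0)
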